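{- $\rho\tau(K_{12}, o(\mathbf{Q}(4,n))) \le 4/13$. That is, for every $\gamma>0$ there is $\delta>0$ such that every $n$-vertex $K_{12}$-free graph $G$ with $\alpha(G)\le \delta\,\mathbf{Q}(4,n)$ satisfies $e(G)\le (4/13+\gamma)n^2$ for all sufficiently large $n$.
   Context: For a graph $H$ and a function $f(n)$, the Ramsey–Turán number $\mathbf{RT}(n,H,f(n))$ is the maximum number of edges in an $n$-vertex $H$-free graph with independence number at most $f(n)$. Let $\overline{\rho\tau}(H,f)=\limsup_{n\to\infty}\mathbf{RT}(n,H,f(n))/n^2$ and $\underline{\rho\tau}(H,f)=\liminf_{n\to\infty}\mathbf{RT}(n,H,f(n))/n^2$; when they coincide, their common value is $\rho\tau(H,f)$. Further $\rho\tau(H,o(f)) := \lim_{\delta\to 0}\rho\tau(H,\delta f)$; an upper bound $\rho\tau(H,o(f))\le c$ means $\lim_{\delta\to0}\overline{\rho\tau}(H,\delta f)\le c$. The inverse Ramsey number $\mathbf{Q}(t,n)$ is the minimum independence number of a $K_t$-free graph on $n$ vertices. -}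

module Defs where

open import Data.Nat using (ℕ; _≤_; _<ᵇ_)
open import Data.Bool using (Bool; true; false; if_then_else_; _∧_)
open import Data.Fin using (Fin; toℕ)
open import Data.Fin.Subset using (Subset; _∈_; ∣_∣)
open import Data.List using (map; allFin)
open import Data.Nat.ListAction using (sum)
open import Data.Product using (Σ; ∃; _×_)
open import Relation.Nullary using (¬_)
open import Relation.Binary.PropositionalEquality using (_≡_; _≢_)
open import Data.Integer using (+_)
open import Data.Rational using (ℚ; _/_)

record Graph (n : ℕ) : Set where
  field
    adj    : Fin n → Fin n → Bool
    sym    : ∀ i j → adj i j ≡ adj j i
    irrefl : ∀ i → adj i i ≡ false
open Graph public

Independent : {n : ℕ} → Graph n → Subset n → Set
Independent G S = ∀ i j → i ∈ S → j ∈ S → adj G i j ≡ false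

Clique : {n : ℕ} → Graph n → Subset n → Set
Clique G S = ∀ i j → i ∈ S → j ∈ S → i ≢ j → adj G i j ≡ true

KFree : {n : ℕ} → ℕ → Graph n → Set
KFree t G = ¬ (Σ _ λ S → Clique G S × ∣ S ∣ ≡ t)

IsIndepNum : {n : ℕ} → Graph n → ℕ → Set
IsIndepNum G a =
  (Σ _ λ S → Independent G S × ∣ S ∣ ≡ a) × (∀ S → Independent G S → ∣ S ∣ ≤ a)

IsQ : ℕ → (n : ℕ) → ℕ → Set
IsQ t n q =
  (Σ (Graph n) λ G → KFree t G × IsIndepNum G q) ×
  (∀ (G : Graph n) → KFree t G → ∀ a → IsIndepNum G a → q ≤ a)

edges : {n : ℕ} → Graph n → ℕ
edges {n} G = sum (map (λ i → sum (map (λ j →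
  if (toℕ i <ᵇ toℕ j) ∧ adj G i j then 1 else 0) (allFin n))) (allFin n))

ℕtoℚ : ℕ → ℚ
ℕtoℚ m = (+ m) / 1

{-# OPTIONS --safe #-}

-- If α(G) ≤ δ Q(4,n) with δ small, then every set of linear size contains a K₄: otherwise boundedly many copies of it
-- would give a K₄-free graph on n vertices whose independence number is too small.
--
-- Instead of a regularity partition, take k copies of the uniform measure on the vertices (k a constant) and condition
-- them on large sets as long as this increases the energy Σ (w + η w²) of the pair densities w. Densities are bilinear, so
-- the average energy over a splitting of one measure never drops, and it rises by a constant if the splitting witnesses an
-- irregular pair. After boundedly many steps all pairs are regular, and the average density has hardly decreased.
--
-- Round every pair density w up to a level in 0, …, 4, where level l + 1 means w > l / 4. In a K₄ taken from a cluster, some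
-- l vertices have a common neighbourhood of positive measure in a cluster at level l, so for clusters i₁, …, iₘ with positive
-- levels the i_s contribute max(1, 4 − Σ_{t>s} (4 − l(i_s,i_t))) vertices each to a clique. If the edge density exceeds
-- 8/13, deleting clusters of low degree leaves a family in which, for every weighting c of clusters, some further cluster has
-- weighted level sum above (32/13) Σ c. Choosing the weightings well forces a configuration with a clique of size 12; this is a
-- finite game, and its winning strategy is checked by evaluation.
module Submission where

-- Regularity of a pair quantifies over all pieces of two measures, so it is not decided, and the
-- independence number is also obtained only up to double negation. Hence these existence steps have
-- the form `(... → ⊥) → ⊥`, and only the final comparison of rationals is decided. Measures avoid
-- rounding and exceptional sets. The k initial copies coincide, which does no harm because levels
-- and energy only concern distinct indices.
--
-- In the energy, the linear part of `w + η w²` preserves the average density, with a loss of at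
-- most η per pair. The quadratic part is strictly convex and pays for each irregular pair.
--
-- A level is worth vertices for the following reason: if the four vertices of a K₄ have degree
-- above l/4 into a measure, their degrees sum to more than l, so a set of positive measure sees l +
-- 1 of the four, and always the same ones. The constant 32/13 is four times the pair density 8/13 =
-- 2 · 4/13. A refuted state stays refuted when levels are raised, so only minimal responses have to
-- be examined; this keeps the evaluation small.

-- Sums and inequalities of rationals
module Rationals where

  open import Data.Bool using (Bool; true; false; if_then_else_)
  open import Data.Empty using (⊥; ⊥-elim)
  open import Data.List as List using (List; []; _∷_)
  open import Data.List.Membership.Propositional using (_∈_)
  open import Data.List.Relation.Unary.Any using (here; there)
  open import Data.Fin as Fin using (Fin)
  open import Data.List.Relation.Unary.All using (All; []; _∷_)
  open import Data.List.Relation.Unary.AllPairs using ([]; _∷_)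
  open import Data.List.Relation.Unary.Unique.Propositional using (Unique)
  open import Data.Nat.ListAction using (sum)
  open import Data.Nat as ℕ using (ℕ; zero; suc)
  import Data.Nat.Properties as ℕₚ
  open import Data.Product using (∃-syntax; _×_; _,_)
  open import Data.Sum using (_⊎_; inj₁; inj₂)
  open import Data.Rational using (ℚ; 0ℚ; 1ℚ; _≤_; _<_; _+_; _*_; _-_; -_; _≟_; _≤?_; 1/_; Positive; positive; nonNegative; NonZero)
  import Data.Rational.Properties as ℚₚ
  open import Relation.Nullary.Decidable.Core using (dec⇒maybe)
  open import Relation.Nullary using (yes; no; does)
  open import Relation.Binary.PropositionalEquality using (_≡_; _≢_; refl; sym; trans; cong; cong₂; subst; subst₂)
  open import Tactic.RingSolver using (solve-∀)
  open import Tactic.RingSolver.Core.AlmostCommutativeRing using (AlmostCommutativeRing; fromCommutativeRing)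

  ℚ-ring : AlmostCommutativeRing _ _
  ℚ-ring = fromCommutativeRing ℚₚ.+-*-commutativeRing λ x → dec⇒maybe (0ℚ ≟ x)

  gap : ∀ {p q} → p ≤ q → 0ℚ ≤ q - p
  gap {p} {q} p≤q = subst (_≤ q - p) (ℚₚ.+-inverseʳ p) (ℚₚ.+-monoˡ-≤ (- p) p≤q)

  gap< : ∀ {p q} → p < q → 0ℚ < q - p
  gap< {p} {q} p<q = subst (_< q - p) (ℚₚ.+-inverseʳ p) (ℚₚ.+-monoˡ-< (- p) p<q)

  restore : ∀ p q → q - p + p ≡ q
  restore = solve-∀ ℚ-ring

  -- Most rational inequalities below are proved by a certificate: the ring solver rewrites the
  -- difference of the two sides as a sum of products of quantities known to be non-negative, and
  -- `⊕` and `⊗` assemble the sign.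
  close : ∀ {p q r} → 0ℚ ≤ r → q - p ≡ r → p ≤ q
  close {p} {q} 0≤r refl = subst₂ _≤_ (ℚₚ.+-identityˡ p) (restore p q) (ℚₚ.+-monoˡ-≤ p 0≤r)

  close< : ∀ {p q r} → 0ℚ < r → q - p ≡ r → p < q
  close< {p} {q} 0<r refl = subst₂ _<_ (ℚₚ.+-identityˡ p) (restore p q) (ℚₚ.+-monoˡ-< p 0<r)

  infixl 6 _⊕_ _⊕<_
  infixl 7 _⊗_ _⊗<_
  _⊕_ : ∀ {p q} → 0ℚ ≤ p → 0ℚ ≤ q → 0ℚ ≤ p + q
  _⊕_ = ℚₚ.+-mono-≤

  _⊕<_ : ∀ {p q} → 0ℚ ≤ p → 0ℚ < q → 0ℚ < p + q
  _⊕<_ = ℚₚ.+-mono-≤-<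

  _⊗_ : ∀ {p q} → 0ℚ ≤ p → 0ℚ ≤ q → 0ℚ ≤ p * q
  _⊗_ {p} {q} 0≤p 0≤q = subst (_≤ p * q) (ℚₚ.*-zeroʳ p) (ℚₚ.*-monoˡ-≤-nonNeg p ⦃ nonNegative 0≤p ⦄ 0≤q)

  _⊗<_ : ∀ {p q} → 0ℚ < p → 0ℚ < q → 0ℚ < p * q
  _⊗<_ {p} {q} 0<p 0<q = subst (_< p * q) (ℚₚ.*-zeroʳ p) (ℚₚ.*-monoʳ-<-pos p ⦃ positive 0<p ⦄ 0<q)

  square≥0 : ∀ x → 0ℚ ≤ x * x
  square≥0 x with ℚₚ.≤-total 0ℚ x
  ... | inj₁ 0≤x = 0≤x ⊗ 0≤x
  ... | inj₂ x≤0 = subst (0ℚ ≤_) (neg-square x) (ℚₚ.neg-antimono-≤ x≤0 ⊗ ℚₚ.neg-antimono-≤ x≤0)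
    where
    neg-square : ∀ x → (- x) * (- x) ≡ x * x
    neg-square = solve-∀ ℚ-ring

  absurd : ∀ {p} → 0ℚ < p → p ≤ 0ℚ → ⊥
  absurd 0<p p≤0 = ℚₚ.<-irrefl refl (ℚₚ.<-≤-trans 0<p p≤0)

  inverse : ∀ {p} → 0ℚ < p → ∃[ r ] (0ℚ < r × p * r ≡ 1ℚ)
  inverse {p} 0<p = 1/ p , ℚₚ.positive⁻¹ (1/ p) ⦃ ℚₚ.1/pos⇒pos p ⦄ , ℚₚ.*-inverseʳ p
    where instance
      _ : Positive p
      _ = positive 0<p
      _ : NonZero p
      _ = ℚₚ.pos⇒nonZero p

  cancel-≤ : ∀ {r p q} → 0ℚ < r → r * p ≤ r * q → p ≤ q
  cancel-≤ {r} 0<r = ℚₚ.*-cancelˡ-≤-pos r ⦃ positive 0<r ⦄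

  -- Finite sums

  module _ {A : Set} where

    ∑ : List A → (A → ℚ) → ℚ
    ∑ []       f = 0ℚ
    ∑ (x ∷ xs) f = f x + ∑ xs f

    ∑-cong : ∀ xs {f g : A → ℚ} → (∀ x → f x ≡ g x) → ∑ xs f ≡ ∑ xs g
    ∑-cong []       e = refl
    ∑-cong (x ∷ xs) e = cong₂ _+_ (e x) (∑-cong xs e)

    ∑-mono : ∀ xs {f g : A → ℚ} → (∀ x → f x ≤ g x) → ∑ xs f ≤ ∑ xs g
    ∑-mono []       le = ℚₚ.≤-refl
    ∑-mono (x ∷ xs) le = ℚₚ.+-mono-≤ (le x) (∑-mono xs le)

    ∑-nonNeg : ∀ xs {f : A → ℚ} → (∀ x → 0ℚ ≤ f x) → 0ℚ ≤ ∑ xs f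
    ∑-nonNeg []       nn = ℚₚ.≤-refl
    ∑-nonNeg (x ∷ xs) nn = nn x ⊕ ∑-nonNeg xs nn

    ∑-linear : ∀ xs (p q : ℚ) (f g : A → ℚ) → ∑ xs (λ x → p * f x + q * g x) ≡ p * ∑ xs f + q * ∑ xs g
    ∑-linear []       p q f g = zeros p q
      where zeros : ∀ p q → 0ℚ ≡ p * 0ℚ + q * 0ℚ
            zeros = solve-∀ ℚ-ring
    ∑-linear (x ∷ xs) p q f g = trans (cong (p * f x + q * g x +_) (∑-linear xs p q f g)) (regroup p q (f x) (g x) _ _)
      where regroup : ∀ p q a b c d → p * a + q * b + (p * c + q * d) ≡ p * (a + c) + q * (b + d)
            regroup = solve-∀ ℚ-ring

    ∑-+ : ∀ xs (f g : A → ℚ) → ∑ xs (λ x → f x + g x) ≡ ∑ xs f + ∑ xs g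
    ∑-+ []       f g = refl
    ∑-+ (x ∷ xs) f g = trans (cong (f x + g x +_) (∑-+ xs f g)) (regroup (f x) (g x) _ _)
      where regroup : ∀ a b c d → a + b + (c + d) ≡ a + c + (b + d)
            regroup = solve-∀ ℚ-ring

    ∑-scale : ∀ xs (p : ℚ) (f : A → ℚ) → ∑ xs (λ x → p * f x) ≡ p * ∑ xs f
    ∑-scale []       p f = sym (ℚₚ.*-zeroʳ p)
    ∑-scale (x ∷ xs) p f = trans (cong (p * f x +_) (∑-scale xs p f)) (sym (ℚₚ.*-distribˡ-+ p (f x) _))

    ∑-gain : ∀ xs {f g : A → ℚ} {i δ} → (∀ x → f x ≤ g x) → i ∈ xs → f i + δ ≤ g i → ∑ xs f + δ ≤ ∑ xs g
    ∑-gain (x ∷ xs) {f} {g} {δ = δ} le (here refl) ge =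
      subst (_≤ g x + ∑ xs g) (swap (f x) δ (∑ xs f)) (ℚₚ.+-mono-≤ ge (∑-mono xs le))
      where swap : ∀ a b c → a + b + c ≡ a + c + b
            swap = solve-∀ ℚ-ring
    ∑-gain (x ∷ xs) {f} {g} {δ = δ} le (there i∈) ge =
      subst (_≤ g x + ∑ xs g) (sym (ℚₚ.+-assoc (f x) _ δ)) (ℚₚ.+-mono-≤ (le x) (∑-gain xs le i∈ ge))

  ∑-swap : ∀ {A B : Set} (xs : List A) (ys : List B) (f : A → B → ℚ) →
    ∑ xs (λ x → ∑ ys (f x)) ≡ ∑ ys (λ y → ∑ xs (λ x → f x y))
  ∑-swap []       ys f = sym (zero-sum ys)
    where zero-sum : ∀ {B : Set} (ys : List B) → ∑ ys (λ _ → 0ℚ) ≡ 0ℚ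
          zero-sum []       = refl
          zero-sum (y ∷ ys) = cong (0ℚ +_) (zero-sum ys)
  ∑-swap (x ∷ xs) ys f = trans (cong (∑ ys (f x) +_) (∑-swap xs ys f)) (sym (∑-+ ys (f x) _))

  -- Natural numbers as rationals

  ofℕ : ℕ → ℚ
  ofℕ zero    = 0ℚ
  ofℕ (suc n) = 1ℚ + ofℕ n

  0<1 : 0ℚ < 1ℚ
  0<1 = ℚₚ.positive⁻¹ 1ℚ

  0≤1 : 0ℚ ≤ 1ℚ
  0≤1 = ℚₚ.<⇒≤ 0<1

  ofℕ≥0 : ∀ n → 0ℚ ≤ ofℕ n
  ofℕ≥0 zero    = ℚₚ.≤-refl
  ofℕ≥0 (suc n) = 0≤1 ⊕ ofℕ≥0 n

  ofℕ>0 : ∀ n → 0ℚ < ofℕ (suc n)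
  ofℕ>0 n = subst (0ℚ <_) (ℚₚ.+-comm (ofℕ n) 1ℚ) (ofℕ≥0 n ⊕< 0<1)

  ofℕ-+ : ∀ m n → ofℕ (m ℕ.+ n) ≡ ofℕ m + ofℕ n
  ofℕ-+ zero    n = sym (ℚₚ.+-identityˡ (ofℕ n))
  ofℕ-+ (suc m) n = trans (cong (1ℚ +_) (ofℕ-+ m n)) (sym (ℚₚ.+-assoc 1ℚ (ofℕ m) (ofℕ n)))

  ofℕ-* : ∀ m n → ofℕ (m ℕ.* n) ≡ ofℕ m * ofℕ n
  ofℕ-* zero    n = sym (ℚₚ.*-zeroˡ (ofℕ n))
  ofℕ-* (suc m) n = trans (ofℕ-+ n (m ℕ.* n)) (trans (cong (ofℕ n +_) (ofℕ-* m n)) (distribute (ofℕ m) (ofℕ n)))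
    where
    distribute : ∀ a b → b + a * b ≡ (1ℚ + a) * b
    distribute = solve-∀ ℚ-ring

  ofℕ-mono : ∀ {m n} → m ℕ.≤ n → ofℕ m ≤ ofℕ n
  ofℕ-mono {n = n} ℕ.z≤n = ofℕ≥0 n
  ofℕ-mono (ℕ.s≤s m≤n)   = ℚₚ.+-monoʳ-≤ 1ℚ (ofℕ-mono m≤n)

  ofℕ-reflects-< : ∀ {m n} → ofℕ m < ofℕ n → m ℕ.< n
  ofℕ-reflects-< {m} {n} lt with m ℕₚ.<? n
  ... | yes m<n = m<n
  ... | no m≮n  = ⊥-elim (ℚₚ.<-irrefl refl (ℚₚ.<-≤-trans lt (ofℕ-mono (ℕₚ.≮⇒≥ m≮n))))

  ofℕ-reflects-≤ : ∀ {m n} → ofℕ m ≤ ofℕ n → m ℕ.≤ n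
  ofℕ-reflects-≤ {m} {n} le = ℕₚ.≮⇒≥ λ n<m →
    ℚₚ.<-irrefl refl (ℚₚ.<-≤-trans (close< 0<1 (next (ofℕ n))) (ℚₚ.≤-trans (ofℕ-mono n<m) le))
    where
    next : ∀ n → 1ℚ + n - n ≡ 1ℚ
    next = solve-∀ ℚ-ring

  infix 4 _≤⊎>_
  _≤⊎>_ : ∀ p q → p ≤ q ⊎ q < p
  p ≤⊎> q with p ≤? q
  ... | yes p≤q = inj₁ p≤q
  ... | no p≰q  = inj₂ (ℚₚ.≰⇒> p≰q)

  times : ℕ → ℚ → ℚ
  times zero    b = 0ℚ
  times (suc n) b = b + times n b

  times-ofℕ : ∀ n b → times n b ≡ ofℕ n * b
  times-ofℕ zero    b = sym (ℚₚ.*-zeroˡ b)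
  times-ofℕ (suc n) b = trans (cong (b +_) (times-ofℕ n b)) (distribute b (ofℕ n))
    where
    distribute : ∀ b n → b + n * b ≡ (1ℚ + n) * b
    distribute = solve-∀ ℚ-ring

  -- This is c ε^(2n), accumulated so as to match the recursion of `regularise`, where one energy
  -- step conditions at most twice by ε.
  scale : ℚ → ℕ → ℚ → ℚ
  scale ε zero    c = c
  scale ε (suc n) c = scale ε n (c * ε * ε)

  scale>0 : ∀ {ε} → 0ℚ < ε → ∀ n {c} → 0ℚ < c → 0ℚ < scale ε n c
  scale>0 ε>0 zero    c>0 = c>0
  scale>0 ε>0 (suc n) c>0 = scale>0 ε>0 n (c>0 ⊗< ε>0 ⊗< ε>0)

  power : ℚ → ℕ → ℚ
  power τ zero    = 1ℚ
  power τ (suc n) = power τ n * τ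

  power>0 : ∀ {τ} → 0ℚ < τ → ∀ n → 0ℚ < power τ n
  power>0 τ>0 zero    = 0<1
  power>0 τ>0 (suc n) = power>0 τ>0 n ⊗< τ>0

  power-anti : ∀ {τ} → 0ℚ < τ → τ ≤ 1ℚ → ∀ {m n} → m ℕ.≤′ n → power τ n ≤ power τ m
  power-anti τ>0 τ≤1 ℕ.≤′-refl = ℚₚ.≤-refl
  power-anti {τ} τ>0 τ≤1 {m} {suc n} (ℕ.≤′-step le) =
    ℚₚ.≤-trans (close (ℚₚ.<⇒≤ (power>0 τ>0 n) ⊗ gap τ≤1) (factor (power τ n) τ)) (power-anti τ>0 τ≤1 le)
    where
    factor : ∀ p t → p - p * t ≡ p * (1ℚ - t)
    factor = solve-∀ ℚ-ring

  ∑-const : ∀ {A : Set} (xs : List A) c → ∑ xs (λ _ → c) ≡ ofℕ (List.length xs) * c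
  ∑-const []       c = sym (ℚₚ.*-zeroˡ c)
  ∑-const (x ∷ xs) c = trans (cong (c +_) (∑-const xs c)) (distribute c (ofℕ (List.length xs)))
    where
    distribute : ∀ c n → c + n * c ≡ (1ℚ + n) * c
    distribute = solve-∀ ℚ-ring

  bit : Bool → ℚ
  bit b = if b then 1ℚ else 0ℚ

  bit≥0 : ∀ b → 0ℚ ≤ bit b
  bit≥0 true  = 0≤1
  bit≥0 false = ℚₚ.≤-refl

  bit≤1 : ∀ b → bit b ≤ 1ℚ
  bit≤1 true  = ℚₚ.≤-refl
  bit≤1 false = 0≤1

  ofℕ-sum : ∀ {A : Set} (xs : List A) f → ofℕ (sum (List.map f xs)) ≡ ∑ xs (λ x → ofℕ (f x))
  ofℕ-sum []       f = refl
  ofℕ-sum (x ∷ xs) f = trans (ofℕ-+ (f x) _) (cong (ofℕ (f x) +_) (ofℕ-sum xs f))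

  -- The largest l + 1 ≤ n with l + g ≤ y, or 0. The offset `g` raises the thresholds, so that a
  -- positive level leaves room for regularity errors; the price is the `g` in `levelUpTo-upper`.
  levelUpTo : ℚ → ℕ → ℚ → ℕ
  levelUpTo g zero    y = 0
  levelUpTo g (suc n) y with ofℕ n + g ≤? y
  ... | yes _ = suc n
  ... | no _  = levelUpTo g n y

  levelUpTo-≤ : ∀ g n y → levelUpTo g n y ℕ.≤ n
  levelUpTo-≤ g zero    y = ℕ.z≤n
  levelUpTo-≤ g (suc n) y with ofℕ n + g ≤? y
  ... | yes _ = ℕₚ.≤-refl
  ... | no _  = ℕₚ.m≤n⇒m≤1+n (levelUpTo-≤ g n y)

  levelUpTo-lower : ∀ g n {y l} → suc l ℕ.≤ levelUpTo g n y → ofℕ l + g ≤ y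
  levelUpTo-lower g (suc n) {y} le with ofℕ n + g ≤? y
  ... | yes n≤y = ℚₚ.≤-trans (ℚₚ.+-monoˡ-≤ g (ofℕ-mono (ℕₚ.≤-pred le))) n≤y
  ... | no _    = levelUpTo-lower g n le

  levelUpTo-upper : ∀ g n {y} → y ≤ ofℕ n + g → y ≤ ofℕ (levelUpTo g n y) + g
  levelUpTo-upper g zero    y≤ = y≤
  levelUpTo-upper g (suc n) {y} y≤ with ofℕ n + g ≤? y
  ... | yes _  = y≤
  ... | no n≰y = levelUpTo-upper g n (ℚₚ.<⇒≤ (ℚₚ.≰⇒> n≰y))

  ∑-indicator : ∀ {k} (a : Fin k) {xs} → Unique xs → ∑ xs (λ b → bit (does (a Fin.≟ b))) ≤ 1ℚ
  ∑-indicator a {[]}     []       = 0≤1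
  ∑-indicator a {x ∷ xs} (x# ∷ u) with a Fin.≟ x
  ... | yes refl = ℚₚ.≤-reflexive (cong (1ℚ +_) (none x#))
    where
    none : ∀ {ys} → All (a ≢_) ys → ∑ ys (λ b → bit (does (a Fin.≟ b))) ≡ 0ℚ
    none []                   = refl
    none {y ∷ _} (a≢y ∷ rest) with a Fin.≟ y
    ... | yes a≡y = ⊥-elim (a≢y a≡y)
    ... | no _    = cong (0ℚ +_) (none rest)
  ... | no _     = subst (_≤ 1ℚ) (sym (ℚₚ.+-identityˡ _)) (∑-indicator a u)

-- The extension game on levels between clusters
module Game where

  open import Data.Bool using (Bool; true; false; not; _∧_; _∨_; T)
  open import Data.Bool.Properties using (T?; T-∧; T-∨; T-≡)
  open import Data.Bool.ListAction using (all; any)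
  open import Data.Empty using (⊥; ⊥-elim)
  open import Data.Fin using (Fin; zero; suc)
  import Data.Fin.Properties as Finₚ
  open import Data.List as List using (List; []; _∷_; _++_; concatMap)
  open import Data.List.Membership.Propositional using (_∈_)
  import Data.List.Membership.Propositional.Properties as Mem
  open import Data.List.Relation.Unary.All as All using (All; []; _∷_)
  import Data.List.Relation.Unary.All.Properties as Allₚ
  open import Data.List.Relation.Unary.Any as Any using (Any; here; there)
  import Data.List.Relation.Unary.Any.Properties as Anyₚ
  open import Data.Nat using (ℕ; zero; suc; _+_; _*_; _∸_; _≤_; _<_; _⊔_; z≤n; s≤s; _≤ᵇ_; _<ᵇ_; pred)
  import Data.Nat.Properties as ℕₚ
  open import Data.Product using (∃; ∃-syntax; _×_; _,_; proj₁; proj₂)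
  open import Data.Sum using (_⊎_; [_,_]′)
  open import Data.Vec as Vec using (Vec; []; _∷_; lookup)
  import Data.Vec.Properties as Vecₚ
  open import Data.Vec.Relation.Binary.Pointwise.Inductive as PW using (Pointwise; []; _∷_)
  open import Data.Vec.Relation.Unary.All using ([]; _∷_) renaming (All to VAll)
  import Data.Vec.Relation.Unary.All.Properties as VAllₚ
  open import Function using (Equivalence)
  open import Relation.Nullary using (¬_; Dec; yes; no; does)
  open import Relation.Binary.PropositionalEquality using (_≡_; refl; sym; trans; cong₂; subst)

  -- Each cluster, newest first, comes with lower bounds for its levels towards the older ones.
  infixr 5 _∷_
  data State : ℕ → Set where
    []  : State 0
    _∷_ : ∀ {n} → Vec ℕ n → State n → State (suc n)

  level : ∀ {n} → State n → Fin n → Fin n → ℕ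
  level (r ∷ s) zero    zero    = 0
  level (r ∷ s) zero    (suc j) = lookup r j
  level (r ∷ s) (suc i) zero    = lookup r i
  level (r ∷ s) (suc i) (suc j) = level s i j

  level-sym : ∀ {n} (s : State n) i j → level s i j ≡ level s j i
  level-sym (r ∷ s) zero    zero    = refl
  level-sym (r ∷ s) zero    (suc j) = refl
  level-sym (r ∷ s) (suc i) zero    = refl
  level-sym (r ∷ s) (suc i) (suc j) = level-sym s i j

  -- Intersecting subsets of the same four vertices loses at most 4 - l for a subset of size l. If
  -- nothing is certain to be left, a single vertex is kept instead, which positive levels allow.
  headSize : ∀ {n} → Vec ℕ n → ℕ
  headSize r = 1 ⊔ (4 ∸ Vec.sum (Vec.map (4 ∸_) r))

  cliqueSize : ∀ {n} → State n → ℕ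
  cliqueSize []      = 0
  cliqueSize (r ∷ s) = headSize r + cliqueSize s

  positive : ∀ {n} → State n → Bool
  positive []      = true
  positive (r ∷ s) = Vec.foldr′ (λ l b → (1 ≤ᵇ l) ∧ b) true r ∧ positive s

  clamp : ∀ n → ℕ → Fin (suc n)
  clamp zero    _       = zero
  clamp (suc n) zero    = zero
  clamp (suc n) (suc i) = suc (clamp n i)

  -- Plain numbers keep the strategy readable. Clamping and padding cannot make the check unsound:
  -- `occursAt` compares levels at the clamped positions and rejects lists that are too short.
  positions : ∀ p {n} → List ℕ → Vec (Fin (suc n)) p
  positions zero    is       = []
  positions (suc p) []       = zero ∷ positions p []
  positions (suc p) (i ∷ is) = clamp _ i ∷ positions p is

  fits : ∀ {p n} → State (suc n) → Fin (suc n) → Vec ℕ p → List ℕ → Bool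
  fits s i []      is       = true
  fits s i (l ∷ r) []       = false
  fits s i (l ∷ r) (j ∷ js) = (l ≤ᵇ level s i (clamp _ j)) ∧ fits s i r js

  -- The clusters of q, newest first, are found at the listed positions of s (0 is the newest cluster).
  occursAt : ∀ {p n} → State p → State (suc n) → List ℕ → Bool
  occursAt []      s is       = true
  occursAt (r ∷ q) s []       = false
  occursAt (r ∷ q) s (i ∷ is) = fits s (clamp _ i) r is ∧ occursAt q s is

  fits-sound : ∀ {p n} (s : State (suc n)) i (r : Vec ℕ p) is → T (fits s i r is) →
    ∀ b → lookup r b ≤ level s i (lookup (positions p is) b)
  fits-sound s i (l ∷ r) (j ∷ js) t zero    = ℕₚ.≤ᵇ⇒≤ l _ (proj₁ (Equivalence.to T-∧ t))
  fits-sound s i (l ∷ r) (j ∷ js) t (suc b) =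
    fits-sound s i r js (proj₂ (Equivalence.to (T-∧ {l ≤ᵇ level s i (clamp _ j)}) t)) b

  occursAt-sound : ∀ {p n} (q : State p) (s : State (suc n)) is → T (occursAt q s is) →
    ∀ a b → level q a b ≤ level s (lookup (positions p is) a) (lookup (positions p is) b)
  occursAt-sound (r ∷ q) s (i ∷ is) t with Equivalence.to (T-∧ {fits s (clamp _ i) r is}) t
  ... | row , rest = sound
    where
    sound : ∀ a b → level (r ∷ q) a b ≤ level s (lookup (positions _ (i ∷ is)) a) (lookup (positions _ (i ∷ is)) b)
    sound zero    zero    = z≤n
    sound zero    (suc b) = fits-sound s _ r is row b
    sound (suc a) zero    = subst (lookup r a ≤_) (level-sym s _ (lookup (positions _ is) a)) (fits-sound s _ r is row a)
    sound (suc a) (suc b) = occursAt-sound q s is rest a b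

  -- Weights and minimal responses

  rows : ∀ n → List (Vec ℕ n)
  rows zero    = [] ∷ []
  rows (suc n) = concatMap (λ l → List.map (l ∷_) (rows n)) (List.upTo 5)

  ∈-rows : ∀ {n} (r : Vec ℕ n) → VAll (_≤ 4) r → r ∈ rows n
  ∈-rows []      []       = here refl
  ∈-rows (l ∷ r) (l≤4 ∷ ps) =
    Mem.∈-concatMap⁺ (λ l → List.map (l ∷_) (rows _)) (Any.map (λ { refl → Mem.∈-map⁺ (_ ∷_) (∈-rows r ps) }) (Mem.∈-upTo⁺ (s≤s l≤4)))

  dot : ∀ {n} → Vec ℕ n → Vec ℕ n → ℕ
  dot c r = Vec.sum (Vec.zipWith _*_ c r)

  beats : ∀ {n} → Vec ℕ n → Vec ℕ n → Bool
  beats c r = 32 * Vec.sum c <ᵇ 13 * dot c r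

  -- An entry 0 counts as tight: `pred` fixes it, so lowering it would be no progress.
  Tight : ∀ {n} → Vec ℕ n → Vec ℕ n → Fin n → Set
  Tight c r i = T (not (beats c (Vec.updateAt r i pred)) ∨ (lookup r i ≤ᵇ 0))

  minimal? : ∀ {n} (c r : Vec ℕ n) → Dec (∀ i → Tight c r i)
  minimal? c r = Finₚ.all? (λ i → T? _)

  private
    lower-≤ : ∀ {n} (r : Vec ℕ n) i → Pointwise _≤_ (Vec.updateAt r i pred) r
    lower-≤ (l ∷ r) zero    = ℕₚ.pred[n]≤n ∷ PW.refl ℕₚ.≤-refl
    lower-≤ (l ∷ r) (suc i) = ℕₚ.≤-refl ∷ lower-≤ r i

    lower-< : ∀ {n} (r : Vec ℕ n) i → 1 ≤ lookup r i → Vec.sum (Vec.updateAt r i pred) < Vec.sum r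
    lower-< (suc l ∷ r) zero    _ = ℕₚ.≤-refl
    lower-< (l ∷ r)     (suc i) p = ℕₚ.+-monoʳ-< l (lower-< r i p)

    not-tight : ∀ b l → ¬ T (not b ∨ (l ≤ᵇ 0)) → T b × 1 ≤ l
    not-tight false l       p = ⊥-elim (p _)
    not-tight true  zero    p = ⊥-elim (p _)
    not-tight true  (suc l) p = _ , s≤s z≤n

  -- Entries are lowered one at a time while the row still beats `c`; each step decreases the sum,
  -- which the fuel bounds. States record lower bounds only, so a response may be replaced by the
  -- smaller row, and checking the minimal rows suffices.
  minimal-below : ∀ {n} (c : Vec ℕ n) fuel r → Vec.sum r ≤ fuel → T (beats c r) →
    ∃[ r′ ] (Pointwise _≤_ r′ r × T (beats c r′) × (∀ i → Tight c r′ i))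
  minimal-below c fuel r le b with minimal? c r
  ... | yes m = r , PW.refl ℕₚ.≤-refl , b , m
  ... | no ¬m with Finₚ.¬∀⟶∃¬ _ (Tight c r) (λ i → T? _) ¬m
  ... | i , ¬t with not-tight _ (lookup r i) ¬t
  minimal-below c zero r le b | no ¬m | i , ¬t | b′ , pos =
    ⊥-elim (ℕₚ.<⇒≱ (lower-< r i pos) (ℕₚ.≤-trans le z≤n))
  minimal-below c (suc fuel) r le b | no ¬m | i , ¬t | b′ , pos
    with minimal-below c fuel (Vec.updateAt r i pred) (ℕₚ.≤-pred (ℕₚ.≤-trans (lower-< r i pos) le)) b′
  ... | r′ , r′≤ , rest = r′ , PW.trans ℕₚ.≤-trans r′≤ (lower-≤ r i) , rest

  guarded : ∀ {P : Set} b (d : Dec P) {h} → T (not (b ∧ does d) ∨ h) → T b → P → T h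
  guarded true (yes _) t _ _ = t
  guarded true (no ¬p) t _ p = ⊥-elim (¬p p)

  -- A state is refuted by its clique, or by weights to which every minimal response produces a clique or one of the listed
  -- occurrences (index of an earlier entry, positions).
  data Justification (n : ℕ) : Set where
    embeds : Justification n
    plays_to_ : Vec ℕ n → List (ℕ × List ℕ) → Justification n

  infix 6 _by_
  infix 7 plays_to_
  record Entry : Set where
    constructor _by_
    field
      {size} : ℕ
      state  : State size
      why    : Justification size
  open Entry

  -- At most one element, as a list: an index out of range makes the surrounding `any` false.
  nth : {B : Set} → ℕ → List B → List B
  nth i xs = List.take 1 (List.drop i xs)

  occursVia : ∀ {n} → List (∃ State) → State (suc n) → ℕ × List ℕ → Bool
  occursVia known s (k , is) = any (λ q → occursAt (proj₂ q) s is) (nth k known)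

  -- The limit of twelve clusters matches the number of conditionings that the regularity parameters
  -- allow for.
  embeds12 : ∀ {n} → State n → Bool
  embeds12 {n} s = (n ≤ᵇ 12) ∧ positive s ∧ (12 ≤ᵇ cliqueSize s)

  justified : ∀ {n} → List (∃ State) → State n → Justification n → Bool
  justified known s embeds          = embeds12 s
  justified known s (plays c to is) = (1 ≤ᵇ Vec.sum c) ∧
    all (λ r → not (beats c r ∧ does (minimal? c r)) ∨ (embeds12 (r ∷ s) ∨ any (occursVia known (r ∷ s)) is)) (rows _)

  -- An entry may refer to earlier ones only, so the references are well-founded.
  checks : List (∃ State) → List Entry → Bool
  checks known []       = true
  checks known (e ∷ es) = justified known (state e) (why e) ∧ checks (known ++ (_ , state e) ∷ []) es

  -- Soundness of the check

  module Soundness {A : Set} (L : A → A → ℕ) (L≤4 : ∀ a b → L a b ≤ 4) (L-sym : ∀ a b → L a b ≡ L b a) (S : List A)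
    (respond : ∀ {n} (c : Vec ℕ n) (vs : Vec A n) → 1 ≤ Vec.sum c → VAll (_∈ S) vs → ∃[ v ] (v ∈ S × T (beats c (Vec.map (L v) vs))))
    where

    Realises : ∀ {n} → State n → Vec A n → Set
    Realises s vs = ∀ i j → level s i j ≤ L (lookup vs i) (lookup vs j)

    Refutable : ∃ State → Set
    Refutable (n , s) = ∀ (vs : Vec A n) → VAll (_∈ S) vs → Realises s vs → ⊥

    module _ (embed : ∀ {n} (s : State n) (vs : Vec A n) → Realises s vs → n ≤ 12 → T (positive s) → 12 ≤ cliqueSize s → ⊥) where

      occursAt-refutes : ∀ {n} (s : State (suc n)) q is → T (occursAt (proj₂ q) s is) → Refutable q → Refutable (suc n , s)
      occursAt-refutes s (p , q) is t ref vs vs∈ re = ref (Vec.map (lookup vs) σ) (in-S σ)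
        λ i j → subst (level q i j ≤_)
          (cong₂ L (sym (Vecₚ.lookup-map i (lookup vs) σ)) (sym (Vecₚ.lookup-map j (lookup vs) σ)))
          (ℕₚ.≤-trans (occursAt-sound q s is t i j) (re _ _))
        where
        σ = positions p is
        in-S : ∀ {m} (σ : Vec (Fin _) m) → VAll (_∈ S) (Vec.map (lookup vs) σ)
        in-S []      = []
        in-S (i ∷ σ) = VAllₚ.lookup⁺ vs∈ i ∷ in-S σ

      occursVia-refutes : ∀ {n} known (s : State (suc n)) is → All Refutable known →
        T (any (occursVia known s) is) → Refutable (suc n , s)
      occursVia-refutes known s is refs t with Any.satisfied (Anyₚ.any⁻ _ is t)
      ... | (k , σ) , t′ = nth-refutable (nth k known) (Allₚ.take⁺ 1 (Allₚ.drop⁺ k refs)) (Anyₚ.any⁻ _ (nth k known) t′)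
        where
        nth-refutable : ∀ qs → All Refutable qs → Any (λ q → T (occursAt (proj₂ q) s σ)) qs → Refutable (_ , s)
        nth-refutable (q ∷ _)  (ref ∷ _)  (here o)  = occursAt-refutes s q σ o ref
        nth-refutable (_ ∷ qs) (_ ∷ refs) (there o) = nth-refutable qs refs o

      embeds12-sound : ∀ {n} (s : State n) → T (embeds12 s) → Refutable (n , s)
      embeds12-sound {n} s t vs vs∈ re with Equivalence.to (T-∧ {n ≤ᵇ 12}) t
      ... | few , t′ with Equivalence.to (T-∧ {positive s}) t′
      ... | pos , big = embed s vs re (ℕₚ.≤ᵇ⇒≤ n 12 few) pos (ℕₚ.≤ᵇ⇒≤ _ _ big)

      -- Whatever cluster answers the weights, its levels are lowered to a minimal row. The extended
      -- state is still realised, and the check has found in it a large clique or an occurrence of a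
      -- refuted state.
      justified-sound : ∀ {n} known (s : State n) w → All Refutable known → T (justified known s w) → Refutable (n , s)
      justified-sound known s embeds          refs t = embeds12-sound s t
      justified-sound known s (plays c to is) refs t vs vs∈ re
        with Equivalence.to (T-∧ {1 ≤ᵇ Vec.sum c}) t
      ... | c≥1 , covered
        with respond c vs (ℕₚ.≤ᵇ⇒≤ 1 _ c≥1) vs∈
      ... | v , v∈ , b
        with minimal-below c _ (Vec.map (L v) vs) ℕₚ.≤-refl b
      ... | r , r≤ , b′ , tight =
        [ embeds12-sound (r ∷ s) , occursVia-refutes known (r ∷ s) is refs ]′
          (Equivalence.to (T-∨ {embeds12 (r ∷ s)}) hit) (v ∷ vs) (v∈ ∷ vs∈) realises
        where
        bounded : ∀ {m} {r : Vec ℕ m} {ws : Vec A m} → Pointwise _≤_ r (Vec.map (L v) ws) → VAll (_≤ 4) r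
        bounded {ws = []}     []       = []
        bounded {ws = w ∷ ws} (p ∷ ps) = ℕₚ.≤-trans p (L≤4 _ _) ∷ bounded ps

        hit : T (embeds12 (r ∷ s) ∨ any (occursVia known (r ∷ s)) is)
        hit = guarded (beats c r) (minimal? c r) (All.lookup (Allₚ.all⁺ _ _ covered) (∈-rows r (bounded r≤))) b′ tight

        entry : ∀ j → lookup r j ≤ L v (lookup vs j)
        entry j = subst (lookup r j ≤_) (Vecₚ.lookup-map j (L v) vs) (PW.lookup r≤ j)

        realises : Realises (r ∷ s) (v ∷ vs)
        realises zero    zero    = z≤n
        realises zero    (suc j) = entry j
        realises (suc i) zero    = subst (lookup r i ≤_) (L-sym v (lookup vs i)) (entry i)
        realises (suc i) (suc j) = re i j

      checks-sound : ∀ known es → All Refutable known → T (checks known es) → All (λ e → Refutable (_ , state e)) es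
      checks-sound known []       refs t = []
      checks-sound known (e ∷ es) refs t with Equivalence.to (T-∧ {justified known (state e) (why e)}) t
      ... | j , js = ref ∷ checks-sound _ es (Allₚ.++⁺ refs (ref ∷ [])) js
        where ref = justified-sound known (state e) (why e) refs j

      refutable : ∀ es → checks [] es ≡ true → All (λ e → Refutable (_ , state e)) es
      refutable es valid = checks-sound [] es [] (Equivalence.from T-≡ valid)

-- A winning strategy
module Strategy where

  open Game
  open import Data.List using (List; []; _∷_; _++_)
  open import Data.List.Membership.Propositional using (_∈_)
  open import Data.List.Membership.Propositional.Properties using (∈-++⁺ʳ)
  open import Data.List.Relation.Unary.Any using (here)
  open import Data.Vec using ([]; _∷_)
  open import Data.Bool using (true)
  open import Data.Product using (_,_)
  open import Relation.Binary.PropositionalEquality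

  -- Entries are numbered from 0. The first three are the basic cliques, with 4 + 4 + 4, 2 + 4 + 2 +
  -- 4 and 2 + 3 + 3 + 4 vertices. The refuted patterns then become weaker: triangles containing a
  -- level 4, an edge of level 4 (entry 36), the triangle with levels 3, 3, 2 (entry 48), an edge of
  -- level 3 (entry 49).
  preparations : List Entry
  preparations =
    ((4 ∷ 4 ∷ []) ∷ (4 ∷ []) ∷ [] ∷ []) by embeds ∷
    ((2 ∷ 4 ∷ 4 ∷ []) ∷ (4 ∷ 4 ∷ []) ∷ (2 ∷ []) ∷ [] ∷ []) by embeds ∷
    ((3 ∷ 3 ∷ 4 ∷ []) ∷ (4 ∷ 3 ∷ []) ∷ (3 ∷ []) ∷ [] ∷ []) by embeds ∷
    ((3 ∷ 4 ∷ []) ∷ (4 ∷ []) ∷ [] ∷ []) by plays (4 ∷ 4 ∷ 5 ∷ []) to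
        ((0 , 0 ∷ 1 ∷ 3 ∷ []) ∷ (0 , 0 ∷ 2 ∷ 3 ∷ []) ∷ []) ∷
    ((4 ∷ 4 ∷ 1 ∷ []) ∷ (2 ∷ 4 ∷ []) ∷ (4 ∷ []) ∷ [] ∷ []) by plays (2 ∷ 3 ∷ 2 ∷ 2 ∷ []) to
        ((3 , 0 ∷ 1 ∷ 2 ∷ []) ∷ (3 , 0 ∷ 2 ∷ 4 ∷ []) ∷ (3 , 0 ∷ 2 ∷ 1 ∷ []) ∷ (3 , 0 ∷ 1 ∷ 3 ∷ []) ∷
         (3 , 0 ∷ 4 ∷ 2 ∷ []) ∷ (3 , 0 ∷ 4 ∷ 3 ∷ []) ∷ (1 , 0 ∷ 1 ∷ 2 ∷ 3 ∷ []) ∷ (1 , 2 ∷ 3 ∷ 0 ∷ 4 ∷ []) ∷ []) ∷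
    ((4 ∷ 2 ∷ 2 ∷ []) ∷ (2 ∷ 4 ∷ []) ∷ (4 ∷ []) ∷ [] ∷ []) by plays (2 ∷ 3 ∷ 2 ∷ 3 ∷ []) to
        ((3 , 0 ∷ 2 ∷ 1 ∷ []) ∷ (3 , 0 ∷ 4 ∷ 2 ∷ []) ∷ (3 , 0 ∷ 4 ∷ 3 ∷ []) ∷ (3 , 0 ∷ 2 ∷ 4 ∷ []) ∷
         (3 , 0 ∷ 1 ∷ 2 ∷ []) ∷ (3 , 0 ∷ 3 ∷ 4 ∷ []) ∷ (1 , 2 ∷ 3 ∷ 0 ∷ 4 ∷ []) ∷ (1 , 0 ∷ 2 ∷ 1 ∷ 4 ∷ []) ∷ []) ∷
    ((2 ∷ 1 ∷ 4 ∷ []) ∷ (2 ∷ 4 ∷ []) ∷ (4 ∷ []) ∷ [] ∷ []) by plays (1 ∷ 1 ∷ 1 ∷ 2 ∷ []) to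
        ((3 , 0 ∷ 4 ∷ 1 ∷ []) ∷ (3 , 0 ∷ 4 ∷ 2 ∷ []) ∷ (3 , 0 ∷ 4 ∷ 3 ∷ []) ∷ (3 , 0 ∷ 1 ∷ 4 ∷ []) ∷
         (3 , 0 ∷ 2 ∷ 4 ∷ []) ∷ (3 , 0 ∷ 3 ∷ 4 ∷ []) ∷ []) ∷
    ((4 ∷ 3 ∷ 1 ∷ []) ∷ (3 ∷ 3 ∷ []) ∷ (4 ∷ []) ∷ [] ∷ []) by plays (3 ∷ 3 ∷ 3 ∷ 2 ∷ []) to
        ((3 , 0 ∷ 1 ∷ 2 ∷ []) ∷ (3 , 0 ∷ 3 ∷ 4 ∷ []) ∷ (3 , 0 ∷ 2 ∷ 1 ∷ []) ∷ (3 , 1 ∷ 3 ∷ 0 ∷ []) ∷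
         (3 , 2 ∷ 3 ∷ 0 ∷ []) ∷ (2 , 0 ∷ 1 ∷ 2 ∷ 3 ∷ []) ∷ []) ∷
    ((3 ∷ 4 ∷ 1 ∷ []) ∷ (3 ∷ 3 ∷ []) ∷ (4 ∷ []) ∷ [] ∷ []) by plays (2 ∷ 2 ∷ 3 ∷ 2 ∷ []) to
        ((3 , 0 ∷ 3 ∷ 1 ∷ []) ∷ (3 , 0 ∷ 4 ∷ 3 ∷ []) ∷ (3 , 2 ∷ 3 ∷ 0 ∷ []) ∷ (3 , 0 ∷ 3 ∷ 4 ∷ []) ∷
         (3 , 0 ∷ 1 ∷ 3 ∷ []) ∷ (3 , 2 ∷ 4 ∷ 0 ∷ []) ∷ (2 , 1 ∷ 0 ∷ 2 ∷ 3 ∷ []) ∷ (2 , 3 ∷ 0 ∷ 2 ∷ 4 ∷ []) ∷ []) ∷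
    ((4 ∷ 2 ∷ 2 ∷ []) ∷ (3 ∷ 3 ∷ []) ∷ (4 ∷ []) ∷ [] ∷ []) by plays (2 ∷ 3 ∷ 2 ∷ 2 ∷ []) to
        ((3 , 0 ∷ 1 ∷ 2 ∷ []) ∷ (3 , 0 ∷ 2 ∷ 1 ∷ []) ∷ (3 , 2 ∷ 3 ∷ 0 ∷ []) ∷ (3 , 0 ∷ 4 ∷ 3 ∷ []) ∷
         (3 , 2 ∷ 4 ∷ 0 ∷ []) ∷ (3 , 0 ∷ 3 ∷ 4 ∷ []) ∷ (2 , 3 ∷ 0 ∷ 2 ∷ 4 ∷ []) ∷ (7 , 1 ∷ 2 ∷ 0 ∷ 3 ∷ []) ∷
         (7 , 1 ∷ 2 ∷ 0 ∷ 4 ∷ []) ∷ []) ∷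
    ((3 ∷ 3 ∷ 2 ∷ []) ∷ (3 ∷ 3 ∷ []) ∷ (4 ∷ []) ∷ [] ∷ []) by plays (2 ∷ 2 ∷ 3 ∷ 3 ∷ []) to
        ((3 , 0 ∷ 4 ∷ 3 ∷ []) ∷ (9 , 0 ∷ 2 ∷ 3 ∷ 4 ∷ []) ∷ (3 , 1 ∷ 2 ∷ 0 ∷ []) ∷ (3 , 1 ∷ 3 ∷ 0 ∷ []) ∷
         (3 , 0 ∷ 3 ∷ 4 ∷ []) ∷ (3 , 2 ∷ 3 ∷ 0 ∷ []) ∷ (3 , 2 ∷ 4 ∷ 0 ∷ []) ∷ (5 , 1 ∷ 0 ∷ 3 ∷ 4 ∷ []) ∷
         (7 , 1 ∷ 0 ∷ 3 ∷ 4 ∷ []) ∷ (8 , 1 ∷ 2 ∷ 0 ∷ 4 ∷ []) ∷ []) ∷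
    ((1 ∷ 4 ∷ 2 ∷ []) ∷ (3 ∷ 3 ∷ []) ∷ (4 ∷ []) ∷ [] ∷ []) by plays (2 ∷ 1 ∷ 3 ∷ 2 ∷ []) to
        ((3 , 0 ∷ 3 ∷ 1 ∷ []) ∷ (3 , 0 ∷ 4 ∷ 3 ∷ []) ∷ (3 , 0 ∷ 1 ∷ 3 ∷ []) ∷ (3 , 2 ∷ 3 ∷ 0 ∷ []) ∷
         (3 , 0 ∷ 3 ∷ 4 ∷ []) ∷ (3 , 2 ∷ 4 ∷ 0 ∷ []) ∷ (5 , 0 ∷ 1 ∷ 4 ∷ 3 ∷ []) ∷ (5 , 1 ∷ 3 ∷ 0 ∷ 4 ∷ []) ∷
         (6 , 0 ∷ 1 ∷ 4 ∷ 3 ∷ []) ∷ (8 , 1 ∷ 0 ∷ 3 ∷ 4 ∷ []) ∷ []) ∷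
    ((1 ∷ 3 ∷ 3 ∷ []) ∷ (3 ∷ 3 ∷ []) ∷ (4 ∷ []) ∷ [] ∷ []) by plays (1 ∷ 1 ∷ 2 ∷ 2 ∷ []) to
        ((3 , 0 ∷ 4 ∷ 3 ∷ []) ∷ (3 , 0 ∷ 3 ∷ 4 ∷ []) ∷ (10 , 0 ∷ 1 ∷ 3 ∷ 4 ∷ []) ∷ (10 , 0 ∷ 2 ∷ 3 ∷ 4 ∷ []) ∷
         (3 , 1 ∷ 3 ∷ 0 ∷ []) ∷ (3 , 2 ∷ 3 ∷ 0 ∷ []) ∷ (3 , 1 ∷ 4 ∷ 0 ∷ []) ∷ (3 , 2 ∷ 4 ∷ 0 ∷ []) ∷
         (8 , 0 ∷ 1 ∷ 4 ∷ 3 ∷ []) ∷ (8 , 0 ∷ 2 ∷ 4 ∷ 3 ∷ []) ∷ []) ∷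
    ((3 ∷ 3 ∷ 2 ∷ []) ∷ (2 ∷ 4 ∷ []) ∷ (4 ∷ []) ∷ [] ∷ []) by plays (1 ∷ 2 ∷ 2 ∷ 3 ∷ []) to
        ((3 , 0 ∷ 4 ∷ 2 ∷ []) ∷ (3 , 0 ∷ 4 ∷ 3 ∷ []) ∷ (3 , 0 ∷ 2 ∷ 4 ∷ []) ∷ (3 , 0 ∷ 3 ∷ 4 ∷ []) ∷
         (3 , 1 ∷ 3 ∷ 0 ∷ []) ∷ (5 , 0 ∷ 2 ∷ 3 ∷ 4 ∷ []) ∷ (5 , 0 ∷ 3 ∷ 2 ∷ 4 ∷ []) ∷ (5 , 1 ∷ 0 ∷ 2 ∷ 4 ∷ []) ∷
         (5 , 1 ∷ 0 ∷ 3 ∷ 4 ∷ []) ∷ (6 , 0 ∷ 2 ∷ 3 ∷ 4 ∷ []) ∷ (8 , 2 ∷ 0 ∷ 4 ∷ 3 ∷ []) ∷ []) ∷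
    ((2 ∷ 4 ∷ []) ∷ (4 ∷ []) ∷ [] ∷ []) by plays (2 ∷ 2 ∷ 3 ∷ []) to
        ((11 , 2 ∷ 0 ∷ 3 ∷ 1 ∷ []) ∷ (11 , 1 ∷ 0 ∷ 3 ∷ 2 ∷ []) ∷ (3 , 0 ∷ 1 ∷ 3 ∷ []) ∷ (3 , 0 ∷ 2 ∷ 3 ∷ []) ∷
         (4 , 0 ∷ 1 ∷ 2 ∷ 3 ∷ []) ∷ (5 , 0 ∷ 1 ∷ 2 ∷ 3 ∷ []) ∷ (5 , 0 ∷ 2 ∷ 1 ∷ 3 ∷ []) ∷ (6 , 0 ∷ 1 ∷ 2 ∷ 3 ∷ []) ∷
         (6 , 0 ∷ 2 ∷ 1 ∷ 3 ∷ []) ∷ (13 , 0 ∷ 1 ∷ 2 ∷ 3 ∷ []) ∷ []) ∷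
    ((3 ∷ 3 ∷ []) ∷ (4 ∷ []) ∷ [] ∷ []) by plays (1 ∷ 1 ∷ 1 ∷ []) to
        ((14 , 0 ∷ 3 ∷ 2 ∷ []) ∷ (14 , 0 ∷ 2 ∷ 3 ∷ []) ∷ (3 , 1 ∷ 2 ∷ 0 ∷ []) ∷ (3 , 1 ∷ 3 ∷ 0 ∷ []) ∷
         (7 , 0 ∷ 1 ∷ 2 ∷ 3 ∷ []) ∷ (7 , 0 ∷ 1 ∷ 3 ∷ 2 ∷ []) ∷ (8 , 0 ∷ 1 ∷ 2 ∷ 3 ∷ []) ∷ (8 , 0 ∷ 1 ∷ 3 ∷ 2 ∷ []) ∷
         (9 , 0 ∷ 1 ∷ 2 ∷ 3 ∷ []) ∷ (10 , 0 ∷ 1 ∷ 2 ∷ 3 ∷ []) ∷ (10 , 0 ∷ 1 ∷ 3 ∷ 2 ∷ []) ∷ (12 , 0 ∷ 1 ∷ 2 ∷ 3 ∷ []) ∷ []) ∷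
    ((1 ∷ 4 ∷ 4 ∷ 1 ∷ []) ∷ (4 ∷ 4 ∷ 1 ∷ []) ∷ (1 ∷ 4 ∷ []) ∷ (4 ∷ []) ∷ [] ∷ []) by plays (1 ∷ 2 ∷ 2 ∷ 2 ∷ 2 ∷ []) to
        ((15 , 0 ∷ 2 ∷ 3 ∷ []) ∷ (15 , 0 ∷ 4 ∷ 5 ∷ []) ∷ (14 , 0 ∷ 4 ∷ 2 ∷ []) ∷ (14 , 0 ∷ 5 ∷ 3 ∷ []) ∷
         (3 , 0 ∷ 1 ∷ 3 ∷ []) ∷ (14 , 0 ∷ 3 ∷ 2 ∷ []) ∷ []) ∷
    ((2 ∷ 3 ∷ 3 ∷ 2 ∷ []) ∷ (4 ∷ 4 ∷ 1 ∷ []) ∷ (1 ∷ 4 ∷ []) ∷ (4 ∷ []) ∷ [] ∷ []) by plays (1 ∷ 2 ∷ 2 ∷ 2 ∷ 2 ∷ []) to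
        ((15 , 0 ∷ 2 ∷ 3 ∷ []) ∷ (15 , 0 ∷ 4 ∷ 5 ∷ []) ∷ (14 , 0 ∷ 4 ∷ 2 ∷ []) ∷ (14 , 0 ∷ 5 ∷ 3 ∷ []) ∷
         (14 , 0 ∷ 2 ∷ 3 ∷ []) ∷ (14 , 0 ∷ 3 ∷ 2 ∷ []) ∷ []) ∷
    ((4 ∷ 4 ∷ 1 ∷ []) ∷ (1 ∷ 4 ∷ []) ∷ (4 ∷ []) ∷ [] ∷ []) by plays (1 ∷ 1 ∷ 1 ∷ 1 ∷ []) to
        ((15 , 0 ∷ 1 ∷ 2 ∷ []) ∷ (15 , 0 ∷ 3 ∷ 4 ∷ []) ∷ (14 , 0 ∷ 3 ∷ 1 ∷ []) ∷ (14 , 0 ∷ 4 ∷ 2 ∷ []) ∷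
         (14 , 0 ∷ 1 ∷ 3 ∷ []) ∷ (14 , 0 ∷ 2 ∷ 4 ∷ []) ∷ (14 , 0 ∷ 1 ∷ 2 ∷ []) ∷ (14 , 0 ∷ 2 ∷ 1 ∷ []) ∷
         (14 , 0 ∷ 4 ∷ 3 ∷ []) ∷ (14 , 0 ∷ 3 ∷ 4 ∷ []) ∷ (15 , 0 ∷ 1 ∷ 3 ∷ []) ∷ (15 , 0 ∷ 2 ∷ 4 ∷ []) ∷
         (16 , 0 ∷ 1 ∷ 2 ∷ 3 ∷ 4 ∷ []) ∷ (16 , 0 ∷ 2 ∷ 1 ∷ 4 ∷ 3 ∷ []) ∷ (17 , 0 ∷ 1 ∷ 2 ∷ 3 ∷ 4 ∷ []) ∷
         (17 , 0 ∷ 2 ∷ 1 ∷ 4 ∷ 3 ∷ []) ∷ []) ∷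
    ((2 ∷ 3 ∷ 4 ∷ 1 ∷ []) ∷ (4 ∷ 3 ∷ 2 ∷ []) ∷ (2 ∷ 3 ∷ []) ∷ (4 ∷ []) ∷ [] ∷ []) by plays (1 ∷ 2 ∷ 2 ∷ 2 ∷ 2 ∷ []) to
        ((15 , 0 ∷ 2 ∷ 3 ∷ []) ∷ (15 , 0 ∷ 4 ∷ 5 ∷ []) ∷ (3 , 0 ∷ 1 ∷ 4 ∷ []) ∷ (14 , 0 ∷ 4 ∷ 5 ∷ []) ∷
         (14 , 0 ∷ 2 ∷ 3 ∷ []) ∷ (14 , 0 ∷ 3 ∷ 2 ∷ []) ∷ []) ∷
    ((3 ∷ 2 ∷ 3 ∷ 2 ∷ []) ∷ (4 ∷ 3 ∷ 2 ∷ []) ∷ (2 ∷ 3 ∷ []) ∷ (4 ∷ []) ∷ [] ∷ []) by plays (1 ∷ 2 ∷ 2 ∷ 2 ∷ 2 ∷ []) to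
        ((15 , 0 ∷ 2 ∷ 3 ∷ []) ∷ (15 , 0 ∷ 4 ∷ 5 ∷ []) ∷ (14 , 0 ∷ 2 ∷ 3 ∷ []) ∷ (14 , 0 ∷ 3 ∷ 2 ∷ []) ∷
         (14 , 0 ∷ 5 ∷ 4 ∷ []) ∷ (14 , 0 ∷ 4 ∷ 5 ∷ []) ∷ []) ∷
    ((2 ∷ 3 ∷ 3 ∷ 2 ∷ []) ∷ (4 ∷ 3 ∷ 2 ∷ []) ∷ (2 ∷ 3 ∷ []) ∷ (4 ∷ []) ∷ [] ∷ []) by plays (1 ∷ 2 ∷ 2 ∷ 2 ∷ 2 ∷ []) to
        ((15 , 0 ∷ 2 ∷ 3 ∷ []) ∷ (15 , 0 ∷ 4 ∷ 5 ∷ []) ∷ (14 , 0 ∷ 2 ∷ 3 ∷ []) ∷ (14 , 0 ∷ 3 ∷ 2 ∷ []) ∷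
         (14 , 0 ∷ 5 ∷ 4 ∷ []) ∷ (14 , 0 ∷ 4 ∷ 5 ∷ []) ∷ []) ∷
    ((4 ∷ 3 ∷ 2 ∷ []) ∷ (2 ∷ 3 ∷ []) ∷ (4 ∷ []) ∷ [] ∷ []) by plays (1 ∷ 1 ∷ 1 ∷ 1 ∷ []) to
        ((15 , 0 ∷ 1 ∷ 2 ∷ []) ∷ (15 , 0 ∷ 3 ∷ 4 ∷ []) ∷ (14 , 0 ∷ 1 ∷ 2 ∷ []) ∷ (14 , 0 ∷ 2 ∷ 1 ∷ []) ∷
         (14 , 0 ∷ 4 ∷ 3 ∷ []) ∷ (14 , 0 ∷ 3 ∷ 4 ∷ []) ∷ (15 , 3 ∷ 0 ∷ 1 ∷ []) ∷ (15 , 4 ∷ 0 ∷ 2 ∷ []) ∷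
         (14 , 2 ∷ 3 ∷ 0 ∷ []) ∷ (14 , 1 ∷ 4 ∷ 0 ∷ []) ∷ (15 , 1 ∷ 0 ∷ 3 ∷ []) ∷ (15 , 2 ∷ 0 ∷ 4 ∷ []) ∷
         (19 , 0 ∷ 1 ∷ 2 ∷ 3 ∷ 4 ∷ []) ∷ (19 , 0 ∷ 4 ∷ 3 ∷ 2 ∷ 1 ∷ []) ∷ (19 , 0 ∷ 3 ∷ 4 ∷ 1 ∷ 2 ∷ []) ∷
         (19 , 0 ∷ 2 ∷ 1 ∷ 4 ∷ 3 ∷ []) ∷ (20 , 0 ∷ 1 ∷ 2 ∷ 3 ∷ 4 ∷ []) ∷ (20 , 0 ∷ 2 ∷ 1 ∷ 4 ∷ 3 ∷ []) ∷
         (21 , 0 ∷ 1 ∷ 2 ∷ 3 ∷ 4 ∷ []) ∷ (21 , 0 ∷ 2 ∷ 1 ∷ 4 ∷ 3 ∷ []) ∷ []) ∷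
    ((3 ∷ 2 ∷ 3 ∷ 2 ∷ []) ∷ (3 ∷ 2 ∷ 3 ∷ []) ∷ (4 ∷ 1 ∷ []) ∷ (4 ∷ []) ∷ [] ∷ []) by plays (1 ∷ 1 ∷ 1 ∷ 5 ∷ 5 ∷ []) to
        ((15 , 0 ∷ 4 ∷ 5 ∷ []) ∷ (14 , 0 ∷ 5 ∷ 4 ∷ []) ∷ (14 , 0 ∷ 4 ∷ 5 ∷ []) ∷ (14 , 0 ∷ 4 ∷ 3 ∷ []) ∷
         (3 , 1 ∷ 2 ∷ 0 ∷ []) ∷ (18 , 3 ∷ 0 ∷ 4 ∷ 5 ∷ []) ∷ []) ∷
    ((3 ∷ 2 ∷ 2 ∷ 3 ∷ []) ∷ (3 ∷ 2 ∷ 3 ∷ []) ∷ (4 ∷ 1 ∷ []) ∷ (4 ∷ []) ∷ [] ∷ []) by plays (1 ∷ 1 ∷ 1 ∷ 5 ∷ 5 ∷ []) to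
        ((15 , 0 ∷ 4 ∷ 5 ∷ []) ∷ (14 , 0 ∷ 5 ∷ 4 ∷ []) ∷ (14 , 0 ∷ 4 ∷ 5 ∷ []) ∷ (14 , 0 ∷ 4 ∷ 3 ∷ []) ∷
         (3 , 1 ∷ 2 ∷ 0 ∷ []) ∷ (18 , 3 ∷ 0 ∷ 4 ∷ 5 ∷ []) ∷ []) ∷
    ((2 ∷ 3 ∷ 2 ∷ 3 ∷ []) ∷ (3 ∷ 2 ∷ 3 ∷ []) ∷ (4 ∷ 1 ∷ []) ∷ (4 ∷ []) ∷ [] ∷ []) by plays (1 ∷ 1 ∷ 1 ∷ 5 ∷ 5 ∷ []) to
        ((15 , 0 ∷ 4 ∷ 5 ∷ []) ∷ (14 , 0 ∷ 5 ∷ 4 ∷ []) ∷ (14 , 0 ∷ 4 ∷ 5 ∷ []) ∷ (14 , 0 ∷ 4 ∷ 3 ∷ []) ∷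
         (14 , 1 ∷ 2 ∷ 0 ∷ []) ∷ (18 , 3 ∷ 0 ∷ 4 ∷ 5 ∷ []) ∷ []) ∷
    ((2 ∷ 3 ∷ 1 ∷ 4 ∷ []) ∷ (3 ∷ 2 ∷ 3 ∷ []) ∷ (4 ∷ 1 ∷ []) ∷ (4 ∷ []) ∷ [] ∷ []) by plays (1 ∷ 1 ∷ 1 ∷ 5 ∷ 5 ∷ []) to
        ((15 , 0 ∷ 4 ∷ 5 ∷ []) ∷ (14 , 0 ∷ 5 ∷ 4 ∷ []) ∷ (14 , 0 ∷ 4 ∷ 5 ∷ []) ∷ (14 , 0 ∷ 4 ∷ 3 ∷ []) ∷
         (14 , 1 ∷ 2 ∷ 0 ∷ []) ∷ (18 , 3 ∷ 0 ∷ 4 ∷ 5 ∷ []) ∷ []) ∷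
    ((3 ∷ 2 ∷ 3 ∷ []) ∷ (4 ∷ 1 ∷ []) ∷ (4 ∷ []) ∷ [] ∷ []) by plays (1 ∷ 1 ∷ 4 ∷ 4 ∷ []) to
        ((15 , 0 ∷ 2 ∷ 3 ∷ []) ∷ (15 , 0 ∷ 3 ∷ 4 ∷ []) ∷ (14 , 0 ∷ 4 ∷ 3 ∷ []) ∷ (14 , 0 ∷ 3 ∷ 4 ∷ []) ∷
         (15 , 4 ∷ 0 ∷ 1 ∷ []) ∷ (14 , 1 ∷ 3 ∷ 0 ∷ []) ∷ (14 , 0 ∷ 2 ∷ 3 ∷ []) ∷ (14 , 0 ∷ 3 ∷ 2 ∷ []) ∷
         (15 , 1 ∷ 0 ∷ 4 ∷ []) ∷ (18 , 2 ∷ 0 ∷ 3 ∷ 4 ∷ []) ∷ (22 , 0 ∷ 1 ∷ 3 ∷ 4 ∷ []) ∷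
         (23 , 0 ∷ 1 ∷ 2 ∷ 3 ∷ 4 ∷ []) ∷ (24 , 0 ∷ 1 ∷ 2 ∷ 3 ∷ 4 ∷ []) ∷ (25 , 0 ∷ 1 ∷ 2 ∷ 3 ∷ 4 ∷ []) ∷
         (26 , 0 ∷ 1 ∷ 2 ∷ 3 ∷ 4 ∷ []) ∷ []) ∷
    ((3 ∷ 1 ∷ 4 ∷ []) ∷ (4 ∷ 1 ∷ []) ∷ (4 ∷ []) ∷ [] ∷ []) by plays (1 ∷ 1 ∷ 4 ∷ 4 ∷ []) to
        ((15 , 0 ∷ 2 ∷ 3 ∷ []) ∷ (15 , 0 ∷ 1 ∷ 4 ∷ []) ∷ (15 , 0 ∷ 3 ∷ 4 ∷ []) ∷ (14 , 0 ∷ 4 ∷ 3 ∷ []) ∷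
         (14 , 0 ∷ 3 ∷ 4 ∷ []) ∷ (27 , 0 ∷ 1 ∷ 4 ∷ 3 ∷ []) ∷ (27 , 0 ∷ 2 ∷ 3 ∷ 4 ∷ []) ∷ (14 , 0 ∷ 2 ∷ 3 ∷ []) ∷
         (14 , 0 ∷ 1 ∷ 4 ∷ []) ∷ (18 , 0 ∷ 1 ∷ 3 ∷ 4 ∷ []) ∷ (18 , 2 ∷ 0 ∷ 3 ∷ 4 ∷ []) ∷ []) ∷
    ((4 ∷ 1 ∷ []) ∷ (4 ∷ []) ∷ [] ∷ []) by plays (3 ∷ 5 ∷ 5 ∷ []) to
        ((15 , 0 ∷ 2 ∷ 3 ∷ []) ∷ (15 , 0 ∷ 1 ∷ 2 ∷ []) ∷ (14 , 0 ∷ 3 ∷ 2 ∷ []) ∷ (14 , 0 ∷ 2 ∷ 3 ∷ []) ∷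
         (27 , 0 ∷ 1 ∷ 2 ∷ 3 ∷ []) ∷ (28 , 0 ∷ 1 ∷ 2 ∷ 3 ∷ []) ∷ []) ∷
    ((3 ∷ 2 ∷ 3 ∷ 2 ∷ []) ∷ (3 ∷ 3 ∷ 2 ∷ []) ∷ (3 ∷ 2 ∷ []) ∷ (4 ∷ []) ∷ [] ∷ []) by plays (1 ∷ 1 ∷ 1 ∷ 5 ∷ 5 ∷ []) to
        ((29 , 0 ∷ 4 ∷ 5 ∷ []) ∷ (29 , 0 ∷ 5 ∷ 4 ∷ []) ∷ (15 , 0 ∷ 4 ∷ 5 ∷ []) ∷ (3 , 1 ∷ 2 ∷ 0 ∷ []) ∷
         (3 , 2 ∷ 3 ∷ 0 ∷ []) ∷ (14 , 1 ∷ 3 ∷ 0 ∷ []) ∷ []) ∷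
    ((3 ∷ 2 ∷ 2 ∷ 3 ∷ []) ∷ (3 ∷ 3 ∷ 2 ∷ []) ∷ (3 ∷ 2 ∷ []) ∷ (4 ∷ []) ∷ [] ∷ []) by plays (1 ∷ 1 ∷ 1 ∷ 5 ∷ 5 ∷ []) to
        ((29 , 0 ∷ 4 ∷ 5 ∷ []) ∷ (29 , 0 ∷ 5 ∷ 4 ∷ []) ∷ (15 , 0 ∷ 4 ∷ 5 ∷ []) ∷ (3 , 1 ∷ 2 ∷ 0 ∷ []) ∷
         (3 , 2 ∷ 3 ∷ 0 ∷ []) ∷ (14 , 1 ∷ 3 ∷ 0 ∷ []) ∷ []) ∷
    ((3 ∷ 3 ∷ 2 ∷ []) ∷ (3 ∷ 2 ∷ []) ∷ (4 ∷ []) ∷ [] ∷ []) by plays (1 ∷ 1 ∷ 4 ∷ 4 ∷ []) to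
        ((29 , 0 ∷ 3 ∷ 4 ∷ []) ∷ (29 , 0 ∷ 4 ∷ 3 ∷ []) ∷ (15 , 0 ∷ 3 ∷ 4 ∷ []) ∷ (15 , 3 ∷ 0 ∷ 1 ∷ []) ∷
         (15 , 3 ∷ 0 ∷ 2 ∷ []) ∷ (22 , 1 ∷ 0 ∷ 3 ∷ 4 ∷ []) ∷ (22 , 2 ∷ 0 ∷ 3 ∷ 4 ∷ []) ∷
         (30 , 0 ∷ 1 ∷ 2 ∷ 3 ∷ 4 ∷ []) ∷ (30 , 0 ∷ 2 ∷ 1 ∷ 3 ∷ 4 ∷ []) ∷ (31 , 0 ∷ 1 ∷ 2 ∷ 3 ∷ 4 ∷ []) ∷
         (31 , 0 ∷ 2 ∷ 1 ∷ 3 ∷ 4 ∷ []) ∷ []) ∷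
    ((3 ∷ 2 ∷ 3 ∷ 2 ∷ []) ∷ (3 ∷ 2 ∷ 3 ∷ []) ∷ (3 ∷ 2 ∷ []) ∷ (4 ∷ []) ∷ [] ∷ []) by plays (1 ∷ 1 ∷ 1 ∷ 5 ∷ 5 ∷ []) to
        ((29 , 0 ∷ 4 ∷ 5 ∷ []) ∷ (29 , 0 ∷ 5 ∷ 4 ∷ []) ∷ (15 , 0 ∷ 4 ∷ 5 ∷ []) ∷ (3 , 1 ∷ 2 ∷ 0 ∷ []) ∷
         (3 , 2 ∷ 3 ∷ 0 ∷ []) ∷ (14 , 1 ∷ 3 ∷ 0 ∷ []) ∷ []) ∷
    ((3 ∷ 2 ∷ 3 ∷ []) ∷ (3 ∷ 2 ∷ []) ∷ (4 ∷ []) ∷ [] ∷ []) by plays (1 ∷ 1 ∷ 4 ∷ 4 ∷ []) to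
        ((29 , 0 ∷ 3 ∷ 4 ∷ []) ∷ (29 , 0 ∷ 4 ∷ 3 ∷ []) ∷ (15 , 0 ∷ 3 ∷ 4 ∷ []) ∷ (32 , 0 ∷ 2 ∷ 3 ∷ 4 ∷ []) ∷
         (32 , 0 ∷ 1 ∷ 4 ∷ 3 ∷ []) ∷ (22 , 0 ∷ 1 ∷ 3 ∷ 4 ∷ []) ∷ (22 , 2 ∷ 0 ∷ 3 ∷ 4 ∷ []) ∷
         (33 , 0 ∷ 1 ∷ 2 ∷ 3 ∷ 4 ∷ []) ∷ (33 , 0 ∷ 2 ∷ 1 ∷ 4 ∷ 3 ∷ []) ∷ []) ∷
    ((3 ∷ 2 ∷ []) ∷ (4 ∷ []) ∷ [] ∷ []) by plays (3 ∷ 5 ∷ 5 ∷ []) to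
        ((15 , 0 ∷ 2 ∷ 3 ∷ []) ∷ (29 , 0 ∷ 2 ∷ 3 ∷ []) ∷ (29 , 0 ∷ 3 ∷ 2 ∷ []) ∷ (32 , 0 ∷ 1 ∷ 2 ∷ 3 ∷ []) ∷
         (34 , 0 ∷ 1 ∷ 2 ∷ 3 ∷ []) ∷ []) ∷
    -- Equal weights force a row sum of at least 5, as 13 · 4 < 64 < 13 · 5. The minimal rows 4 + 1
    -- and 3 + 2 complete triangles refuted above. From here on, a response with a level 4 is
    -- refuted at once.
    ((4 ∷ []) ∷ [] ∷ []) by plays (1 ∷ 1 ∷ []) to
        ((29 , 0 ∷ 1 ∷ 2 ∷ []) ∷ (29 , 0 ∷ 2 ∷ 1 ∷ []) ∷ (35 , 0 ∷ 1 ∷ 2 ∷ []) ∷ (35 , 0 ∷ 2 ∷ 1 ∷ []) ∷ []) ∷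
    ((1 ∷ 3 ∷ 3 ∷ 3 ∷ []) ∷ (2 ∷ 2 ∷ 3 ∷ []) ∷ (3 ∷ 3 ∷ []) ∷ (3 ∷ []) ∷ [] ∷ []) by plays (1 ∷ 1 ∷ 1 ∷ 1 ∷ 1 ∷ []) to
        ((36 , 0 ∷ 3 ∷ []) ∷ (36 , 0 ∷ 2 ∷ []) ∷ (36 , 0 ∷ 1 ∷ []) ∷ (36 , 0 ∷ 4 ∷ []) ∷ (36 , 0 ∷ 5 ∷ []) ∷ []) ∷
    ((2 ∷ 3 ∷ 3 ∷ 2 ∷ []) ∷ (2 ∷ 2 ∷ 3 ∷ []) ∷ (3 ∷ 3 ∷ []) ∷ (3 ∷ []) ∷ [] ∷ []) by plays (1 ∷ 1 ∷ 1 ∷ 1 ∷ 1 ∷ []) to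
        ((36 , 0 ∷ 3 ∷ []) ∷ (36 , 0 ∷ 2 ∷ []) ∷ (36 , 0 ∷ 1 ∷ []) ∷ (36 , 0 ∷ 4 ∷ []) ∷ (36 , 0 ∷ 5 ∷ []) ∷ []) ∷
    ((2 ∷ 3 ∷ 2 ∷ 3 ∷ []) ∷ (2 ∷ 2 ∷ 3 ∷ []) ∷ (3 ∷ 3 ∷ []) ∷ (3 ∷ []) ∷ [] ∷ []) by plays (1 ∷ 1 ∷ 1 ∷ 1 ∷ 1 ∷ []) to
        ((36 , 0 ∷ 3 ∷ []) ∷ (36 , 0 ∷ 2 ∷ []) ∷ (36 , 0 ∷ 1 ∷ []) ∷ (36 , 0 ∷ 4 ∷ []) ∷ (36 , 0 ∷ 5 ∷ []) ∷ []) ∷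
    ((3 ∷ 3 ∷ 3 ∷ 1 ∷ []) ∷ (2 ∷ 2 ∷ 3 ∷ []) ∷ (3 ∷ 3 ∷ []) ∷ (3 ∷ []) ∷ [] ∷ []) by plays (1 ∷ 1 ∷ 1 ∷ 1 ∷ 1 ∷ []) to
        ((36 , 0 ∷ 3 ∷ []) ∷ (36 , 0 ∷ 2 ∷ []) ∷ (36 , 0 ∷ 1 ∷ []) ∷ (36 , 0 ∷ 4 ∷ []) ∷ (36 , 0 ∷ 5 ∷ []) ∷ []) ∷
    ((3 ∷ 3 ∷ 2 ∷ 2 ∷ []) ∷ (2 ∷ 2 ∷ 3 ∷ []) ∷ (3 ∷ 3 ∷ []) ∷ (3 ∷ []) ∷ [] ∷ []) by plays (1 ∷ 1 ∷ 1 ∷ 1 ∷ 1 ∷ []) to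
        ((36 , 0 ∷ 3 ∷ []) ∷ (36 , 0 ∷ 2 ∷ []) ∷ (36 , 0 ∷ 1 ∷ []) ∷ (36 , 0 ∷ 4 ∷ []) ∷ (36 , 0 ∷ 5 ∷ []) ∷ []) ∷
    ((3 ∷ 3 ∷ 1 ∷ 3 ∷ []) ∷ (2 ∷ 2 ∷ 3 ∷ []) ∷ (3 ∷ 3 ∷ []) ∷ (3 ∷ []) ∷ [] ∷ []) by plays (1 ∷ 1 ∷ 1 ∷ 1 ∷ 1 ∷ []) to
        ((36 , 0 ∷ 3 ∷ []) ∷ (36 , 0 ∷ 2 ∷ []) ∷ (36 , 0 ∷ 1 ∷ []) ∷ (36 , 0 ∷ 4 ∷ []) ∷ (36 , 0 ∷ 5 ∷ []) ∷ []) ∷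
    ((3 ∷ 2 ∷ 2 ∷ 3 ∷ []) ∷ (2 ∷ 2 ∷ 3 ∷ []) ∷ (3 ∷ 3 ∷ []) ∷ (3 ∷ []) ∷ [] ∷ []) by plays (1 ∷ 1 ∷ 1 ∷ 1 ∷ 1 ∷ []) to
        ((36 , 0 ∷ 3 ∷ []) ∷ (36 , 0 ∷ 2 ∷ []) ∷ (36 , 0 ∷ 1 ∷ []) ∷ (36 , 0 ∷ 4 ∷ []) ∷ (36 , 0 ∷ 5 ∷ []) ∷ []) ∷
    ((2 ∷ 2 ∷ 3 ∷ []) ∷ (3 ∷ 3 ∷ []) ∷ (3 ∷ []) ∷ [] ∷ []) by plays (1 ∷ 1 ∷ 1 ∷ 1 ∷ []) to
        ((36 , 0 ∷ 2 ∷ []) ∷ (36 , 0 ∷ 1 ∷ []) ∷ (36 , 0 ∷ 3 ∷ []) ∷ (36 , 0 ∷ 4 ∷ []) ∷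
         (37 , 0 ∷ 1 ∷ 2 ∷ 3 ∷ 4 ∷ []) ∷ (38 , 0 ∷ 1 ∷ 2 ∷ 3 ∷ 4 ∷ []) ∷ (39 , 0 ∷ 1 ∷ 2 ∷ 3 ∷ 4 ∷ []) ∷
         (39 , 0 ∷ 1 ∷ 3 ∷ 2 ∷ 4 ∷ []) ∷ (40 , 0 ∷ 1 ∷ 2 ∷ 3 ∷ 4 ∷ []) ∷ (41 , 0 ∷ 1 ∷ 2 ∷ 3 ∷ 4 ∷ []) ∷
         (41 , 0 ∷ 1 ∷ 3 ∷ 2 ∷ 4 ∷ []) ∷ (42 , 0 ∷ 1 ∷ 2 ∷ 3 ∷ 4 ∷ []) ∷ (42 , 0 ∷ 1 ∷ 3 ∷ 2 ∷ 4 ∷ []) ∷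
         (43 , 0 ∷ 1 ∷ 2 ∷ 3 ∷ 4 ∷ []) ∷ []) ∷
    ((3 ∷ 2 ∷ 3 ∷ 2 ∷ 3 ∷ []) ∷ (3 ∷ 2 ∷ 3 ∷ 2 ∷ []) ∷ (3 ∷ 2 ∷ 3 ∷ []) ∷ (3 ∷ 2 ∷ []) ∷ (3 ∷ []) ∷ [] ∷ []) by plays (1 ∷ 1 ∷ 1 ∷ 1 ∷ 1 ∷ 1 ∷ []) to
        ((36 , 0 ∷ 3 ∷ []) ∷ (36 , 0 ∷ 2 ∷ []) ∷ (36 , 0 ∷ 1 ∷ []) ∷ (36 , 0 ∷ 4 ∷ []) ∷ (36 , 0 ∷ 5 ∷ []) ∷
         (36 , 0 ∷ 6 ∷ []) ∷ (44 , 1 ∷ 0 ∷ 3 ∷ 4 ∷ []) ∷ (44 , 6 ∷ 0 ∷ 2 ∷ 5 ∷ []) ∷ []) ∷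
    ((3 ∷ 2 ∷ 3 ∷ 2 ∷ []) ∷ (3 ∷ 2 ∷ 3 ∷ []) ∷ (3 ∷ 2 ∷ []) ∷ (3 ∷ []) ∷ [] ∷ []) by plays (1 ∷ 1 ∷ 1 ∷ 1 ∷ 1 ∷ []) to
        ((36 , 0 ∷ 3 ∷ []) ∷ (36 , 0 ∷ 2 ∷ []) ∷ (36 , 0 ∷ 1 ∷ []) ∷ (36 , 0 ∷ 4 ∷ []) ∷ (36 , 0 ∷ 5 ∷ []) ∷
         (44 , 1 ∷ 0 ∷ 3 ∷ 2 ∷ []) ∷ (44 , 5 ∷ 0 ∷ 1 ∷ 4 ∷ []) ∷ (44 , 3 ∷ 0 ∷ 5 ∷ 2 ∷ []) ∷
         (44 , 1 ∷ 0 ∷ 3 ∷ 4 ∷ []) ∷ (45 , 0 ∷ 1 ∷ 2 ∷ 3 ∷ 4 ∷ 5 ∷ []) ∷ []) ∷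
    ((3 ∷ 2 ∷ 3 ∷ []) ∷ (3 ∷ 2 ∷ []) ∷ (3 ∷ []) ∷ [] ∷ []) by plays (1 ∷ 1 ∷ 1 ∷ 1 ∷ []) to
        ((36 , 0 ∷ 2 ∷ []) ∷ (36 , 0 ∷ 1 ∷ []) ∷ (36 , 0 ∷ 3 ∷ []) ∷ (36 , 0 ∷ 4 ∷ []) ∷ (44 , 3 ∷ 0 ∷ 1 ∷ 2 ∷ []) ∷
         (44 , 4 ∷ 0 ∷ 2 ∷ 3 ∷ []) ∷ (44 , 2 ∷ 0 ∷ 4 ∷ 1 ∷ []) ∷ (44 , 1 ∷ 0 ∷ 3 ∷ 4 ∷ []) ∷
         (46 , 0 ∷ 1 ∷ 2 ∷ 3 ∷ 4 ∷ []) ∷ (46 , 0 ∷ 2 ∷ 1 ∷ 4 ∷ 3 ∷ []) ∷ []) ∷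
    ((3 ∷ 2 ∷ []) ∷ (3 ∷ []) ∷ [] ∷ []) by plays (1 ∷ 1 ∷ 1 ∷ []) to
        ((36 , 0 ∷ 2 ∷ []) ∷ (36 , 0 ∷ 1 ∷ []) ∷ (36 , 0 ∷ 3 ∷ []) ∷ (44 , 3 ∷ 0 ∷ 1 ∷ 2 ∷ []) ∷
         (44 , 1 ∷ 0 ∷ 3 ∷ 2 ∷ []) ∷ (47 , 0 ∷ 1 ∷ 2 ∷ 3 ∷ []) ∷ []) ∷
    ((3 ∷ []) ∷ [] ∷ []) by plays (1 ∷ 1 ∷ []) to
        ((36 , 0 ∷ 1 ∷ []) ∷ (36 , 0 ∷ 2 ∷ []) ∷ (48 , 0 ∷ 1 ∷ 2 ∷ []) ∷ (48 , 0 ∷ 2 ∷ 1 ∷ []) ∷ []) ∷ []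

  -- Any cluster has a partner at level 3 or more, because 13 · 2 < 32 < 13 · 3.
  opening : Entry
  opening = ([] ∷ []) by plays (1 ∷ []) to ((49 , 0 ∷ 1 ∷ []) ∷ [])

  strategy : List Entry
  strategy = preparations ++ opening ∷ []

  opening∈strategy : opening ∈ strategy
  opening∈strategy = ∈-++⁺ʳ preparations (here refl)

  strategy-checks : checks [] strategy ≡ true
  strategy-checks = refl

-- Deleting clusters of low degree
module MinimumDegree where

  open import Data.Bool using (T)
  open import Data.Empty using (⊥; ⊥-elim)
  open import Data.List using (List; []; _∷_; _++_; length; map)
  import Data.List.Properties as Listₚ
  open import Data.List.Membership.Propositional using (_∈_; find)
  import Data.List.Membership.Propositional.Properties as Memₚ
  open import Data.List.Relation.Unary.All as All using (All; []; _∷_)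
  import Data.List.Relation.Unary.All.Properties as Allₚ
  import Data.List.Relation.Unary.Any as Any
  open import Data.Nat using (ℕ; zero; suc; _+_; _*_; _≤_; _<_; z≤n; s≤s; _<?_)
  open import Data.Nat.ListAction using (sum)
  import Data.Nat.Properties as ℕₚ
  open import Data.Nat.Tactic.RingSolver using (solve-∀)
  open import Data.Product using (∃-syntax; _×_; _,_)
  open import Data.Vec as Vec using (Vec; []; _∷_)
  open import Data.Vec.Relation.Unary.All using ([]; _∷_) renaming (All to VAll)
  open import Relation.Nullary using (yes; no; ¬_)
  open import Relation.Binary.PropositionalEquality using (_≡_; refl; sym; trans; cong; cong₂; subst; subst₂)
  open Game using (dot; beats)

  sumOver : {A : Set} → List A → (A → ℕ) → ℕ
  sumOver xs f = sum (map f xs)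

  sumOver-+ : ∀ {A : Set} (xs : List A) f g → sumOver xs (λ x → f x + g x) ≡ sumOver xs f + sumOver xs g
  sumOver-+ []       f g = refl
  sumOver-+ (x ∷ xs) f g = trans (cong (f x + g x +_) (sumOver-+ xs f g)) (regroup (f x) (g x) _ _)
    where
    regroup : ∀ a b c d → a + b + (c + d) ≡ a + c + (b + d)
    regroup = solve-∀

  sumOver-cong : ∀ {A : Set} (xs : List A) {f g : A → ℕ} → (∀ x → f x ≡ g x) → sumOver xs f ≡ sumOver xs g
  sumOver-cong xs e = cong sum (Listₚ.map-cong e xs)

  sumOver-scale : ∀ {A : Set} (xs : List A) c f → sumOver xs (λ x → c * f x) ≡ c * sumOver xs f
  sumOver-scale []       c f = sym (ℕₚ.*-zeroʳ c)
  sumOver-scale (x ∷ xs) c f = trans (cong (c * f x +_) (sumOver-scale xs c f)) (sym (ℕₚ.*-distribˡ-+ c (f x) _))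

  sumOver-insert : ∀ {A : Set} (as : List A) {i bs} f → sumOver (as ++ i ∷ bs) f ≡ sumOver (as ++ bs) f + f i
  sumOver-insert []       {i} {bs} f = ℕₚ.+-comm (f i) (sumOver bs f)
  sumOver-insert (a ∷ as) f = trans (cong (f a +_) (sumOver-insert as f)) (sym (ℕₚ.+-assoc (f a) _ _))

  sumOver-bound : ∀ {A : Set} {xs : List A} {f c} → All (λ x → f x ≤ c) xs → sumOver xs f ≤ length xs * c
  sumOver-bound []       = z≤n
  sumOver-bound (p ∷ ps) = ℕₚ.+-mono-≤ p (sumOver-bound ps)

  module Deletion {A : Set} (L : A → A → ℕ) (L-sym : ∀ a b → L a b ≡ L b a) (L-irrefl : ∀ a → L a a ≡ 0) where

    degreeIn : List A → A → ℕ
    degreeIn S i = sumOver S (L i)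

    totalDegree : List A → ℕ
    totalDegree S = sumOver S (degreeIn S)

    -- The inserted point contributes its own degree and, by symmetry, the same amount to the
    -- degrees of the others; `L-irrefl` removes its contribution to itself.
    totalDegree-insert : ∀ as {i bs} → totalDegree (as ++ i ∷ bs) ≡ totalDegree (as ++ bs) + 2 * degreeIn (as ++ i ∷ bs) i
    totalDegree-insert as {i} {bs} = trans (sumOver-insert as (degreeIn (as ++ i ∷ bs)))
      (trans (cong (_+ degreeIn (as ++ i ∷ bs) i)
        (trans (sumOver-cong (as ++ bs) (λ x → trans (sumOver-insert as (L x)) (cong (degreeIn (as ++ bs) x +_) (L-sym x i))))
          (sumOver-+ (as ++ bs) (degreeIn (as ++ bs)) (L i))))
        (trans (ℕₚ.+-assoc (totalDegree (as ++ bs)) _ _) (cong (totalDegree (as ++ bs) +_) (cong₂ _+_ same (sym (ℕₚ.+-identityʳ _))))))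
      where
      same : degreeIn (as ++ bs) i ≡ degreeIn (as ++ i ∷ bs) i
      same = sym (trans (sumOver-insert as (L i)) (trans (cong (degreeIn (as ++ bs) i +_) (L-irrefl i)) (ℕₚ.+-identityʳ _)))

    -- The excess over 32 (s² + s) survives the deletion of a point of degree at most 32 s / 13.
    dense-core : ∀ s S → length S ≡ s → 32 * (s * s + s) < 13 * totalDegree S →
      (∀ S′ → 1 ≤ length S′ → (∀ {i} → i ∈ S′ → 32 * length S′ < 13 * degreeIn S′ i) → ⊥) → ⊥
    dense-core zero    [] e dense found = ℕₚ.n≮0 dense
    dense-core (suc s) S  e dense found with All.all? (λ i → 32 * length S <? 13 * degreeIn S i) S
    ... | yes all = found S (subst (1 ≤_) (sym e) (s≤s z≤n)) (All.lookup all)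
    ... | no ¬all with find (Allₚ.¬All⇒Any¬ (λ i → 32 * length S <? 13 * degreeIn S i) S ¬all)
    ... | i , i∈ , low with Memₚ.∈-∃++ i∈
    ... | as , bs , refl = dense-core s (as ++ bs) (ℕₚ.suc-injective (trans (sym len) e))
          (ℕₚ.+-cancelʳ-< (2 * (32 * suc s)) _ _ (ℕₚ.<-≤-trans
            (subst₂ _<_ (square s) (trans (cong (13 *_) (totalDegree-insert as)) (expand (totalDegree (as ++ bs)) d)) dense)
            (ℕₚ.+-monoʳ-≤ (13 * totalDegree (as ++ bs)) (ℕₚ.*-monoʳ-≤ 2 (subst (λ l → 13 * d ≤ 32 * l) e (ℕₚ.≮⇒≥ low)))))) found
      where
      d = degreeIn (as ++ i ∷ bs) i
      len : length (as ++ i ∷ bs) ≡ suc (length (as ++ bs))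
      len = trans (Listₚ.length-++ as) (trans (ℕₚ.+-suc (length as) (length bs)) (cong suc (sym (Listₚ.length-++ as))))
      square : ∀ s → 32 * (suc s * suc s + suc s) ≡ 32 * (s * s + s) + 2 * (32 * suc s)
      square = solve-∀
      expand : ∀ t d → 13 * (t + 2 * d) ≡ 13 * t + 2 * (13 * d)
      expand = solve-∀

    module _ (S : List A) (high : ∀ {i} → i ∈ S → 32 * length S < 13 * degreeIn S i) where

      -- By symmetry the double sum can be taken weighted cluster by weighted cluster. Each gives
      -- its weight times its degree in `S`, and 13 times that degree is at least 32 |S| + 1.
      weighted-degree : ∀ {n} (c : Vec ℕ n) vs → VAll (_∈ S) vs →
        suc (32 * length S) * Vec.sum c ≤ 13 * sumOver S (λ v → dot c (Vec.map (L v) vs))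
      weighted-degree []      []       []          = subst (_≤ 13 * sumOver S (λ _ → 0)) (sym (ℕₚ.*-zeroʳ (suc (32 * length S)))) z≤n
      weighted-degree (a ∷ c) (v ∷ vs) (v∈ ∷ vs∈) =
        subst₂ _≤_ (sym (ℕₚ.*-distribˡ-+ (suc (32 * length S)) a (Vec.sum c))) (sym rearranged)
          (ℕₚ.+-mono-≤ (subst (suc (32 * length S) * a ≤_) (swap 13 (degreeIn S v) a) (ℕₚ.*-monoˡ-≤ a (high v∈)))
            (weighted-degree c vs vs∈))
        where
        swap : ∀ t d a → t * d * a ≡ t * (a * d)
        swap = solve-∀
        rearranged : 13 * sumOver S (λ w → a * L w v + dot c (Vec.map (L w) vs)) ≡
          13 * (a * degreeIn S v) + 13 * sumOver S (λ w → dot c (Vec.map (L w) vs))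
        rearranged = trans (cong (13 *_) (trans (sumOver-+ S _ _)
            (cong (_+ _) (trans (sumOver-scale S a (λ w → L w v)) (cong (a *_) (sumOver-cong S λ w → L-sym w v))))))
          (ℕₚ.*-distribˡ-+ 13 (a * degreeIn S v) _)

      -- Averaging over `S`: if no cluster beat the weights, 13 times the weighted total would be at
      -- most 32 |S| Σ c, which is less than (32 |S| + 1) Σ c since Σ c ≥ 1.
      respond : ∀ {n} (c : Vec ℕ n) vs → 1 ≤ Vec.sum c → VAll (_∈ S) vs → ∃[ v ] (v ∈ S × T (beats c (Vec.map (L v) vs)))
      respond c vs c≥1 vs∈ with Any.any? (λ v → 32 * Vec.sum c <? 13 * dot c (Vec.map (L v) vs)) S
      ... | yes some = let v , v∈ , lt = find some in v , v∈ , ℕₚ.<⇒<ᵇ lt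
      ... | no none  = ⊥-elim (ℕₚ.<⇒≱ (ℕₚ.<-≤-trans strict (weighted-degree c vs vs∈)) bounded)
        where
        upper : All (λ v → 13 * dot c (Vec.map (L v) vs) ≤ 32 * Vec.sum c) S
        upper = All.map ℕₚ.≮⇒≥ (Allₚ.¬Any⇒All¬ S none)
        bounded : 13 * sumOver S (λ v → dot c (Vec.map (L v) vs)) ≤ length S * (32 * Vec.sum c)
        bounded = subst (_≤ length S * (32 * Vec.sum c)) (sumOver-scale S 13 _) (sumOver-bound upper)
        strict : length S * (32 * Vec.sum c) < suc (32 * length S) * Vec.sum c
        strict = subst (_< suc (32 * length S) * Vec.sum c) (swap (length S) (Vec.sum c)) (ℕₚ.+-monoˡ-≤ (32 * length S * Vec.sum c) c≥1)
          where
          swap : ∀ l s → 32 * l * s ≡ l * (32 * s)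
          swap = solve-∀

-- Pairwise regular families of measures
module Regularity where

  open import Data.List using (List; _∷_; allFin)
  open import Data.Rational using (ℚ; 0ℚ; 1ℚ; _≤_; _<_; _+_; _*_; _-_; -_; _≤?_)
  open import Relation.Binary.PropositionalEquality using (_≡_; _≢_; refl; sym; trans; cong; cong₂; subst; subst₂; module ≡-Reasoning)

  module Reg {V : Set} (xs : List V) (A : V → V → ℚ) (A-sym : ∀ x y → A x y ≡ A y x)
    (A≥0 : ∀ x y → 0ℚ ≤ A x y) (A≤1 : ∀ x y → A x y ≤ 1ℚ) where

    open Rationals
    open import Data.Empty using (⊥; ⊥-elim)
    open import Data.Fin as Fin using (Fin)
    open import Data.List.Membership.Propositional using (_∈_)
    open import Data.List.Membership.Propositional.Properties using (∈-allFin)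
    open import Data.Nat using (ℕ; zero; suc)
    open import Data.Product using (∃-syntax; _×_; _,_)
    open import Data.Sum using (_⊎_; inj₁; inj₂; [_,_]′)
    import Data.Rational.Properties as ℚₚ
    open import Relation.Nullary using (yes; no; ¬_)
    open import Tactic.RingSolver using (solve-∀)

    record Distribution (μ : V → ℚ) : Set where
      field
        nonNeg : ∀ x → 0ℚ ≤ μ x
        total  : ∑ xs μ ≡ 1ℚ
    open Distribution public

    degree : (V → ℚ) → V → ℚ
    degree ν x = ∑ xs λ y → ν y * A x y

    density : (V → ℚ) → (V → ℚ) → ℚ
    density μ ν = ∑ xs λ x → μ x * degree ν x

    record Mixture (p q : ℚ) (μ μ′ μ″ : V → ℚ) : Set where
      constructor mixture
      field
        mixes : ∀ x → μ x ≡ p * μ′ x + q * μ″ x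
    open Mixture public

    density-sym : ∀ μ ν → density μ ν ≡ density ν μ
    density-sym μ ν = begin
      ∑ xs (λ x → μ x * ∑ xs (λ y → ν y * A x y))   ≡⟨ ∑-cong xs (λ x → sym (∑-scale xs (μ x) _)) ⟩
      ∑ xs (λ x → ∑ xs (λ y → μ x * (ν y * A x y))) ≡⟨ ∑-swap xs xs _ ⟩
      ∑ xs (λ y → ∑ xs (λ x → μ x * (ν y * A x y))) ≡⟨ ∑-cong xs (λ y → ∑-cong xs λ x → swap x y) ⟩
      ∑ xs (λ y → ∑ xs (λ x → ν y * (μ x * A y x))) ≡⟨ ∑-cong xs (λ y → ∑-scale xs (ν y) _) ⟩
      ∑ xs (λ y → ν y * ∑ xs (λ x → μ x * A y x))   ∎
      where
      open ≡-Reasoning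
      exchange : ∀ a b c → a * (b * c) ≡ b * (a * c)
      exchange = solve-∀ ℚ-ring
      swap : ∀ x y → μ x * (ν y * A x y) ≡ ν y * (μ x * A y x)
      swap x y = trans (cong (λ t → μ x * (ν y * t)) (A-sym x y)) (exchange (μ x) (ν y) (A y x))

    density-mixˡ : ∀ {p q μ μ′ μ″} ν → Mixture p q μ μ′ μ″ → density μ ν ≡ p * density μ′ ν + q * density μ″ ν
    density-mixˡ {p} {q} {μ} {μ′} {μ″} ν mix =
      trans (∑-cong xs λ x → trans (cong (_* degree ν x) (mixes mix x)) (expand p q (μ′ x) (μ″ x) (degree ν x)))
            (∑-linear xs p q _ _)
      where
      expand : ∀ p q a b c → (p * a + q * b) * c ≡ p * (a * c) + q * (b * c)
      expand = solve-∀ ℚ-ring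

    density-mixʳ : ∀ {p q μ μ′ μ″} ν → Mixture p q μ μ′ μ″ → density ν μ ≡ p * density ν μ′ + q * density ν μ″
    density-mixʳ {p} {q} {μ} {μ′} {μ″} ν mix =
      trans (density-sym ν μ) (trans (density-mixˡ ν mix)
        (cong₂ (λ a b → p * a + q * b) (density-sym μ′ ν) (density-sym μ″ ν)))

    degree≥0 : ∀ {ν} → Distribution ν → ∀ x → 0ℚ ≤ degree ν x
    degree≥0 ν-dist x = ∑-nonNeg xs λ y → nonNeg ν-dist y ⊗ A≥0 x y

    degree≤1 : ∀ {ν} → Distribution ν → ∀ x → degree ν x ≤ 1ℚ
    degree≤1 {ν} ν-dist x = subst (degree ν x ≤_) (total ν-dist)
      (∑-mono xs λ y → close (nonNeg ν-dist y ⊗ gap (A≤1 x y)) (factor (ν y) (A x y)))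
      where
      factor : ∀ a b → a - a * b ≡ a * (1ℚ - b)
      factor = solve-∀ ℚ-ring

    density≥0 : ∀ {μ ν} → Distribution μ → Distribution ν → 0ℚ ≤ density μ ν
    density≥0 μ-dist ν-dist = ∑-nonNeg xs λ x → nonNeg μ-dist x ⊗ degree≥0 ν-dist x

    -- The bound carries the weight `μ x`, so `f` has to be controlled only on the support of `μ`.
    average-≤ : ∀ {μ} → Distribution μ → ∀ (f : V → ℚ) c → (∀ x → μ x * f x ≤ μ x * c) → ∑ xs (λ x → μ x * f x) ≤ c
    average-≤ {μ} μ-dist f c le = subst (∑ xs (λ x → μ x * f x) ≤_)
      (trans (∑-cong xs λ x → ℚₚ.*-comm (μ x) c) (trans (∑-scale xs c μ) (trans (cong (c *_) (total μ-dist)) (ℚₚ.*-identityʳ c))))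
      (∑-mono xs le)

    density≤1 : ∀ {μ ν} → Distribution μ → Distribution ν → density μ ν ≤ 1ℚ
    density≤1 {μ} {ν} μ-dist ν-dist = average-≤ μ-dist (degree ν) 1ℚ λ x →
      close (nonNeg μ-dist x ⊗ gap (degree≤1 ν-dist x)) (factor (μ x) (degree ν x))
      where
      factor : ∀ a b → a * 1ℚ - a * b ≡ a * (1ℚ - b)
      factor = solve-∀ ℚ-ring

    -- The counterpart of a subset of relative size ε: `μ` splits into `ν` with weight ε and a
    -- non-negative remainder.
    Within : ℚ → (V → ℚ) → (V → ℚ) → Set
    Within ε ν μ = ∀ x → ε * ν x ≤ μ x

    -- One-sided, since finding cliques only takes lower bounds on densities. The slack is twice ξ
    -- because the two measures are replaced one after the other, each time with a loss of at most
    -- ξ.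
    Regular : ∀ {k} → ℚ → ℚ → (Fin k → V → ℚ) → Set
    Regular ε ξ μ = ∀ {i j} → i ≢ j → ∀ {μ′ ν′} → Distribution μ′ → Distribution ν′ → Within ε μ′ (μ i) → Within ε ν′ (μ j) →
      density (μ i) (μ j) - (ξ + ξ) ≤ density μ′ ν′

    -- Energy of a family and its increments

    module Energy {k : ℕ} (η : ℚ) (η≥0 : 0ℚ ≤ η) where

      convexify : ℚ → ℚ
      convexify w = w + η * (w * w)

      -- The linear parts cancel, and the squares leave η times the variance p q (b - a)² of a
      -- two-point distribution.
      convexify-mix : ∀ p q {a b w} → p + q ≡ 1ℚ → w ≡ p * a + q * b →
        p * convexify a + q * convexify b - convexify w ≡ η * (p * q * ((b - a) * (b - a)))
      convexify-mix p q {a} {b} p+q refl = subst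
        (λ q → p * convexify a + q * convexify b - convexify (p * a + q * b) ≡ η * (p * q * ((b - a) * (b - a))))
        (trans (cong (_- p) (sym p+q)) (cancel p q)) (expand p η a b)
        where
        cancel : ∀ p q → p + q - p ≡ q
        cancel = solve-∀ ℚ-ring
        expand : ∀ p h a b → p * (a + h * (a * a)) + (1ℚ - p) * (b + h * (b * b))
            - (p * a + (1ℚ - p) * b + h * ((p * a + (1ℚ - p) * b) * (p * a + (1ℚ - p) * b)))
          ≡ h * (p * (1ℚ - p) * ((b - a) * (b - a)))
        expand = solve-∀ ℚ-ring

      Family : Set
      Family = Fin k → V → ℚ

      -- The diagonal is left out: there the density would be quadratic, not linear, in the measure
      -- being split.
      pairEnergy : Family → Fin k → Fin k → ℚ
      pairEnergy μ a b with a Fin.≟ b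
      ... | yes _ = 0ℚ
      ... | no _  = convexify (density (μ a) (μ b))

      energy : Family → ℚ
      energy μ = ∑ (allFin k) λ a → ∑ (allFin k) (pairEnergy μ a)

      _[_≔_] : Family → Fin k → (V → ℚ) → Family
      (μ [ i ≔ ν ]) a with a Fin.≟ i
      ... | yes _ = ν
      ... | no _  = μ a

      update-same : ∀ μ i ν → (μ [ i ≔ ν ]) i ≡ ν
      update-same μ i ν with i Fin.≟ i
      ... | yes _  = refl
      ... | no i≢i = ⊥-elim (i≢i refl)

      update-other : ∀ μ {i j} ν → j ≢ i → (μ [ i ≔ ν ]) j ≡ μ j
      update-other μ {i} {j} ν j≢i with j Fin.≟ i
      ... | yes j≡i = ⊥-elim (j≢i j≡i)
      ... | no _    = refl

      module _ {p q : ℚ} (p≥0 : 0ℚ ≤ p) (q≥0 : 0ℚ ≤ q) (p+q≡1 : p + q ≡ 1ℚ)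
               (μ : Family) (i : Fin k) {μ′ μ″ : V → ℚ} (mix : Mixture p q (μ i) μ′ μ″) where

        private
          loss : ∀ a b → 0ℚ ≤ η * (p * q * ((b - a) * (b - a)))
          loss a b = η≥0 ⊗ (p≥0 ⊗ q≥0 ⊗ square≥0 (b - a))

          same : ∀ c → c ≡ p * c + q * c
          same c = trans (sym (ℚₚ.*-identityˡ c)) (trans (cong (_* c) (sym p+q≡1)) (ℚₚ.*-distribʳ-+ c p q))

          by-convexity : ∀ {a b w} → w ≡ p * a + q * b → convexify w ≤ p * convexify a + q * convexify b
          by-convexity {a} {b} e = close (loss a b) (convexify-mix p q p+q≡1 e)

          pair-split : ∀ a b → pairEnergy μ a b ≤ p * pairEnergy (μ [ i ≔ μ′ ]) a b + q * pairEnergy (μ [ i ≔ μ″ ]) a b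
          pair-split a b with a Fin.≟ b
          ... | yes _ = ℚₚ.≤-reflexive (same 0ℚ)
          ... | no a≢b with a Fin.≟ i | b Fin.≟ i
          ...   | yes refl | yes refl = ⊥-elim (a≢b refl)
          ...   | yes refl | no _     = by-convexity (density-mixˡ (μ b) mix)
          ...   | no _     | yes refl = by-convexity (density-mixʳ (μ a) mix)
          ...   | no _     | no _     = ℚₚ.≤-reflexive (same _)

          pair-gain : ∀ j → i ≢ j →
            pairEnergy μ i j + η * (p * q * ((density μ″ (μ j) - density μ′ (μ j)) * (density μ″ (μ j) - density μ′ (μ j))))
            ≤ p * pairEnergy (μ [ i ≔ μ′ ]) i j + q * pairEnergy (μ [ i ≔ μ″ ]) i j
          pair-gain j i≢j with i Fin.≟ j
          ... | yes i≡j = ⊥-elim (i≢j i≡j)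
          ... | no _ with i Fin.≟ i | j Fin.≟ i
          ...   | no i≢i | _        = ⊥-elim (i≢i refl)
          ...   | yes _  | yes j≡i  = ⊥-elim (i≢j (sym j≡i))
          ...   | yes _  | no _     = ℚₚ.≤-reflexive (rearrange _ _ (convexify-mix p q p+q≡1 (density-mixˡ (μ j) mix)))
            where
            rearrange : ∀ {g} s t → t - s ≡ g → s + g ≡ t
            rearrange s t refl = trans (ℚₚ.+-comm s _) (restore s t)

          combine : ∀ a → ∑ (allFin k) (λ b → p * pairEnergy (μ [ i ≔ μ′ ]) a b + q * pairEnergy (μ [ i ≔ μ″ ]) a b)
                        ≡ p * ∑ (allFin k) (pairEnergy (μ [ i ≔ μ′ ]) a) + q * ∑ (allFin k) (pairEnergy (μ [ i ≔ μ″ ]) a)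
          combine a = ∑-linear (allFin k) p q _ _

          inner : ∀ a → ∑ (allFin k) (pairEnergy μ a)
                      ≤ p * ∑ (allFin k) (pairEnergy (μ [ i ≔ μ′ ]) a) + q * ∑ (allFin k) (pairEnergy (μ [ i ≔ μ″ ]) a)
          inner a = ℚₚ.≤-trans (∑-mono (allFin k) (pair-split a)) (ℚₚ.≤-reflexive (combine a))

        energy-split : energy μ ≤ p * energy (μ [ i ≔ μ′ ]) + q * energy (μ [ i ≔ μ″ ])
        energy-split = subst (energy μ ≤_) (∑-linear (allFin k) p q _ _) (∑-mono (allFin k) inner)

        -- Only the ordered pair (i, j) is evaluated exactly; by convexity no other pair loses on
        -- average.
        energy-split-gain : ∀ j → i ≢ j →
          energy μ + η * (p * q * ((density μ″ (μ j) - density μ′ (μ j)) * (density μ″ (μ j) - density μ′ (μ j))))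
          ≤ p * energy (μ [ i ≔ μ′ ]) + q * energy (μ [ i ≔ μ″ ])
        energy-split-gain j i≢j = ℚₚ.≤-trans
          (∑-gain (allFin k) inner (∈-allFin i)
            (ℚₚ.≤-trans (∑-gain (allFin k) (pair-split i) (∈-allFin j) (pair-gain j i≢j)) (ℚₚ.≤-reflexive (combine i))))
          (ℚₚ.≤-reflexive (∑-linear (allFin k) p q _ _))

      some-≥ : ∀ {p q t a b} → 0ℚ < p → 0ℚ ≤ q → p + q ≡ 1ℚ → t ≤ p * a + q * b → t ≤ a ⊎ t ≤ b
      some-≥ {p} {q} {t} {a} {b} p>0 q≥0 p+q t≤ with t ≤? a | t ≤? b
      ... | yes t≤a | _       = inj₁ t≤a
      ... | no _    | yes t≤b = inj₂ t≤b
      ... | no t≰a  | no t≰b  = ⊥-elim (absurd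
        (subst (0ℚ <_) (rearrange p q t a b) (gap t≤ ⊕ q≥0 ⊗ gap (ℚₚ.<⇒≤ (ℚₚ.≰⇒> t≰b)) ⊕< p>0 ⊗< gap< (ℚₚ.≰⇒> t≰a)))
        (ℚₚ.≤-reflexive (trans (cong (λ s → (s - 1ℚ) * t) p+q) (zero-factor t))))
        where
        rearrange : ∀ p q t a b → p * a + q * b - t + q * (t - b) + p * (t - a) ≡ (p + q - 1ℚ) * t
        rearrange = solve-∀ ℚ-ring
        zero-factor : ∀ t → (1ℚ - 1ℚ) * t ≡ 0ℚ
        zero-factor = solve-∀ ℚ-ring

      -- Here q = 1 - ε and r = 1/q, given by equations so that the ring solver meets no division.
      -- With `ε≤q` both parts of a splitting are pieces of weight ε.
      record Constants : Set where
        field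
          ε q r ξ u         : ℚ
          ε>0               : 0ℚ < ε
          ξ≥0               : 0ℚ ≤ ξ
          q≥0               : 0ℚ ≤ q
          r≥0               : 0ℚ ≤ r
          ε+q≡1             : ε + q ≡ 1ℚ
          q*r≡1             : q * r ≡ 1ℚ
          ε≤q               : ε ≤ q

      module Regularise (constants : Constants) where
        open Constants constants

        private
          ε≥0 = ℚₚ.<⇒≤ ε>0

          ε≤1 : ε ≤ 1ℚ
          ε≤1 = close q≥0 (trans (cong (_- ε) (sym ε+q≡1)) (cancel ε q))
            where cancel : ∀ p q → p + q - p ≡ q
                  cancel = solve-∀ ℚ-ring

          εr≤1 : 0ℚ ≤ 1ℚ - ε * r
          εr≤1 = subst (λ s → 0ℚ ≤ s - ε * r) q*r≡1 (subst (0ℚ ≤_) (factor q r ε) (gap ε≤q ⊗ r≥0))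
            where factor : ∀ q r ε → (q - ε) * r ≡ q * r - ε * r
                  factor = solve-∀ ℚ-ring

        -- `G` is the gain guaranteed when one side of a pair loses more than ξ. The smaller `β` is
        -- what remains of it after a preliminary move to a part of weight ε.
        G β : ℚ
        G = η * (ε * (ξ * ξ))
        β = ε * G

        G≥0 : 0ℚ ≤ G
        G≥0 = η≥0 ⊗ (ε≥0 ⊗ (ξ≥0 ⊗ ξ≥0))

        complement : (μ μ′ : V → ℚ) → V → ℚ
        complement μ μ′ x = r * (μ x - ε * μ′ x)

        module _ {μ μ′ : V → ℚ} (μ-dist : Distribution μ) (μ′-dist : Distribution μ′) (sub : Within ε μ′ μ) where

          complement-mix : Mixture ε q μ μ′ (complement μ μ′)
          complement-mix = mixture λ x → sym (trans (expand ε q r (μ x) (μ′ x))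
            (trans (cong (λ s → ε * μ′ x + s * (μ x - ε * μ′ x)) q*r≡1) (simplify (μ x) (ε * μ′ x))))
            where
            expand : ∀ ε q r a b → ε * b + q * (r * (a - ε * b)) ≡ ε * b + q * r * (a - ε * b)
            expand = solve-∀ ℚ-ring
            simplify : ∀ a c → c + 1ℚ * (a - c) ≡ a
            simplify = solve-∀ ℚ-ring

          complement-dist : Distribution (complement μ μ′)
          complement-dist .nonNeg x = r≥0 ⊗ gap (sub x)
          complement-dist .total = begin
            ∑ xs (λ x → r * (μ x - ε * μ′ x))         ≡⟨ ∑-cong xs (λ x → expand r ε (μ x) (μ′ x)) ⟩
            ∑ xs (λ x → r * μ x + (- (r * ε)) * μ′ x) ≡⟨ ∑-linear xs r (- (r * ε)) μ μ′ ⟩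
            r * ∑ xs μ + (- (r * ε)) * ∑ xs μ′        ≡⟨ cong₂ (λ a b → r * a + (- (r * ε)) * b) (total μ-dist) (total μ′-dist) ⟩
            r * 1ℚ + (- (r * ε)) * 1ℚ                 ≡⟨ cong (λ s → r * s + (- (r * ε)) * 1ℚ) (sym ε+q≡1) ⟩
            r * (ε + q) + (- (r * ε)) * 1ℚ            ≡⟨ collapse r ε q ⟩
            q * r                                     ≡⟨ q*r≡1 ⟩
            1ℚ                                        ∎
            where
            open ≡-Reasoning
            expand : ∀ r ε a b → r * (a - ε * b) ≡ r * a + (- (r * ε)) * b
            expand = solve-∀ ℚ-ring
            collapse : ∀ r ε q → r * (ε + q) + (- (r * ε)) * 1ℚ ≡ q * r
            collapse = solve-∀ ℚ-ring

          complement-within : Within ε (complement μ μ′) μ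
          complement-within x = close (εr≤1 ⊗ gap (sub x) ⊕ ε≥0 ⊗ nonNeg μ′-dist x) (factor ε r (μ x) (μ′ x))
            where
            factor : ∀ ε r a b → a - ε * (r * (a - ε * b)) ≡ (1ℚ - ε * r) * (a - ε * b) + ε * b
            factor = solve-∀ ℚ-ring

        Distributions : Family → Set
        Distributions μ = ∀ a → Distribution (μ a)

        update-dist : ∀ {μ i ν} → Distributions μ → Distribution ν → Distributions (μ [ i ≔ ν ])
        update-dist {i = i} μ-dist ν-dist a with a Fin.≟ i
        ... | yes _ = ν-dist
        ... | no _  = μ-dist a

        -- Let D′ and D″ be the densities of the two parts towards `μ j`. The drop from the mean to
        -- D′ equals q (D″ - D′), so this is at least ξ, and the average gain η ε q (D″ - D′)² is at
        -- least η ε ξ² = `G`. One of the parts reaches the average.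
        improve : ∀ {μ i j μ′} → Distributions μ → i ≢ j → Distribution μ′ → Within ε μ′ (μ i) →
          density μ′ (μ j) < density (μ i) (μ j) - ξ →
          ∃[ ν ] (Distribution ν × Within ε ν (μ i) × energy μ + G ≤ energy (μ [ i ≔ ν ]))
        improve {μ} {i} {j} {μ′} μ-dist i≢j μ′-dist sub low =
          [ (λ E′ → μ′ , μ′-dist , sub , E′)
          , (λ E″ → complement (μ i) μ′ , complement-dist (μ-dist i) μ′-dist sub , complement-within (μ-dist i) μ′-dist sub , E″)
          ]′ (some-≥ ε>0 q≥0 ε+q≡1 (ℚₚ.≤-trans enough
               (energy-split-gain ε≥0 q≥0 ε+q≡1 μ i (complement-mix (μ-dist i) μ′-dist sub) j i≢j)))
          where
          D′ = density μ′ (μ j)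
          D″ = density (complement (μ i) μ′) (μ j)
          z  = q * (D″ - D′)

          drop : density (μ i) (μ j) - D′ ≡ z
          drop = trans (cong (_- D′) (density-mixˡ (μ j) (complement-mix (μ-dist i) μ′-dist sub)))
            (trans (cong (λ s → ε * D′ + q * D″ - s) (trans (sym (ℚₚ.*-identityˡ D′)) (cong (_* D′) (sym ε+q≡1)))) (collect ε q D′ D″))
            where
            collect : ∀ ε q a b → ε * a + q * b - (ε + q) * a ≡ q * (b - a)
            collect = solve-∀ ℚ-ring

          ξ≤z : 0ℚ ≤ z - ξ
          ξ≤z = subst (λ s → 0ℚ ≤ s - ξ) drop (subst (0ℚ ≤_) (swap (density (μ i) (μ j)) ξ D′) (gap (ℚₚ.<⇒≤ low)))
            where
            swap : ∀ w x d → w - x - d ≡ w - d - x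
            swap = solve-∀ ℚ-ring

          z≥0 : 0ℚ ≤ z
          z≥0 = subst (0ℚ ≤_) (restore ξ z) (ξ≤z ⊕ ξ≥0)

          -- Writing q as q (ε + q) turns q (D″ - D′)² into z² + q ε (D″ - D′)², and z ≥ ξ ≥ 0.
          enough : energy μ + G ≤ energy μ + η * (ε * q * ((D″ - D′) * (D″ - D′)))
          enough = ℚₚ.+-monoʳ-≤ (energy μ) (close
            (η≥0 ⊗ (ε≥0 ⊗ (ξ≤z ⊗ (z≥0 ⊕ ξ≥0) ⊕ q≥0 ⊗ ε≥0 ⊗ square≥0 (D″ - D′))))
            (trans (cong (λ s → η * (ε * s * ((D″ - D′) * (D″ - D′))) - G) (trans (sym (ℚₚ.*-identityʳ q)) (cong (q *_) (sym ε+q≡1))))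
              (expand η ε q ξ D′ D″)))
            where
            expand : ∀ h ε q x a b → h * (ε * (q * (ε + q)) * ((b - a) * (b - a))) - h * (ε * (x * x)) ≡
              h * (ε * ((q * (b - a) - x) * (q * (b - a) + x) + q * ε * ((b - a) * (b - a))))
            expand = solve-∀ ℚ-ring

        -- With u = 1/n: no point carries more than 1/c times its uniform share, so a set of large
        -- measure has linear size.
        Bounded : ℚ → Family → Set
        Bounded c μ = ∀ a x → c * μ a x ≤ u

        shrink : ∀ {c μ} → 0ℚ ≤ c → Distributions μ → Bounded c μ → Bounded (c * ε) μ
        shrink {c} {μ} c≥0 μ-dist bound a x = ℚₚ.≤-trans
          (close (c≥0 ⊗ nonNeg (μ-dist a) x ⊗ gap ε≤1) (factor c ε (μ a x))) (bound a x)
          where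
          factor : ∀ c e m → c * m - c * e * m ≡ c * m * (1ℚ - e)
          factor = solve-∀ ℚ-ring

        shrink-scale : ∀ n {c μ} → 0ℚ ≤ c → Distributions μ → Bounded c μ → Bounded (scale ε n c) μ
        shrink-scale zero    c≥0 μ-dist bound = bound
        shrink-scale (suc n) c≥0 μ-dist bound =
          shrink-scale n (c≥0 ⊗ ε≥0 ⊗ ε≥0) μ-dist (shrink (c≥0 ⊗ ε≥0) μ-dist (shrink c≥0 μ-dist bound))

        update-bounded : ∀ {c μ i ν} → 0ℚ ≤ c → Distributions μ → Bounded c μ → Within ε ν (μ i) → Bounded (c * ε) (μ [ i ≔ ν ])
        update-bounded {c} {μ} {i} {ν} c≥0 μ-dist bound sub a x with a Fin.≟ i
        ... | no _     = shrink {μ = μ} c≥0 μ-dist bound a x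
        ... | yes refl = ℚₚ.≤-trans (close (c≥0 ⊗ gap (sub x)) (factor c ε (ν x) (μ i x))) (bound i x)
          where
          factor : ∀ c e n m → c * m - c * e * n ≡ c * (m - e * n)
          factor = solve-∀ ℚ-ring

        module _ (M : ℚ) (energy≤M : ∀ μ → Distributions μ → energy μ ≤ M) where

          -- Nothing decides whether the family is regular. It is passed to `finish` at once, with a
          -- regularity proof that, when confronted with an irregular pair, carries out an energy
          -- step and starts over. Energies stay below `M`, which bounds the number of steps.
          regularise : ∀ fuel {c} μ → 0ℚ ≤ c → Distributions μ → Bounded c μ → M < energy μ + times fuel β →
            (∀ μ′ → Distributions μ′ → Bounded (scale ε fuel c) μ′ → energy μ ≤ energy μ′ → Regular ε ξ μ′ → ⊥) → ⊥
          regularise zero    μ c≥0 μ-dist bound low finish =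
            ℚₚ.<-irrefl refl (ℚₚ.<-≤-trans low (subst (_≤ M) (sym (ℚₚ.+-identityʳ (energy μ))) (energy≤M μ μ-dist)))
          regularise (suc fuel) {c} μ c≥0 μ-dist bound low finish =
            finish μ μ-dist (shrink-scale (suc fuel) c≥0 μ-dist bound) ℚₚ.≤-refl regular
            where
            again : ∀ μ′ → Distributions μ′ → Bounded (c * ε * ε) μ′ → energy μ + β ≤ energy μ′ → ⊥
            again μ′ μ′-dist bound′ up = regularise fuel μ′ (c≥0 ⊗ ε≥0 ⊗ ε≥0) μ′-dist bound′
              (ℚₚ.<-≤-trans low (close (gap up) (regroup (energy μ) β (times fuel β) (energy μ′))))
              λ μ″ μ″-dist bound″ up′ → finish μ″ μ″-dist bound″ (ℚₚ.≤-trans E≤E′ up′)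
              where
              regroup : ∀ e b t f → f + t - (e + (b + t)) ≡ f - (e + b)
              regroup = solve-∀ ℚ-ring
              E≤E′ : energy μ ≤ energy μ′
              E≤E′ = ℚₚ.≤-trans (close (ε≥0 ⊗ G≥0) (cancel (energy μ) β)) up
                where cancel : ∀ e b → e + b - e ≡ b
                      cancel = solve-∀ ℚ-ring

            again¹ : ∀ {i ν} → Distribution ν → Within ε ν (μ i) → energy μ + β ≤ energy (μ [ i ≔ ν ]) → ⊥
            again¹ {i} {ν} ν-dist sub = again (μ [ i ≔ ν ]) (update-dist μ-dist ν-dist)
              (shrink (c≥0 ⊗ ε≥0) (update-dist μ-dist ν-dist) (update-bounded c≥0 μ-dist bound sub))

            regular : Regular ε ξ μ
            regular {i} {j} i≢j {μ′} {ν′} μ′-dist ν′-dist μ′-sub ν′-sub =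
              [ (λ ok → ok) , (λ low → ⊥-elim (irregular low)) ]′ (density (μ i) (μ j) - (ξ + ξ) ≤⊎> density μ′ ν′)
              where
              w = density (μ i) (μ j)

              β≤G : β ≤ G
              β≤G = close (G≥0 ⊗ gap ε≤1) (factor ε G)
                where factor : ∀ e g → g - e * g ≡ g * (1ℚ - e)
                      factor = solve-∀ ℚ-ring

              first-side : density μ′ (μ j) < w - ξ → ⊥
              first-side low′ = let ν , ν-dist , sub , up = improve μ-dist i≢j μ′-dist μ′-sub low′ in
                again¹ ν-dist sub (ℚₚ.≤-trans (ℚₚ.+-monoʳ-≤ (energy μ) β≤G) up)

              μ¹ : Family
              μ¹ = μ [ i ≔ μ′ ]

              μ¹-dist : Distributions μ¹
              μ¹-dist = update-dist μ-dist μ′-dist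

              -- The loss occurs on side j after `μ i` has been replaced by `μ′`, a move that may
              -- lower the energy E. If the complement does not already gain β, averaging gives `μ¹`
              -- energy at least E - q G. The gain `G` from side j then yields E + (1 - q) G = E +
              -- β.
              second-side : density ν′ μ′ < density (μ j) μ′ - ξ → ⊥
              second-side low′ =
                [ (λ E″ → again¹ (complement-dist (μ-dist i) μ′-dist μ′-sub) (complement-within (μ-dist i) μ′-dist μ′-sub) E″)
                , then-second ]′ (energy μ + β ≤⊎> energy (μ [ i ≔ complement (μ i) μ′ ]))
                where
                at-i : μ¹ i ≡ μ′
                at-i = update-same μ i μ′
                at-j : μ¹ j ≡ μ j
                at-j = update-other μ μ′ (λ j≡i → i≢j (sym j≡i))

                then-second : energy (μ [ i ≔ complement (μ i) μ′ ]) < energy μ + β → ⊥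
                then-second E″< =
                  let ν , ν-dist , sub , up = improve {μ¹} {j} {i} μ¹-dist (λ j≡i → i≢j (sym j≡i)) ν′-dist
                        (subst (Within ε ν′) (sym at-j) ν′-sub)
                        (subst₂ (λ a b → density ν′ a < density b a - ξ) (sym at-i) (sym at-j) low′)
                  in again (μ¹ [ j ≔ ν ]) (update-dist μ¹-dist ν-dist)
                       (update-bounded (c≥0 ⊗ ε≥0) μ¹-dist (update-bounded c≥0 μ-dist bound μ′-sub) sub)
                       (ℚₚ.≤-trans (cancel-≤ ε>0 (close
                         (gap (energy-split ε≥0 q≥0 ε+q≡1 μ i (complement-mix (μ-dist i) μ′-dist μ′-sub)) ⊕ q≥0 ⊗ gap (ℚₚ.<⇒≤ E″<))
                         (balance (energy μ) (energy μ¹) (energy (μ [ i ≔ complement (μ i) μ′ ]))))) up)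
                  where
                  expand : ∀ ε q g e f h → ε * (f + g) - ε * (e + ε * g) ≡
                    (ε * f + q * h - e) + q * (e + ε * g - h) + (1ℚ - (ε + q)) * (ε * g + e)
                  expand = solve-∀ ℚ-ring
                  vanish : ∀ a b → a + (1ℚ - 1ℚ) * b ≡ a
                  vanish = solve-∀ ℚ-ring
                  balance : ∀ e f h → ε * (f + G) - ε * (e + β) ≡ (ε * f + q * h - e) + q * (e + β - h)
                  balance e f h = trans (expand ε q G e f h)
                    (trans (cong (λ s → (ε * f + q * h - e) + q * (e + ε * G - h) + (1ℚ - s) * (ε * G + e)) ε+q≡1)
                      (vanish ((ε * f + q * h - e) + q * (e + ε * G - h)) (ε * G + e)))

              irregular : density μ′ ν′ < w - (ξ + ξ) → ⊥
              irregular low′ = [ (λ ok → second-side (subst₂ (λ a b → a < b - ξ) (density-sym μ′ ν′) (density-sym μ′ (μ j))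
                                    (ℚₚ.<-≤-trans low′ (close (gap ok) (swap w ξ (density μ′ (μ j)))))))
                               , first-side ]′ (w - ξ ≤⊎> density μ′ (μ j))
                where
                swap : ∀ w x d → d - x - (w - (x + x)) ≡ d - (w - x)
                swap = solve-∀ ℚ-ring

-- Cliques in regular families
module CliqueEmbedding where

  open Regularity
  open import Data.Bool using (Bool; true; false; not; _∧_; if_then_else_)
  open import Data.List as List using (List; []; _∷_; length)
  open import Data.Rational using (ℚ; 0ℚ; 1ℚ; ½; _≤_; _<_; _+_; _*_; _-_; -_; _≤?_; _<?_)
  open import Relation.Binary.PropositionalEquality using (_≡_; _≢_; refl; sym; trans; cong; cong₂; subst; subst₂)
  open Rationals

  module Embed {V : Set} (xs : List V) (adj : V → V → Bool) (adj-sym : ∀ x y → adj x y ≡ adj y x) where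

    open import Data.Empty using (⊥; ⊥-elim)
    open import Data.Fin using (Fin; zero; suc)
    import Data.List.Properties as Listₚ
    import Data.Vec.Properties as Vecₚ
    open import Data.List.Relation.Unary.All as All using (All; []; _∷_)
    import Data.List.Relation.Unary.All.Properties as Allₚ
    open import Data.List.Relation.Unary.AllPairs using (AllPairs; []; _∷_)
    open import Data.Nat as ℕ using (ℕ; zero; suc)
    import Data.Nat.Properties as ℕₚ
    open import Data.Product using (∃-syntax; _×_; _,_; proj₁; proj₂)
    open import Data.Sum using (_⊎_; [_,_]′)
    open import Data.Vec as Vec using (Vec; []; _∷_; lookup)
    import Data.Rational.Properties as ℚₚ
    open import Relation.Nullary using (Dec; yes; no; ¬_; does)
    open import Tactic.RingSolver using (solve-∀)
    open import Data.Bool using (T)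
    open import Data.Bool.Properties using (T-∧)
    open import Data.Unit using (⊤)
    open import Function using (Equivalence)
    open Game using (State; []; _∷_; level; headSize; cliqueSize; positive)

    open Reg xs (λ x y → bit (adj x y)) (λ x y → cong bit (adj-sym x y)) (λ x y → bit≥0 _) (λ x y → bit≤1 _) public

    -- Conditioning a measure on a set

    restrict : (V → ℚ) → (V → Bool) → V → ℚ
    restrict ν P x = bit (P x) * ν x

    mass : (V → ℚ) → (V → Bool) → ℚ
    mass ν P = ∑ xs (restrict ν P)

    restrict≥0 : ∀ {ν} → (∀ x → 0ℚ ≤ ν x) → ∀ P x → 0ℚ ≤ restrict ν P x
    restrict≥0 ν≥0 P x = bit≥0 (P x) ⊗ ν≥0 x

    within-trans : ∀ {κ τ ν′ ν μ} → 0ℚ ≤ κ → Within κ ν μ → Within τ ν′ ν → Within (κ * τ) ν′ μ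
    within-trans {κ} {τ} {ν′} {ν} {μ} κ≥0 sub sub′ x =
      ℚₚ.≤-trans (close (κ≥0 ⊗ gap (sub′ x)) (factor κ τ (ν x) (ν′ x))) (sub x)
      where
      factor : ∀ k t a b → k * a - k * t * b ≡ k * (a - t * b)
      factor = solve-∀ ℚ-ring

    within-weaken : ∀ {ε κ ν μ} → ε ≤ κ → (∀ x → 0ℚ ≤ ν x) → Within κ ν μ → Within ε ν μ
    within-weaken {ε} {κ} {ν} ε≤κ ν≥0 sub x = ℚₚ.≤-trans (close (gap ε≤κ ⊗ ν≥0 x) (factor ε κ (ν x))) (sub x)
      where
      factor : ∀ e k a → k * a - e * a ≡ (k - e) * a
      factor = solve-∀ ℚ-ring

    -- The restriction is renormalised; as the mass is at least τ, this multiplies `ν` by at most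
    -- 1/τ.
    condition : ∀ {ν P τ} → Distribution ν → 0ℚ < τ → τ ≤ mass ν P →
      ∃[ ν′ ] (Distribution ν′ × Within τ ν′ ν × (∀ x → 0ℚ < ν′ x → P x ≡ true × 0ℚ < ν x))
    condition {ν} {P} {τ} ν-dist τ>0 τ≤m with inverse (ℚₚ.<-≤-trans τ>0 τ≤m)
    ... | r , r>0 , m*r≡1 = ν′ , record { nonNeg = λ x → r≥0 ⊗ restrict≥0 (nonNeg ν-dist) P x ; total = total′ } , sub , support
      where
      r≥0 = ℚₚ.<⇒≤ r>0
      ν′ = λ x → r * restrict ν P x

      total′ : ∑ xs ν′ ≡ 1ℚ
      total′ = trans (∑-scale xs r (restrict ν P)) (trans (ℚₚ.*-comm r _) m*r≡1)

      τr≤1 : 0ℚ ≤ 1ℚ - τ * r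
      τr≤1 = subst (λ s → 0ℚ ≤ s - τ * r) m*r≡1 (subst (0ℚ ≤_) (factor (mass ν P) τ r) (gap τ≤m ⊗ r≥0))
        where
        factor : ∀ m t r → (m - t) * r ≡ m * r - t * r
        factor = solve-∀ ℚ-ring

      sub : Within τ ν′ ν
      sub x = close ((gap (bit≤1 (P x)) ⊗ nonNeg ν-dist x) ⊕ restrict≥0 (nonNeg ν-dist) P x ⊗ τr≤1)
        (split τ r (bit (P x)) (ν x))
        where
        split : ∀ t r b n → n - t * (r * (b * n)) ≡ (1ℚ - b) * n + b * n * (1ℚ - t * r)
        split = solve-∀ ℚ-ring

      support : ∀ x → 0ℚ < ν′ x → P x ≡ true × 0ℚ < ν x
      support x pos with P x | ν x ≤? 0ℚ
      ... | true  | no ν≰0  = refl , ℚₚ.≰⇒> ν≰0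
      ... | true  | yes ν≤0 = ⊥-elim (absurd pos (close (r≥0 ⊗ gap ν≤0) (flip r (ν x))))
        where
        flip : ∀ r n → 0ℚ - r * (1ℚ * n) ≡ r * (0ℚ - n)
        flip = solve-∀ ℚ-ring
      ... | false | _       = ⊥-elim (absurd pos (ℚₚ.≤-reflexive (vanish r (ν x))))
        where
        vanish : ∀ r n → r * (0ℚ * n) ≡ 0ℚ
        vanish = solve-∀ ℚ-ring

    below : ℚ → (V → ℚ) → V → Bool
    below v f x = does (f x <? v)

    does-true : ∀ {P : Set} (d : Dec P) → does d ≡ true → P
    does-true (yes p) _ = p

    does-false : ∀ {P : Set} (d : Dec P) → does d ≡ false → ¬ P
    does-false (no ¬p) _ = ¬p

    below-false : ∀ v f x → below v f x ≡ false → v ≤ f x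
    below-false v f x e = ℚₚ.≮⇒≥ (does-false (f x <? v) e)

    below-true : ∀ v f x → below v f x ≡ true → f x ≤ v
    below-true v f x e = ℚₚ.<⇒≤ (does-true (f x <? v) e)

    count : List Bool → ℕ
    count []          = 0
    count (true ∷ S)  = suc (count S)
    count (false ∷ S) = count S

    pow2 : ℕ → ℚ
    pow2 zero    = 1ℚ
    pow2 (suc n) = pow2 n + pow2 n

    pow2≥0 : ∀ n → 0ℚ ≤ pow2 n
    pow2≥0 zero    = 0≤1
    pow2≥0 (suc n) = pow2≥0 n ⊕ pow2≥0 n

    4ℚ : ℚ
    4ℚ = ofℕ 4

    private
      everything : V → Bool
      everything _ = true

      mass-all : ∀ ν → mass ν everything ≡ ∑ xs ν
      mass-all ν = ∑-cong xs λ x → ℚₚ.*-identityˡ (ν x)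

      split-mass : ∀ ν P → ∑ xs (restrict ν P) + ∑ xs (restrict ν (λ x → not (P x))) ≡ ∑ xs ν
      split-mass ν P = trans (sym (∑-+ xs _ _)) (∑-cong xs λ x → pieces (P x) (ν x))
        where
        pieces : ∀ b n → bit b * n + bit (not b) * n ≡ n
        pieces true  n = trans (cong₂ _+_ (ℚₚ.*-identityˡ n) (ℚₚ.*-zeroˡ n)) (ℚₚ.+-identityʳ n)
        pieces false n = trans (cong₂ _+_ (ℚₚ.*-zeroˡ n) (ℚₚ.*-identityˡ n)) (ℚₚ.+-identityˡ n)

      split-degree : ∀ ν P q → degree (restrict ν P) q + degree (restrict ν (λ x → not (P x))) q ≡ degree ν q
      split-degree ν P q = trans (sym (∑-+ xs _ _)) (∑-cong xs λ x →
          trans (sym (ℚₚ.*-distribʳ-+ (bit (adj q x)) (restrict ν P x) (restrict ν (λ x → not (P x)) x)))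
            (cong (_* bit (adj q x)) (pieces (P x) (ν x))))
        where
        pieces : ∀ b n → bit b * n + bit (not b) * n ≡ n
        pieces true  n = trans (cong₂ _+_ (ℚₚ.*-identityˡ n) (ℚₚ.*-zeroˡ n)) (ℚₚ.+-identityʳ n)
        pieces false n = trans (cong₂ _+_ (ℚₚ.*-zeroˡ n) (ℚₚ.*-identityˡ n)) (ℚₚ.+-identityˡ n)

    -- Splitting the measure at one vertex of qs after the other: if the average number of neighbours in qs exceeds t,
    -- this persists on one of the two sides (with t lowered by one on the side of the neighbours).
    popularType : ∀ {τ₀} → 0ℚ < τ₀ → ∀ qs {ν} t → (∀ x → 0ℚ ≤ ν x) → ofℕ (length qs) ≤ 4ℚ + t →
      t * ∑ xs ν + pow2 (length qs) * τ₀ ≤ ∑ qs (degree ν) →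
      ∃[ S ] ∃[ P ] (length S ≡ length qs × t < ofℕ (count S) × (∀ y → P y ≡ true → List.map (adj y) qs ≡ S) × τ₀ ≤ 4ℚ * mass ν P)
    -- With no vertex left, `le` forces t < 0, and t ≥ -4 then bounds the remaining mass below by
    -- τ₀/4.
    popularType {τ₀} τ₀>0 [] {ν} t ν≥0 len le = [] , everything , refl , t<0 , (λ _ _ → refl) ,
        subst (λ m → τ₀ ≤ 4ℚ * m) (sym (mass-all ν)) (close (gap le ⊕ (gap len ⊗ ∑-nonNeg xs ν≥0)) (collect t τ₀ (∑ xs ν) 4ℚ))
      where
      collect : ∀ t τ m d → d * m - τ ≡ 0ℚ - (t * m + 1ℚ * τ) + (d + t - 0ℚ) * m
      collect = solve-∀ ℚ-ring
      t<0 : t < 0ℚ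
      t<0 = [ (λ 0≤t → ⊥-elim (absurd (0≤t ⊗ ∑-nonNeg xs ν≥0 ⊕< 0<1 ⊗< τ₀>0) le)) , (λ lt → lt) ]′ (0ℚ ≤⊎> t)
    popularType {τ₀} τ₀>0 (q ∷ qs) {ν} t ν≥0 len le =
      -- Half of the budget 2^(length) τ₀ goes to each side: if the neighbours miss their share,
      -- `balance` leaves enough for the non-neighbours.
      [ adjacent , nonadjacent ]′ ((t - 1ℚ) * m₁ + e ≤⊎> Σ₁)
      where
      ν₁ = restrict ν (adj q)
      ν₀ = restrict ν (λ x → not (adj q x))
      m₁ = ∑ xs ν₁
      m₀ = ∑ xs ν₀
      Σ₁ = ∑ qs (degree ν₁)
      Σ₀ = ∑ qs (degree ν₀)
      e = pow2 (length qs) * τ₀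

      Σ-split : Σ₁ + Σ₀ ≡ ∑ qs (degree ν)
      Σ-split = trans (sym (∑-+ qs _ _)) (∑-cong qs (split-degree ν (adj q)))

      degree-mass : degree ν q ≡ m₁
      degree-mass = ∑-cong xs λ x → ℚₚ.*-comm (ν x) (bit (adj q x))

      balance : t * (m₁ + m₀) + (pow2 (length qs) + pow2 (length qs)) * τ₀ ≤ m₁ + (Σ₁ + Σ₀)
      balance = subst₂ (λ m s → t * m + (pow2 (length qs) + pow2 (length qs)) * τ₀ ≤ s) (sym (split-mass ν (adj q)))
        (cong₂ _+_ degree-mass (sym Σ-split)) le

      Result = ∃[ S ] ∃[ P ] (length S ≡ suc (length qs) × t < ofℕ (count S) ×
        (∀ y → P y ≡ true → List.map (adj y) (q ∷ qs) ≡ S) × τ₀ ≤ 4ℚ * mass ν P)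

      ∧-true : ∀ {a b} → a ∧ b ≡ true → a ≡ true × b ≡ true
      ∧-true {true} {true} _ = refl , refl

      restrict-∧ : ∀ P Q → mass (restrict ν P) Q ≡ mass ν (λ x → P x ∧ Q x)
      restrict-∧ P Q = ∑-cong xs λ x → pieces (P x) (Q x) (ν x)
        where
        pieces : ∀ a b n → bit b * (bit a * n) ≡ bit (a ∧ b) * n
        pieces true  b n = cong (bit b *_) (ℚₚ.*-identityˡ n)
        pieces false b n = trans (cong (bit b *_) (ℚₚ.*-zeroˡ n)) (trans (ℚₚ.*-zeroʳ (bit b)) (sym (ℚₚ.*-zeroˡ n)))

      adjacent : (t - 1ℚ) * m₁ + e ≤ Σ₁ → Result
      adjacent le₁ =
        let S , P , len-S , t<S , type , big = popularType τ₀>0 qs (t - 1ℚ) (restrict≥0 ν≥0 (adj q))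
              (close (gap len) (shift (ofℕ (length qs)) 4ℚ t)) le₁
        in true ∷ S , (λ y → adj q y ∧ P y) , cong suc len-S , close< (gap< t<S) (shift′ (ofℕ (count S)) t)
         , (λ y p → let a , b = ∧-true p in cong₂ _∷_ (trans (adj-sym y q) a) (type y b))
         , subst (λ m → τ₀ ≤ 4ℚ * m) (restrict-∧ (adj q) P) big
        where
        shift : ∀ l d t → d + (t - 1ℚ) - l ≡ d + t - (1ℚ + l)
        shift = solve-∀ ℚ-ring
        shift′ : ∀ c t → 1ℚ + c - t ≡ c - (t - 1ℚ)
        shift′ = solve-∀ ℚ-ring

      nonadjacent : Σ₁ < (t - 1ℚ) * m₁ + e → Result
      nonadjacent lt₁ =
        let S , P , len-S , t<S , type , big = popularType τ₀>0 qs t (restrict≥0 ν≥0 (λ x → not (adj q x)))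
              (close (gap len ⊕ 0≤1) (shift (ofℕ (length qs)) 4ℚ t))
              (close (gap balance ⊕ gap (ℚₚ.<⇒≤ lt₁)) (collect t m₁ m₀ (pow2 (length qs)) τ₀ Σ₁ Σ₀))
        in false ∷ S , (λ y → not (adj q y) ∧ P y) , cong suc len-S , t<S
         , (λ y p → let a , b = ∧-true p in cong₂ _∷_ (trans (adj-sym y q) (not-true a)) (type y b))
         , subst (λ m → τ₀ ≤ 4ℚ * m) (restrict-∧ (λ x → not (adj q x)) P) big
        where
        shift : ∀ l d t → d + t - l ≡ d + t - (1ℚ + l) + 1ℚ
        shift = solve-∀ ℚ-ring
        collect : ∀ t a b p τ s r → r - (t * b + p * τ) ≡ a + (s + r) - (t * (a + b) + (p + p) * τ) + ((t - 1ℚ) * a + p * τ - s)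
        collect = solve-∀ ℚ-ring
        not-true : ∀ {b} → not b ≡ true → b ≡ false
        not-true {false} _ = refl

    -- Selecting vertices of a clique

    AllAdjacent : List V → Set
    AllAdjacent = AllPairs (λ x y → adj x y ≡ true)

    AdjacentTo : List V → V → Set
    AdjacentTo C x = All (λ y → adj x y ≡ true) C

    select : List Bool → List V → List V
    select []          qs       = []
    select (b ∷ S)     []       = []
    select (true ∷ S)  (q ∷ qs) = q ∷ select S qs
    select (false ∷ S) (q ∷ qs) = select S qs

    length-select : ∀ S qs → length S ≡ length qs → length (select S qs) ≡ count S
    length-select []          []       e = refl
    length-select (true ∷ S)  (q ∷ qs) e = cong suc (length-select S qs (ℕₚ.suc-injective e))
    length-select (false ∷ S) (q ∷ qs) e = length-select S qs (ℕₚ.suc-injective e)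

    All-select : ∀ {P : V → Set} S {qs} → All P qs → All P (select S qs)
    All-select []          ps       = []
    All-select (b ∷ S)     []       = []
    All-select (true ∷ S)  (p ∷ ps) = p ∷ All-select S ps
    All-select (false ∷ S) (p ∷ ps) = All-select S ps

    clique-extend : ∀ S {qs C} → AllAdjacent qs → All (AdjacentTo C) qs → AllAdjacent C → AllAdjacent (select S qs List.++ C)
    clique-extend []          cl       ads       C-cl = C-cl
    clique-extend (b ∷ S)     []       ads       C-cl = C-cl
    clique-extend (true ∷ S)  (a ∷ cl) (ad ∷ ads) C-cl = Allₚ.++⁺ (All-select S a) ad ∷ clique-extend S cl ads C-cl
    clique-extend (false ∷ S) (a ∷ cl) (ad ∷ ads) C-cl = clique-extend S cl ads C-cl

    meet : ∀ n → ℕ → (Fin n → List Bool) → List Bool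
    meet zero    m S = List.replicate m true
    meet (suc n) m S = List.zipWith _∧_ (S zero) (meet n m λ j → S (suc j))

    length-∧ : ∀ {m} S T → length S ≡ m → length T ≡ m → length (List.zipWith _∧_ S T) ≡ m
    length-∧ []      T       p q = p
    length-∧ {suc m} (a ∷ S) (b ∷ T) p q = cong suc (length-∧ S T (ℕₚ.suc-injective p) (ℕₚ.suc-injective q))

    length-meet : ∀ n m (S : Fin n → List Bool) → (∀ j → length (S j) ≡ m) → length (meet n m S) ≡ m
    length-meet zero    zero    S len = refl
    length-meet zero    (suc m) S len = cong suc (length-meet zero m (λ ()) (λ ()))
    length-meet (suc n) m       S len = length-∧ (S zero) _ (len zero) (length-meet n m _ (λ j → len (suc j)))

    count-∧ : ∀ {m} S T → length S ≡ m → length T ≡ m → count S ℕ.+ count T ℕ.≤ count (List.zipWith _∧_ S T) ℕ.+ m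
    count-∧ []      []      p q = ℕ.z≤n
    count-∧ []      (b ∷ T) refl ()
    count-∧ {suc m} (a ∷ S) (b ∷ T) p q = cases a b (count-∧ S T (ℕₚ.suc-injective p) (ℕₚ.suc-injective q))
      where
      c = count (List.zipWith _∧_ S T)
      cases : ∀ a b → count S ℕ.+ count T ℕ.≤ c ℕ.+ m →
        count (a ∷ S) ℕ.+ count (b ∷ T) ℕ.≤ count (List.zipWith _∧_ (a ∷ S) (b ∷ T)) ℕ.+ suc m
      cases true  true  le = ℕ.s≤s (subst₂ ℕ._≤_ (sym (ℕₚ.+-suc (count S) (count T))) (sym (ℕₚ.+-suc c m)) (ℕ.s≤s le))
      cases true  false le = subst (suc (count S ℕ.+ count T) ℕ.≤_) (sym (ℕₚ.+-suc c m)) (ℕ.s≤s le)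
      cases false true  le = subst₂ ℕ._≤_ (sym (ℕₚ.+-suc (count S) (count T))) (sym (ℕₚ.+-suc c m)) (ℕ.s≤s le)
      cases false false le = ℕₚ.≤-trans le (ℕₚ.+-monoʳ-≤ c (ℕₚ.n≤1+n m))

    count-replicate : ∀ m → count (List.replicate m true) ≡ m
    count-replicate zero    = refl
    count-replicate (suc m) = cong suc (count-replicate m)

    -- Each selection omits at most m - l of the m vertices, so their intersection omits at most the
    -- sum of these numbers.
    count-meet : ∀ n m (S : Fin n → List Bool) (l : Vec ℕ n) → (∀ j → length (S j) ≡ m) → (∀ j → lookup l j ℕ.≤ count (S j)) →
      m ℕ.∸ Vec.sum (Vec.map (m ℕ.∸_) l) ℕ.≤ count (meet n m S)
    count-meet zero    m S []      len le = ℕₚ.≤-reflexive (sym (count-replicate m))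
    count-meet (suc n) m S (a ∷ l) len le = begin
      m ℕ.∸ ((m ℕ.∸ a) ℕ.+ rest)      ≡⟨ cong (m ℕ.∸_) (ℕₚ.+-comm (m ℕ.∸ a) rest) ⟩
      m ℕ.∸ (rest ℕ.+ (m ℕ.∸ a))      ≡⟨ sym (ℕₚ.∸-+-assoc m rest (m ℕ.∸ a)) ⟩
      (m ℕ.∸ rest) ℕ.∸ (m ℕ.∸ a)      ≤⟨ ℕₚ.∸-monoˡ-≤ (m ℕ.∸ a) (count-meet n m _ l (λ j → len (suc j)) (λ j → le (suc j))) ⟩
      c ℕ.∸ (m ℕ.∸ a)               ≤⟨ ℕₚ.m≤n+o⇒m∸n≤o c (m ℕ.∸ a) (ℕₚ.+-cancelʳ-≤ (count (S zero)) c _ bound) ⟩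
      count (meet (suc n) m S)  ∎
      where
      open ℕₚ.≤-Reasoning
      rest = Vec.sum (Vec.map (m ℕ.∸_) l)
      c = count (meet n m λ j → S (suc j))
      m≤ : m ℕ.≤ (m ℕ.∸ a) ℕ.+ count (S zero)
      m≤ = ℕₚ.≤-trans (ℕₚ.m≤n+m∸n m a)
        (subst (a ℕ.+ (m ℕ.∸ a) ℕ.≤_) (ℕₚ.+-comm (count (S zero)) (m ℕ.∸ a)) (ℕₚ.+-monoˡ-≤ (m ℕ.∸ a) (le zero)))
      bound : c ℕ.+ count (S zero) ℕ.≤ (m ℕ.∸ a) ℕ.+ count (meet (suc n) m S) ℕ.+ count (S zero)
      bound = begin
        c ℕ.+ count (S zero)                                  ≡⟨ ℕₚ.+-comm c _ ⟩
        count (S zero) ℕ.+ c                                  ≤⟨ count-∧ (S zero) _ (len zero) (length-meet n m _ (λ j → len (suc j))) ⟩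
        count (meet (suc n) m S) ℕ.+ m                        ≤⟨ ℕₚ.+-monoʳ-≤ (count (meet (suc n) m S)) m≤ ⟩
        count (meet (suc n) m S) ℕ.+ ((m ℕ.∸ a) ℕ.+ count (S zero)) ≡⟨ sym (ℕₚ.+-assoc (count (meet (suc n) m S)) (m ℕ.∸ a) _) ⟩
        count (meet (suc n) m S) ℕ.+ (m ℕ.∸ a) ℕ.+ count (S zero) ≡⟨ cong (ℕ._+ count (S zero)) (ℕₚ.+-comm (count (meet (suc n) m S)) (m ℕ.∸ a)) ⟩
        (m ℕ.∸ a) ℕ.+ count (meet (suc n) m S) ℕ.+ count (S zero) ∎

    adjacent-select : ∀ S T R y {qs} → List.map (adj y) qs ≡ S → T ≡ List.zipWith _∧_ S R → AdjacentTo (select T qs) y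
    adjacent-select S T R y {[]} refl refl = []
    adjacent-select S T [] y {q ∷ qs} refl refl = []
    adjacent-select S T (r ∷ R) y {q ∷ qs} refl refl = cases (adj y q) r refl
      where
      rest = adjacent-select _ _ R y {qs} refl refl
      cases : ∀ a r → adj y q ≡ a → AdjacentTo (select (a ∧ r ∷ List.zipWith _∧_ (List.map (adj y) qs) R) (q ∷ qs)) y
      cases true  true  e = e ∷ rest
      cases true  false e = rest
      cases false r     e = rest

    below-∧ : ∀ S R {y qs} → AdjacentTo (select R qs) y → AdjacentTo (select (List.zipWith _∧_ S R) qs) y
    below-∧ []          R           ads = []
    below-∧ (s ∷ S)     []          ads = []
    below-∧ (s ∷ S)     (r ∷ R)     {qs = []} ads = []
    below-∧ (true ∷ S)  (true ∷ R)  {qs = q ∷ qs} (a ∷ ads) = a ∷ below-∧ S R ads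
    below-∧ (false ∷ S) (true ∷ R)  {qs = q ∷ qs} (a ∷ ads) = below-∧ S R ads
    below-∧ (true ∷ S)  (false ∷ R) {qs = q ∷ qs} ads = below-∧ S R ads
    below-∧ (false ∷ S) (false ∷ R) {qs = q ∷ qs} ads = below-∧ S R ads

    adjacent-meet : ∀ n m (S : Fin n → List Bool) j y {qs} → List.map (adj y) qs ≡ S j → AdjacentTo (select (meet n m S) qs) y
    adjacent-meet (suc n) m S zero    y e = adjacent-select (S zero) _ (meet n m λ j → S (suc j)) y e refl
    adjacent-meet (suc n) m S (suc j) y e = below-∧ (S zero) _ (adjacent-meet n m (λ j → S (suc j)) j y e)

    sum-≥ : ∀ {v} (f : V → ℚ) {qs} → All (λ q → v ≤ f q) qs → ofℕ (length qs) * v ≤ ∑ qs f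
    sum-≥ {v} f []       = ℚₚ.≤-reflexive (ℚₚ.*-zeroˡ v)
    sum-≥ {v} f {q ∷ qs} (p ∷ ps) = ℚₚ.≤-trans (ℚₚ.≤-reflexive (distribute v (ofℕ (length qs)))) (ℚₚ.+-mono-≤ p (sum-≥ f ps))
      where
      distribute : ∀ v n → (1ℚ + n) * v ≡ v + n * v
      distribute = solve-∀ ℚ-ring

    positive-row : ∀ {n} (r : Vec ℕ n) → T (Vec.foldr′ (λ l b → (1 ℕ.≤ᵇ l) ∧ b) true r) → ∀ j → 1 ℕ.≤ lookup r j
    positive-row (l ∷ r) t zero    = ℕₚ.≤ᵇ⇒≤ 1 l (proj₁ (Equivalence.to T-∧ t))
    positive-row (l ∷ r) t (suc j) = positive-row r (proj₂ (Equivalence.to (T-∧ {1 ℕ.≤ᵇ l}) t)) j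

    -- What has to be kept for a cluster not yet processed: a piece of its measure that lives on
    -- common neighbours of the clique built so far.
    record Live {k} (μ : Fin k → V → ℚ) (κ : ℚ) (C : List V) (i : Fin k) : Set where
      field
        measure : V → ℚ
        dist    : Distribution measure
        within  : Within κ measure (μ i)
        support : ∀ x → 0ℚ < measure x → AdjacentTo C x
    open Live

    -- Building a clique cluster by cluster

    module Embedding {k : ℕ} (μ : Fin k → V → ℚ) (L : Fin k → Fin k → ℕ) (L-irrefl : ∀ a → L a a ≡ 0)
      {ε ξ u c θ τ τ₀ b : ℚ} (c≥0 : 0ℚ ≤ c) (ξ>0 : 0ℚ < ξ) (θ>0 : 0ℚ < θ) (12θ≤½ : ofℕ 12 * θ ≤ ½)
      (τ>0 : 0ℚ < τ) (τ₀>0 : 0ℚ < τ₀) (4τ≤τ₀ : 4ℚ * τ ≤ τ₀)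
      (bounded : ∀ a x → c * μ a x ≤ u)
      (regular : Regular ε ξ μ)
      (level-density : ∀ {i j} l → i ≢ j → suc l ℕ.≤ L i j → ofℕ l + pow2 4 * τ₀ ≤ 4ℚ * (density (μ i) (μ j) - (ξ + ξ + ξ)))
      (K₄ : ∀ (P : V → Bool) → b ≤ u * ∑ xs (λ x → bit (P x)) →
        (∀ qs → length qs ≡ 4 → AllAdjacent qs → All (λ q → P q ≡ true) qs → ⊥) → ⊥)
      where

      -- The measures have been conditioned down to a share κ of the original ones, and n more clusters are to be processed.
      Enough : ℕ → ℚ → Set
      Enough zero    κ = ⊤
      Enough (suc n) κ = 0ℚ ≤ κ × ε ≤ κ × ε ≤ κ * θ × b ≤ κ * c * ½ × Enough n (κ * τ)

      -- Regularity keeps densities above w - 2ξ; the third ξ makes the contradiction in `bad-mass`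
      -- strict.
      threshold : Fin k → Fin k → ℚ
      threshold i j = density (μ i) (μ j) - (ξ + ξ + ξ)

      distinct : ∀ {i j} → 1 ℕ.≤ L i j → i ≢ j
      distinct {i} 1≤ refl = ℕₚ.<⇒≢ 1≤ (sym (L-irrefl i))

      -- If the vertices of low degree had mass above θ, conditioning on them would give a piece of
      -- weight κ θ ≥ ε with density at most w - 3ξ, against regularity.
      bad-mass : ∀ {κ C i j} → 0ℚ ≤ κ → ε ≤ κ → ε ≤ κ * θ → i ≢ j → (ν : Live μ κ C i) (ρ : Live μ κ C j) →
        mass (measure ν) (below (threshold i j) (degree (measure ρ))) ≤ θ
      bad-mass {κ} {i = i} {j} κ≥0 ε≤κ ε≤κθ i≢j ν ρ = [ (λ ok → ok) , (λ big → ⊥-elim (impossible big)) ]′ (mass _ bad ≤⊎> θ)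
        where
        bad = below (threshold i j) (degree (measure ρ))
        impossible : θ < mass (measure ν) bad → ⊥
        impossible big =
          let ν′ , ν′-dist , sub , supp = condition {P = bad} (dist ν) θ>0 (ℚₚ.<⇒≤ big)
              low : density ν′ (measure ρ) ≤ threshold i j
              low = average-≤ ν′-dist (degree (measure ρ)) (threshold i j) (pointwise ν′-dist supp)
              high = regular i≢j ν′-dist (dist ρ)
                (within-weaken ε≤κθ (nonNeg ν′-dist) (within-trans {μ = μ i} κ≥0 (within ν) sub))
                (within-weaken {μ = μ j} ε≤κ (nonNeg (dist ρ)) (within ρ))
          in absurd ξ>0 (close (gap high ⊕ gap low) (collect (density (μ i) (μ j)) ξ (density ν′ (measure ρ))))
          where
          collect : ∀ w x d → 0ℚ - x ≡ d - (w - (x + x)) + (w - (x + x + x) - d)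
          collect = solve-∀ ℚ-ring
          pointwise : ∀ {ν′} → Distribution ν′ → (∀ x → 0ℚ < ν′ x → bad x ≡ true × 0ℚ < measure ν x) →
            ∀ x → ν′ x * degree (measure ρ) x ≤ ν′ x * threshold i j
          pointwise {ν′} ν′-dist supp x = [ outside , inside ]′ (ν′ x ≤⊎> 0ℚ)
            where
            factor : ∀ a b c → a * c - a * b ≡ a * (c - b)
            factor = solve-∀ ℚ-ring
            inside : 0ℚ < ν′ x → ν′ x * degree (measure ρ) x ≤ ν′ x * threshold i j
            inside pos = close (ℚₚ.<⇒≤ pos ⊗ gap (below-true (threshold i j) (degree (measure ρ)) x (proj₁ (supp x pos))))
              (factor (ν′ x) (degree (measure ρ) x) (threshold i j))
            outside : ν′ x ≤ 0ℚ → ν′ x * degree (measure ρ) x ≤ ν′ x * threshold i j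
            outside ≤0 = ℚₚ.≤-reflexive (subst (λ z → z * degree (measure ρ) x ≡ z * threshold i j)
              (ℚₚ.≤-antisym (nonNeg ν′-dist x) ≤0) (trans (ℚₚ.*-zeroˡ (degree (measure ρ) x)) (sym (ℚₚ.*-zeroˡ (threshold i j)))))

      remove : ∀ {ν} → (∀ x → 0ℚ ≤ ν x) → ∀ n (bad : Fin n → V → Bool) → (∀ j → mass ν (bad j) ≤ θ) → ∀ P →
        ∃[ Q ] ((∀ x → Q x ≡ true → P x ≡ true × (∀ j → bad j x ≡ false)) × mass ν P ≤ mass ν Q + ofℕ n * θ)
      remove {ν} ν≥0 zero    bad small P = P , (λ x p → p , λ ()) , ℚₚ.≤-reflexive (pad (mass ν P) θ)
        where
        pad : ∀ m t → m ≡ m + 0ℚ * t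
        pad = solve-∀ ℚ-ring
      remove {ν} ν≥0 (suc n) bad small P =
        let Q , ok , big = remove ν≥0 n (λ j → bad (suc j)) (λ j → small (suc j)) (λ x → P x ∧ not (bad zero x))
        in Q , (λ x q → let p , rest = ok x q in both x p rest)
         , close (gap big ⊕ gap (small zero) ⊕ gap cover) (collect (mass ν Q) (ofℕ n) θ (mass ν (bad zero)) (mass ν P) _)
        where
        both : ∀ x → P x ∧ not (bad zero x) ≡ true → (∀ j → bad (suc j) x ≡ false) → P x ≡ true × (∀ j → bad j x ≡ false)
        both x p rest with P x | bad zero x in eq
        ... | true | false = refl , λ { zero → eq ; (suc j) → rest j }
        collect : ∀ q n t b p p′ → q + (1ℚ + n) * t - p ≡ q + n * t - p′ + (t - b) + (p′ + b - p)
        collect = solve-∀ ℚ-ring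
        cover : mass ν P ≤ mass ν (λ x → P x ∧ not (bad zero x)) + mass ν (bad zero)
        cover = ℚₚ.≤-trans (∑-mono xs λ x → pieces (P x) (bad zero x) (ν≥0 x)) (ℚₚ.≤-reflexive (∑-+ xs _ _))
          where
          pieces : ∀ p b {n} → 0ℚ ≤ n → bit p * n ≤ bit (p ∧ not b) * n + bit b * n
          pieces p     true  {n} n≥0 = close (gap (bit≤1 p) ⊗ n≥0 ⊕ bit≥0 (p ∧ false) ⊗ n≥0) (eq (bit p) (bit (p ∧ false)) n)
            where eq : ∀ p z n → z * n + 1ℚ * n - p * n ≡ (1ℚ - p) * n + z * n
                  eq = solve-∀ ℚ-ring
          pieces true  false {n} n≥0 = ℚₚ.≤-reflexive (eq n)
            where eq : ∀ n → 1ℚ * n ≡ 1ℚ * n + 0ℚ * n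
                  eq = solve-∀ ℚ-ring
          pieces false false {n} n≥0 = ℚₚ.≤-reflexive (eq n)
            where eq : ∀ n → 0ℚ * n ≡ 0ℚ * n + 0ℚ * n
                  eq = solve-∀ ℚ-ring

      module _ {n κ C} (vs : Vec (Fin k) n) (κ≥0 : 0ℚ ≤ κ) (live : ∀ j → Live μ κ C (lookup vs j)) where

        -- In each remaining cluster, a set of positive measure sees one and the same subset of the
        -- m vertices. The vertices common to all these subsets can join the clique, and
        -- conditioning on those sets keeps every remaining cluster live.
        narrow : ∀ m qs → length qs ≡ m → m ℕ.≤ 4 → (l : Vec ℕ n) → (∀ j → 1 ℕ.≤ lookup l j) →
          (∀ j → ofℕ (lookup l j) - 1ℚ + pow2 m * τ₀ ≤ ∑ qs (degree (measure (live j)))) →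
          ∃[ S ] (length S ≡ m × m ℕ.∸ Vec.sum (Vec.map (m ℕ.∸_) l) ℕ.≤ count S ×
            (∀ j → Live μ (κ * τ) (select S qs List.++ C) (lookup vs j)))
        narrow m qs refl m≤4 l l≥1 heavy =
          meet n m S , length-meet n m S len-S , count-meet n m S l len-S big-S , shrunk
          where
          popular : ∀ j → _
          popular j = popularType τ₀>0 qs (ofℕ (lookup l j) - 1ℚ) (nonNeg (dist (live j)))
            (close (gap (ofℕ-mono m≤4) ⊕ gap (ofℕ-mono (l≥1 j))) (shift (ofℕ m) 4ℚ (ofℕ (lookup l j))))
            (subst (λ t → (ofℕ (lookup l j) - 1ℚ) * t + pow2 m * τ₀ ≤ ∑ qs (degree (measure (live j)))) (sym (total (dist (live j))))
              (subst (λ t → t + pow2 m * τ₀ ≤ ∑ qs (degree (measure (live j)))) (sym (ℚₚ.*-identityʳ (ofℕ (lookup l j) - 1ℚ)))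
                (heavy j)))
            where
            shift : ∀ m d l → d + (l - 1ℚ) - m ≡ d - m + (l - ofℕ 1)
            shift = solve-∀ ℚ-ring

          S : Fin n → List Bool
          S j = proj₁ (popular j)

          len-S : ∀ j → length (S j) ≡ m
          len-S j = proj₁ (proj₂ (proj₂ (popular j)))

          big-S : ∀ j → lookup l j ℕ.≤ count (S j)
          big-S j = ℕ.s≤s⁻¹ (ofℕ-reflects-< {n = suc (count (S j))} (close< (gap< (proj₁ (proj₂ (proj₂ (proj₂ (popular j))))))
            (shift (ofℕ (count (S j))) (ofℕ (lookup l j)))))
            where
            shift : ∀ c l → 1ℚ + c - l ≡ c - (l - 1ℚ)
            shift = solve-∀ ℚ-ring

          shrunk : ∀ j → Live μ (κ * τ) (select (meet n m S) qs List.++ C) (lookup vs j)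
          shrunk j =
            let S′ , P , len , lt , type , heavy-P = popular j
                ν′ , ν′-dist , sub , supp = condition {P = P} (dist (live j)) τ>0 (cancel-≤ {4ℚ} (ofℕ>0 3) (ℚₚ.≤-trans 4τ≤τ₀ heavy-P))
            in record
              { measure = ν′ ; dist = ν′-dist ; within = within-trans {μ = μ (lookup vs j)} κ≥0 (within (live j)) sub
              ; support = λ x pos → let p , pos′ = supp x pos in
                  Allₚ.++⁺ (adjacent-meet n m S j x (type x p)) (support (live j) x pos′) }

      -- Rows point to older clusters, so the newest is processed first: a K₄ is found among its
      -- good vertices, and all older clusters are narrowed to what is kept of it. Each such round
      -- costs them a factor τ.
      embedClique : ∀ {n} (s : State n) (vs : Vec (Fin k) n) →
        (∀ i j → level s i j ℕ.≤ L (lookup vs i) (lookup vs j)) → T (positive s) → n ℕ.≤ 12 →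
        ∀ {κ C} → Enough n κ → AllAdjacent C → (∀ j → Live μ κ C (lookup vs j)) →
        (∀ C′ → AllAdjacent C′ → cliqueSize s ℕ.+ length C ℕ.≤ length C′ → ⊥) → ⊥
      embedClique []      []       rel pos few enough C-cl live found = found _ C-cl ℕₚ.≤-refl
      embedClique {suc n} (r ∷ s) (v ∷ vs) rel pos few {κ} {C} (κ≥0 , ε≤κ , ε≤κθ , b≤ , enough) C-cl live found =
        K₄ P heavy-P extend
        where
        ν : Live μ κ C v
        ν = live zero

        r≥1 : ∀ j → 1 ℕ.≤ lookup r j
        r≥1 = positive-row r (proj₁ (Equivalence.to T-∧ pos))

        rel-row : ∀ j → lookup r j ℕ.≤ L v (lookup vs j)
        rel-row j = rel zero (suc j)

        v≢ : ∀ j → v ≢ lookup vs j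
        v≢ j = distinct (ℕₚ.≤-trans (r≥1 j) (rel-row j))

        -- Membership in the support of the conditioned measure is what makes a vertex adjacent to
        -- all of `C`.
        charged : V → Bool
        charged x = does (0ℚ <? measure ν x)

        bad : Fin n → V → Bool
        bad j = below (threshold v (lookup vs j)) (degree (measure (live (suc j))))

        removed = remove (nonNeg (dist ν)) n bad (λ j → bad-mass κ≥0 ε≤κ ε≤κθ (v≢ j) ν (live (suc j))) charged
        P = proj₁ removed

        charged-mass : mass (measure ν) charged ≡ 1ℚ
        charged-mass = trans (∑-cong xs λ x → pieces x (0ℚ <? measure ν x)) (total (dist ν))
          where
          pieces : ∀ x (d : Dec (0ℚ < measure ν x)) → bit (does d) * measure ν x ≡ measure ν x
          pieces x (yes _) = ℚₚ.*-identityˡ (measure ν x)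
          pieces x (no ≯)  = trans (ℚₚ.*-zeroˡ (measure ν x)) (ℚₚ.≤-antisym (nonNeg (dist ν) x) (ℚₚ.≮⇒≥ ≯))

        -- Fewer than twelve bad sets of mass θ are removed, and 12 θ ≤ ½.
        half : ½ ≤ mass (measure ν) P
        half = close (gap (subst (_≤ mass (measure ν) P + ofℕ n * θ) charged-mass (proj₂ (proj₂ removed)))
            ⊕ gap 12θ≤½ ⊕ gap (ofℕ-mono (ℕₚ.≤-trans (ℕₚ.n≤1+n n) few)) ⊗ ℚₚ.<⇒≤ θ>0)
          (collect (mass (measure ν) P) (ofℕ n) θ (ofℕ 12) ½ 1ℚ refl)
          where
          collect : ∀ m n t d h o → h + h ≡ o → m - h ≡ m + n * t - o + (h - d * t) + (d - n) * t
          collect m n t d h o refl = expand m n t d h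
            where
            expand : ∀ m n t d h → m - h ≡ m + n * t - (h + h) + (h - d * t) + (d - n) * t
            expand = solve-∀ ℚ-ring

        -- The chain κ c ν ≤ c μ ≤ u, valid at each point, turns measure into a number of vertices.
        heavy-P : b ≤ u * ∑ xs (λ x → bit (P x))
        heavy-P = ℚₚ.≤-trans b≤ (ℚₚ.≤-trans (close ((κ≥0 ⊗ c≥0) ⊗ gap half) (factor (κ * c) ½ (mass (measure ν) P)))
          (subst₂ _≤_ (∑-scale xs (κ * c) _) (∑-scale xs u _) (∑-mono xs pointwise)))
          where
          factor : ∀ k h m → k * m - k * h ≡ k * (m - h)
          factor = solve-∀ ℚ-ring
          pointwise : ∀ x → κ * c * restrict (measure ν) P x ≤ u * bit (P x)
          pointwise x = close (bit≥0 (P x) ⊗ (gap (bounded v x) ⊕ c≥0 ⊗ gap (within ν x)))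
            (expand κ c u (bit (P x)) (measure ν x) (μ v x))
            where
            expand : ∀ k c u b n m → u * b - k * c * (b * n) ≡ b * (u - c * m + c * (m - k * n))
            expand = solve-∀ ℚ-ring

        extend : ∀ qs → length qs ≡ 4 → AllAdjacent qs → All (λ q → P q ≡ true) qs → ⊥
        extend qs len cl qs⊆P = [ one , several ]′ (ℕₚ.≤-total (4 ℕ.∸ Vec.sum (Vec.map (4 ℕ.∸_) r)) 1)
          where
          ok : ∀ x → P x ≡ true → charged x ≡ true × (∀ j → bad j x ≡ false)
          ok = proj₁ (proj₂ removed)

          adjacent-C : ∀ {q} → P q ≡ true → AdjacentTo C q
          adjacent-C {q} p = support ν q (does-true (0ℚ <? measure ν q) (proj₁ (ok q p)))

          degrees : ∀ {qs} → All (λ q → P q ≡ true) qs → ∀ j →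
            ofℕ (length qs) * threshold v (lookup vs j) ≤ ∑ qs (degree (measure (live (suc j))))
          degrees ps j = sum-≥ _ (All.map (λ {q} p →
            below-false (threshold v (lookup vs j)) (degree (measure (live (suc j)))) q (proj₂ (ok q p) j)) ps)

          finish : ∀ {qs} S → length S ≡ length qs → AllAdjacent qs → All (λ q → P q ≡ true) qs → headSize r ℕ.≤ count S →
            (∀ j → Live μ (κ * τ) (select S qs List.++ C) (lookup vs j)) → ⊥
          finish {qs} S len-S cl ps big live′ = embedClique s vs (λ i j → rel (suc i) (suc j))
            (proj₂ (Equivalence.to (T-∧ {Vec.foldr′ (λ l b → (1 ℕ.≤ᵇ l) ∧ b) true r}) pos)) (ℕₚ.≤-trans (ℕₚ.n≤1+n n) few)
            enough (clique-extend S cl (All.map adjacent-C ps) C-cl) live′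
            λ C′ C′-cl size → found C′ C′-cl (ℕₚ.≤-trans sizes size)
            where
            sizes : headSize r ℕ.+ cliqueSize s ℕ.+ length C ℕ.≤ cliqueSize s ℕ.+ length (select S qs List.++ C)
            sizes = subst₂ ℕ._≤_ (rearrange (headSize r) (cliqueSize s) (length C))
                (cong (cliqueSize s ℕ.+_) (sym (trans (Listₚ.length-++ (select S qs))
                  (cong (ℕ._+ length C) (length-select S qs len-S)))))
                (ℕₚ.+-monoʳ-≤ (cliqueSize s) (ℕₚ.+-monoˡ-≤ (length C) big))
              where
              rearrange : ∀ h s c → s ℕ.+ (h ℕ.+ c) ≡ h ℕ.+ s ℕ.+ c
              rearrange h s c = trans (sym (ℕₚ.+-assoc s h c)) (cong (ℕ._+ c) (ℕₚ.+-comm s h))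

          several : 1 ℕ.≤ 4 ℕ.∸ Vec.sum (Vec.map (4 ℕ.∸_) r) → ⊥
          several le = let S , len-S , big , live′ = narrow vs κ≥0 (λ j → live (suc j)) 4 qs len ℕₚ.≤-refl r r≥1 heavy in
            finish S (trans len-S (sym len)) cl qs⊆P (subst (ℕ._≤ count S) (sym (ℕₚ.m≤n⇒m⊔n≡n le)) big) live′
            where
            heavy : ∀ j → ofℕ (lookup r j) - 1ℚ + pow2 4 * τ₀ ≤ ∑ qs (degree (measure (live (suc j))))
            heavy j = ℚₚ.≤-trans (from (lookup r j) (r≥1 j) (rel-row j))
              (subst (λ m → ofℕ m * threshold v (lookup vs j) ≤ ∑ qs (degree (measure (live (suc j))))) len (degrees qs⊆P j))
              where
              from : ∀ l → 1 ℕ.≤ l → l ℕ.≤ L v (lookup vs j) → ofℕ l - 1ℚ + pow2 4 * τ₀ ≤ 4ℚ * threshold v (lookup vs j)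
              from (suc l) _ le = subst (λ t → t + pow2 4 * τ₀ ≤ 4ℚ * threshold v (lookup vs j)) (cancel (ofℕ l))
                (level-density l (v≢ j) le)
                where cancel : ∀ l → l ≡ 1ℚ + l - 1ℚ
                      cancel = solve-∀ ℚ-ring

          -- A single vertex of the K₄ is used. With m = 1 and one neighbour requested from each
          -- cluster, intersecting loses nothing.
          one : 4 ℕ.∸ Vec.sum (Vec.map (4 ℕ.∸_) r) ℕ.≤ 1 → ⊥
          one le = single qs len cl qs⊆P
            where
            single : ∀ qs → length qs ≡ 4 → AllAdjacent qs → All (λ q → P q ≡ true) qs → ⊥
            single (q ∷ _) _ _ (p ∷ _) =
              let S , len-S , big , live′ = narrow vs κ≥0 (λ j → live (suc j)) 1 (q ∷ []) refl (ℕ.s≤s ℕ.z≤n) (Vec.replicate n 1)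
                    (λ j → ℕₚ.≤-reflexive (sym (Vecₚ.lookup-replicate j 1))) heavy in
              finish S len-S ([] ∷ []) (p ∷ [])
                (subst₂ ℕ._≤_ (sym (ℕₚ.m≥n⇒m⊔n≡m le)) refl (ℕₚ.≤-trans (ℕₚ.≤-reflexive (sym (full n))) big)) live′
              where
              full : ∀ n → 1 ℕ.∸ Vec.sum (Vec.map (1 ℕ.∸_) (Vec.replicate n 1)) ≡ 1
              full zero    = refl
              full (suc n) = full n
              heavy : ∀ j → ofℕ (lookup (Vec.replicate n 1) j) - 1ℚ + pow2 1 * τ₀ ≤ ∑ (q ∷ []) (degree (measure (live (suc j))))
              heavy j = ℚₚ.≤-trans (subst (λ l → ofℕ l - 1ℚ + pow2 1 * τ₀ ≤ t) (sym (Vecₚ.lookup-replicate j 1))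
                  (cancel-≤ {4ℚ} (ofℕ>0 3) (close
                    (gap (level-density 0 (v≢ j) (ℕₚ.≤-trans (r≥1 j) (rel-row j))) ⊕ ofℕ≥0 4 ⊗ (pow2≥0 1 ⊗ ℚₚ.<⇒≤ τ₀>0))
                    (expand t τ₀ (pow2 1)))))
                (ℚₚ.≤-trans (ℚₚ.≤-reflexive (sym (ℚₚ.*-identityˡ t))) (degrees (p ∷ []) j))
                where
                t = threshold v (lookup vs j)
                expand : ∀ t τ p → (1ℚ + (1ℚ + (1ℚ + (1ℚ + 0ℚ)))) * t - (1ℚ + (1ℚ + (1ℚ + (1ℚ + 0ℚ)))) * (1ℚ + 0ℚ - 1ℚ + p * τ) ≡
                  (1ℚ + (1ℚ + (1ℚ + (1ℚ + 0ℚ)))) * t - (0ℚ + (p + p + (p + p) + (p + p + (p + p))) * τ)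
                    + (1ℚ + (1ℚ + (1ℚ + (1ℚ + 0ℚ)))) * (p * τ)
                expand = solve-∀ ℚ-ring

-- Copies of K₄ in large sets
module LargeSets where

  open import Defs hiding (sym)
  open import Data.Bool using (Bool; true; false; _∧_)
  open import Data.Empty using (⊥; ⊥-elim)
  open import Data.Fin as Fin using (Fin; zero; suc; toℕ; inject≤; remQuot)
  import Data.Fin.Properties as Finₚ
  open import Data.Fin.Subset as Subset using (Subset; inside; outside; ∣_∣; _∈_)
  import Data.Fin.Subset.Properties as Subsetₚ
  open import Data.List as List using (List; []; _∷_; length; filter)
  import Data.List.Properties as Listₚ
  open import Data.List.Membership.Propositional using () renaming (_∈_ to _∈ˡ_)
  import Data.List.Membership.Propositional.Properties as Memₚ
  open import Data.List.Relation.Unary.All as All using (All; []; _∷_)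
  import Data.List.Relation.Unary.All.Properties as Allₚ
  open import Data.List.Relation.Unary.AllPairs as AllPairs using (AllPairs; []; _∷_)
  import Data.List.Relation.Unary.AllPairs.Properties as AllPairsₚ
  open import Data.List.Relation.Unary.Any using (here; there)
  open import Data.List.Relation.Unary.Unique.Propositional using (Unique)
  import Data.List.Relation.Unary.Unique.Propositional.Properties as Uniqueₚ
  open import Data.Nat using (ℕ; zero; suc; _+_; _*_; _≤_; _<_; z≤n; s≤s)
  import Data.Nat.Properties as ℕₚ
  open import Data.Product using (_×_; _,_; proj₁; proj₂)
  open import Data.Sum using (_⊎_; inj₁; inj₂; [_,_]′)
  open import Data.Vec using ([]; _∷_; here; there)
  open import Relation.Nullary using (¬_; Dec; yes; no; does)
  open import Relation.Nullary.Decidable using (dec-true; dec-false)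
  open import Relation.Binary.PropositionalEquality using (_≡_; _≢_; refl; sym; trans; cong; cong₂; subst)

  -- Subsets as lists without repetition

  elements : ∀ {n} → Subset n → List (Fin n)
  elements []            = []
  elements (inside ∷ p)  = zero ∷ List.map suc (elements p)
  elements (outside ∷ p) = List.map suc (elements p)

  length-elements : ∀ {n} (p : Subset n) → length (elements p) ≡ ∣ p ∣
  length-elements []            = refl
  length-elements (inside ∷ p)  = cong suc (trans (Listₚ.length-map suc (elements p)) (length-elements p))
  length-elements (outside ∷ p) = trans (Listₚ.length-map suc (elements p)) (length-elements p)

  elements-sound : ∀ {n} (p : Subset n) {x} → x ∈ˡ elements p → x ∈ p
  elements-sound (inside ∷ p)  (here refl) = here
  elements-sound (inside ∷ p)  (there x∈)  with Memₚ.∈-map⁻ suc x∈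
  ... | y , y∈ , refl = there (elements-sound p y∈)
  elements-sound (outside ∷ p) x∈ with Memₚ.∈-map⁻ suc x∈
  ... | y , y∈ , refl = there (elements-sound p y∈)

  elements-unique : ∀ {n} (p : Subset n) → Unique (elements p)
  elements-unique []            = []
  elements-unique (inside ∷ p)  =
    Allₚ.map⁺ (All.universal (λ _ ()) (elements p)) ∷ Uniqueₚ.map⁺ Finₚ.suc-injective (elements-unique p)
  elements-unique (outside ∷ p) = Uniqueₚ.map⁺ Finₚ.suc-injective (elements-unique p)

  insert : ∀ {n} → Fin n → Subset n → Subset n
  insert zero    (b ∷ p) = inside ∷ p
  insert (suc i) (b ∷ p) = b ∷ insert i p

  ∣insert∣ : ∀ {n} (i : Fin n) p → ¬ (i ∈ p) → ∣ insert i p ∣ ≡ suc ∣ p ∣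
  ∣insert∣ zero    (inside ∷ p)  i∉ = ⊥-elim (i∉ here)
  ∣insert∣ zero    (outside ∷ p) i∉ = refl
  ∣insert∣ (suc i) (inside ∷ p)  i∉ = cong suc (∣insert∣ i p λ i∈ → i∉ (there i∈))
  ∣insert∣ (suc i) (outside ∷ p) i∉ = ∣insert∣ i p λ i∈ → i∉ (there i∈)

  insert-∈ : ∀ {n} (i : Fin n) p {x} → x ∈ insert i p → x ≡ i ⊎ x ∈ p
  insert-∈ zero    (b ∷ p) here       = inj₁ refl
  insert-∈ zero    (b ∷ p) (there x∈) = inj₂ (there x∈)
  insert-∈ (suc i) (b ∷ p) here       = inj₂ here
  insert-∈ (suc i) (b ∷ p) (there x∈) = [ (λ { refl → inj₁ refl }) , (λ x∈p → inj₂ (there x∈p)) ]′ (insert-∈ i p x∈)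

  fromList : ∀ {n} → List (Fin n) → Subset n
  fromList []       = Subset.⊥
  fromList (x ∷ xs) = insert x (fromList xs)

  fromList-sound : ∀ {n} (xs : List (Fin n)) {x} → x ∈ fromList xs → x ∈ˡ xs
  fromList-sound []       x∈ = ⊥-elim (Subsetₚ.∉⊥ x∈)
  fromList-sound (y ∷ xs) x∈ = [ here , (λ x∈xs → there (fromList-sound xs x∈xs)) ]′ (insert-∈ y (fromList xs) x∈)

  ∣fromList∣ : ∀ {n} {xs : List (Fin n)} → Unique xs → ∣ fromList xs ∣ ≡ length xs
  ∣fromList∣ {n} []     = Subsetₚ.∣⊥∣≡0 n
  ∣fromList∣ {xs = x ∷ xs} (x# ∷ u) = trans (∣insert∣ x (fromList xs)
    (λ x∈ → All.lookup x# (fromList-sound xs x∈) refl)) (cong suc (∣fromList∣ u))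

  allPairs : ∀ {A : Set} {R : A → A → Set} {xs} → Unique xs → (∀ {i j} → i ∈ˡ xs → j ∈ˡ xs → i ≢ j → R i j) → AllPairs R xs
  allPairs []      r = []
  allPairs (x# ∷ u) r =
    All.tabulate (λ y∈ → r (here refl) (there y∈) (All.lookup x# y∈)) ∷ allPairs u (λ i∈ j∈ → r (there i∈) (there j∈))

  fromAllPairs : ∀ {A : Set} {R : A → A → Set} {xs} → (∀ {i j} → R i j → R j i) → AllPairs R xs →
    ∀ {i j} → i ∈ˡ xs → j ∈ˡ xs → i ≢ j → R i j
  fromAllPairs R-sym (a ∷ as) (here refl) (here refl) i≢j = ⊥-elim (i≢j refl)
  fromAllPairs R-sym (a ∷ as) (here refl) (there j∈)  i≢j = All.lookup a j∈
  fromAllPairs R-sym (a ∷ as) (there i∈)  (here refl) i≢j = R-sym (All.lookup a i∈)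
  fromAllPairs R-sym (a ∷ as) (there i∈)  (there j∈)  i≢j = fromAllPairs R-sym as i∈ j∈ i≢j

  true≢false : true ≢ false
  true≢false ()

  clique-bound : ∀ {n t} (G : Graph n) → KFree t G → ∀ xs → AllPairs (λ x y → adj G x y ≡ true) xs → ¬ (t ≤ length xs)
  clique-bound {t = t} G free xs cl t≤ =
    free (fromList ys , clique , trans (∣fromList∣ unique) (trans (Listₚ.length-take t xs) (ℕₚ.m≤n⇒m⊓n≡m t≤)))
    where
    ys = List.take t xs
    cl′ : AllPairs (λ x y → adj G x y ≡ true) ys
    cl′ = AllPairsₚ.take⁺ t cl
    unique : Unique ys
    unique = AllPairs.map (λ { {x} e refl → true≢false (trans (sym e) (irrefl G x)) }) cl′
    clique : Clique G (fromList ys)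
    clique i j i∈ j∈ = fromAllPairs (λ {i} {j} e → trans (sym (Graph.sym G i j)) e) cl′ (fromList-sound ys i∈) (fromList-sound ys j∈)

  independent-bound : ∀ {n a} (G : Graph n) → IsIndepNum G a → ∀ {xs} → Unique xs →
    (∀ {i j} → i ∈ˡ xs → j ∈ˡ xs → adj G i j ≡ false) → length xs ≤ a
  independent-bound G (_ , bound) {xs} u ind = subst (_≤ _) (∣fromList∣ u)
    (bound (fromList xs) λ i j i∈ j∈ → ind (fromList-sound xs i∈) (fromList-sound xs j∈))

  -- A candidate is declared maximal, and a counterexample to this restarts the search with a larger
  -- independent set; at most n restarts are possible.
  some-indepNum : ∀ {n} (G : Graph n) → (∀ a → IsIndepNum G a → ⊥) → ⊥
  some-indepNum {n} G none = search n Subset.⊥ (λ i j i∈ _ → ⊥-elim (Subsetₚ.∉⊥ i∈)) (ℕₚ.m≤n+m n _)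
    where
    search : ∀ fuel S → Independent G S → n ≤ ∣ S ∣ + fuel → ⊥
    search fuel S ind le = none ∣ S ∣ ((S , ind , refl) , larger fuel le)
      where
      larger : ∀ fuel → n ≤ ∣ S ∣ + fuel → ∀ S′ → Independent G S′ → ∣ S′ ∣ ≤ ∣ S ∣
      larger fuel le S′ ind′ with ∣ S′ ∣ ℕₚ.≤? ∣ S ∣
      ... | yes S′≤S = S′≤S
      larger zero    le S′ ind′ | no S′≰S = ⊥-elim (S′≰S (ℕₚ.≤-trans (Subsetₚ.∣p∣≤n S′) (subst (n ≤_) (ℕₚ.+-identityʳ _) le)))
      larger (suc f) le S′ ind′ | no S′≰S = ⊥-elim (search f S′ ind′ (ℕₚ.≤-trans le
        (subst (_≤ ∣ S′ ∣ + f) (sym (ℕₚ.+-suc ∣ S ∣ f)) (ℕₚ.+-monoˡ-≤ f (ℕₚ.≰⇒> S′≰S)))))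

  some-Q : ∀ {n t a} (H : Graph n) → KFree t H → IsIndepNum H a → (∀ q → IsQ t n q → ⊥) → ⊥
  some-Q {n} {t} {a} H free ind none = search a H free ind ℕₚ.≤-refl
    where
    search : ∀ fuel {a} (H : Graph n) → KFree t H → IsIndepNum H a → a ≤ fuel → ⊥
    search fuel {a} H free ind le = none a ((H , free , ind) , smaller fuel le)
      where
      smaller : ∀ fuel → a ≤ fuel → ∀ H′ → KFree t H′ → ∀ a′ → IsIndepNum H′ a′ → a ≤ a′
      smaller fuel le H′ free′ a′ ind′ with a ℕₚ.≤? a′
      ... | yes a≤a′ = a≤a′
      smaller zero    le H′ free′ a′ ind′ | no a≰a′ = ⊥-elim (a≰a′ (ℕₚ.≤-trans le z≤n))
      smaller (suc f) le H′ free′ a′ ind′ | no a≰a′ = ⊥-elim (search f H′ free′ ind′ (ℕₚ.≤-pred (ℕₚ.≤-trans (ℕₚ.≰⇒> a≰a′) le)))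

  -- A single vertex is independent. This later makes the comparison of m α(G) with Q(4,n) strict.
  Q-positive : ∀ {n t q} → 1 ≤ n → IsQ t n q → 1 ≤ q
  Q-positive {suc n} _ ((H , _ , ind) , _) = independent-bound H ind ([] ∷ []) λ { (here refl) (here refl) → irrefl H zero }

  length-filters : ∀ {A : Set} {P Q : A → Set} (P? : ∀ x → Dec (P x)) (Q? : ∀ x → Dec (Q x)) xs →
    (∀ {x} → x ∈ˡ xs → P x ⊎ Q x) → length xs ≤ length (filter P? xs) + length (filter Q? xs)
  length-filters P? Q? []       cover = z≤n
  length-filters P? Q? (x ∷ xs) cover with length-filters P? Q? xs (λ x∈ → cover (there x∈)) | P? x | Q? x
  ... | ih | yes _ | yes _ = s≤s (ℕₚ.≤-trans ih (ℕₚ.+-monoʳ-≤ _ (ℕₚ.n≤1+n _)))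
  ... | ih | yes _ | no _  = s≤s ih
  ... | ih | no _  | yes _ = subst (suc (length xs) ≤_) (sym (ℕₚ.+-suc _ _)) (s≤s ih)
  ... | ih | no ¬p | no ¬q = ⊥-elim ([ ¬p , ¬q ]′ (cover (here refl)))

  colour-classes : ∀ {A : Set} (f : A → ℕ) {a} m {xs} → Unique xs → (∀ {x} → x ∈ˡ xs → f x < m) →
    (∀ c {ys} → Unique ys → (∀ {y} → y ∈ˡ ys → y ∈ˡ xs × f y ≡ c) → length ys ≤ a) → length xs ≤ m * a
  colour-classes f zero    {[]}     u lt small = z≤n
  colour-classes f zero    {x ∷ xs} u lt small = ⊥-elim (ℕₚ.n≮0 (lt (here refl)))
  colour-classes f {a} (suc m) {xs} u lt small = ℕₚ.≤-trans
    (length-filters (λ x → f x ℕₚ.≟ m) (λ x → f x ℕₚ.<? m) xs below-or-top) (ℕₚ.+-mono-≤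
    (small m (Uniqueₚ.filter⁺ (λ x → f x ℕₚ.≟ m) u) (Memₚ.∈-filter⁻ (λ x → f x ℕₚ.≟ m)))
    (colour-classes f m (Uniqueₚ.filter⁺ (λ x → f x ℕₚ.<? m) u) (λ x∈ → proj₂ (Memₚ.∈-filter⁻ (λ x → f x ℕₚ.<? m) {xs = xs} x∈))
      λ c u′ in-class → small c u′ λ y∈ → let y∈′ , e = in-class y∈ in proj₁ (Memₚ.∈-filter⁻ (λ x → f x ℕₚ.<? m) {xs = xs} y∈′) , e))
    where
    below-or-top : ∀ {x} → x ∈ˡ xs → f x ≡ m ⊎ f x < m
    below-or-top {x} x∈ with f x ℕₚ.≟ m
    ... | yes f≡m = inj₁ f≡m
    ... | no f≢m  = inj₂ (ℕₚ.≤∧≢⇒< (ℕₚ.≤-pred (lt x∈)) f≢m)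

  lookup-injective : ∀ {A : Set} {xs : List A} → Unique xs → ∀ i j → List.lookup xs i ≡ List.lookup xs j → i ≡ j
  lookup-injective (x# ∷ u) zero    zero    e = refl
  lookup-injective (x# ∷ u) zero    (suc j) e = ⊥-elim (All.lookup x# (Memₚ.∈-lookup j) e)
  lookup-injective (x# ∷ u) (suc i) zero    e = ⊥-elim (All.lookup x# (Memₚ.∈-lookup i) (sym e))
  lookup-injective (x# ∷ u) (suc i) (suc j) e = cong suc (lookup-injective u i j e)

  -- Disjoint copies of an induced subgraph

  module BlowUp {n : ℕ} (G : Graph n) (W : List (Fin n)) (W-unique : Unique W) (m : ℕ) (n≤ : n ≤ m * length W) where

    -- Vertices are placed in an m by |W| grid, one copy of W per row. Only the first n places are
    -- occupied, so the graph has exactly n vertices and the copies at the end may be incomplete or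
    -- empty.
    coordinates : Fin n → Fin m × Fin (length W)
    coordinates v = remQuot (length W) (inject≤ v n≤)

    coordinates-injective : ∀ {u v} → coordinates u ≡ coordinates v → u ≡ v
    coordinates-injective {u} {v} e = Finₚ.inject≤-injective n≤ n≤ u v
      (trans (sym (Finₚ.combine-remQuot {m} (length W) _))
        (trans (cong (λ p → Fin.combine (proj₁ p) (proj₂ p)) e) (Finₚ.combine-remQuot {m} (length W) _)))

    colour : Fin n → Fin m
    colour v = proj₁ (coordinates v)

    item : Fin n → Fin n
    item v = List.lookup W (proj₂ (coordinates v))

    item-injective : ∀ {u v} → colour u ≡ colour v → item u ≡ item v → u ≡ v
    item-injective {u} {v} same e = coordinates-injective (cong₂ _,_ same (lookup-injective W-unique _ _ e))

    copies : Graph n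
    copies .adj u v    = does (colour u Fin.≟ colour v) ∧ adj G (item u) (item v)
    copies .Graph.sym u v = cong₂ _∧_ (does-sym (colour u) (colour v)) (Graph.sym G (item u) (item v))
      where
      does-sym : ∀ (a b : Fin m) → does (a Fin.≟ b) ≡ does (b Fin.≟ a)
      does-sym a b with a Fin.≟ b
      ... | yes refl = sym (dec-true (a Fin.≟ a) refl)
      ... | no a≢b   = sym (dec-false (b Fin.≟ a) λ e → a≢b (sym e))
    copies .irrefl u with colour u Fin.≟ colour u
    ... | yes _ = irrefl G (item u)
    ... | no _  = refl

    adj-copies : ∀ {u v} → adj copies u v ≡ true → adj G (item u) (item v) ≡ true
    adj-copies {u} {v} e with colour u Fin.≟ colour v
    ... | yes _ = e

    adj-class : ∀ {u v} → colour u ≡ colour v → adj copies u v ≡ adj G (item u) (item v)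
    adj-class {u} {v} same = cong (_∧ adj G (item u) (item v)) (dec-true (colour u Fin.≟ colour v) same)

    copies-free : ∀ {t} → (∀ qs → length qs ≡ t → AllPairs (λ x y → adj G x y ≡ true) qs → All (_∈ˡ W) qs → ⊥) → KFree t copies
    copies-free none (S , clique , size) = none (List.map item (elements S))
      (trans (Listₚ.length-map item (elements S)) (trans (length-elements S) size))
      (AllPairsₚ.map⁺ (allPairs (elements-unique S) λ {i} {j} i∈ j∈ i≢j →
        adj-copies {i} {j} (clique i j (elements-sound S i∈) (elements-sound S j∈) i≢j)))
      (Allₚ.map⁺ (All.universal (λ v → Memₚ.∈-lookup {xs = W} (proj₂ (coordinates v))) (elements S)))

    -- An independent set meets each of the m copies in an independent set of `G`.
    copies-indepNum : ∀ {h a} → IsIndepNum copies h → IsIndepNum G a → h ≤ m * a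
    copies-indepNum {h} {a} ((S , ind , size) , _) indG = subst (_≤ m * a) (trans (length-elements S) size)
      (colour-classes (λ v → toℕ (colour v)) m (elements-unique S) (λ _ → Finₚ.toℕ<n _) class)
      where
      class : ∀ c {ys} → Unique ys → (∀ {y} → y ∈ˡ ys → y ∈ˡ elements S × toℕ (colour y) ≡ c) → length ys ≤ a
      class c {ys} u in-class = subst (_≤ a) (Listₚ.length-map item ys) (independent-bound G indG
          (AllPairsₚ.map⁺ (allPairs u λ i∈ j∈ i≢j e → i≢j (item-injective (same i∈ j∈) e))) independent)
        where
        same : ∀ {i j} → i ∈ˡ ys → j ∈ˡ ys → colour i ≡ colour j
        same i∈ j∈ = Finₚ.toℕ-injective (trans (proj₂ (in-class i∈)) (sym (proj₂ (in-class j∈))))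
        independent : ∀ {x y} → x ∈ˡ List.map item ys → y ∈ˡ List.map item ys → adj G x y ≡ false
        independent x∈ y∈ with Memₚ.∈-map⁻ item x∈ | Memₚ.∈-map⁻ item y∈
        ... | i , i∈ , refl | j , j∈ , refl = trans (sym (adj-class {i} {j} (same i∈ j∈)))
          (ind i j (elements-sound S (proj₁ (in-class i∈))) (elements-sound S (proj₁ (in-class j∈))))

  -- If W contained no K_t, then m copies of G[W] would form a K_t-free graph with independence number at most m α(G).
  clique-in-large-set : ∀ {n t m} (G : Graph n) → (∀ a q → IsIndepNum G a → IsQ t n q → m * a < q) →
    ∀ W → Unique W → n ≤ m * length W →
    (∀ qs → length qs ≡ t → AllPairs (λ x y → adj G x y ≡ true) qs → All (_∈ˡ W) qs → ⊥) → ⊥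
  clique-in-large-set {n} {t} {m} G small W W-unique n≤ none =
    some-indepNum G λ a indG → some-indepNum copies λ h indH → some-Q copies (copies-free none) indH λ q isQ →
      ℕₚ.<⇒≱ (small a q indG isQ) (ℕₚ.≤-trans (proj₂ isQ copies (copies-free none) h indH) (copies-indepNum indH indG))
    where open BlowUp G W W-unique m n≤

-- From densities to levels
module DensityCounting where

  open Regularity
  open import Data.List using (List; _∷_; allFin; length)
  open import Data.Rational using (ℚ; 0ℚ; 1ℚ; _≤_; _<_; _+_; _*_; _-_; -_; _≤?_; _<?_)
  open import Relation.Binary.PropositionalEquality using (_≡_; _≢_; refl; sym; trans; cong; cong₂; subst; subst₂)
  open Rationals

  module Counting {V : Set} (xs : List V) (A : V → V → ℚ) (A-sym : ∀ x y → A x y ≡ A y x)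
    (A≥0 : ∀ x y → 0ℚ ≤ A x y) (A≤1 : ∀ x y → A x y ≤ 1ℚ) where

    open Reg xs A A-sym A≥0 A≤1
    open import Data.Empty using (⊥-elim)
    open import Data.Fin as Fin using (Fin)
    import Data.List.Properties as Listₚ
    import Data.List.Relation.Unary.Unique.Propositional.Properties as Uniqueₚ
    open import Data.Nat as ℕ using (ℕ; suc)
    import Data.Rational.Properties as ℚₚ
    open import Relation.Nullary using (yes; no; does)
    open import Tactic.RingSolver using (solve-∀)
    open MinimumDegree using (sumOver)

    module _ {k : ℕ} where

      ks : List (Fin k)
      ks = allFin k

      K : ℚ
      K = ofℕ k

      length-ks : length ks ≡ k
      length-ks = Listₚ.length-tabulate _

      ∑ks-const : ∀ c → ∑ ks (λ _ → c) ≡ K * c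
      ∑ks-const c = trans (∑-const ks c) (cong (λ l → ofℕ l * c) length-ks)

      ∑∑-const : ∀ c → ∑ ks (λ _ → ∑ ks (λ _ → c)) ≡ K * (K * c)
      ∑∑-const c = trans (∑ks-const (∑ ks (λ _ → c))) (cong (K *_) (∑ks-const c))

      ∑∑-shift : ∀ (f : Fin k → Fin k → ℚ) c → ∑ ks (λ a → ∑ ks (λ b → f a b + c)) ≡ ∑ ks (λ a → ∑ ks (f a)) + K * (K * c)
      ∑∑-shift f c = trans (∑-cong ks λ a → ∑-+ ks (f a) _) (trans (∑-+ ks _ _) (cong (∑ ks (λ a → ∑ ks (f a)) +_) (∑∑-const c)))

      pairDensity : (Fin k → V → ℚ) → Fin k → Fin k → ℚ
      pairDensity μ a b with a Fin.≟ b
      ... | yes _ = 0ℚ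
      ... | no _  = density (μ a) (μ b)

      totalDensity : (Fin k → V → ℚ) → ℚ
      totalDensity μ = ∑ ks λ a → ∑ ks (pairDensity μ a)

      clusterLevel : ℚ → (Fin k → V → ℚ) → Fin k → Fin k → ℕ
      clusterLevel g μ a b with a Fin.≟ b
      ... | yes _ = 0
      ... | no _  = levelUpTo g 4 (ofℕ 4 * density (μ a) (μ b))

      module _ (g : ℚ) (g≥0 : 0ℚ ≤ g) (μ : Fin k → V → ℚ) (μ-dist : ∀ a → Distribution (μ a)) where

        clusterLevel≤4 : ∀ a b → clusterLevel g μ a b ℕ.≤ 4
        clusterLevel≤4 a b with a Fin.≟ b
        ... | yes _ = ℕ.z≤n
        ... | no _  = levelUpTo-≤ g 4 _

        clusterLevel-irrefl : ∀ a → clusterLevel g μ a a ≡ 0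
        clusterLevel-irrefl a with a Fin.≟ a
        ... | yes _  = refl
        ... | no a≢a = ⊥-elim (a≢a refl)

        clusterLevel-sym : ∀ a b → clusterLevel g μ a b ≡ clusterLevel g μ b a
        clusterLevel-sym a b with a Fin.≟ b | b Fin.≟ a
        ... | yes _   | yes _   = refl
        ... | yes a≡b | no b≢a  = ⊥-elim (b≢a (sym a≡b))
        ... | no a≢b  | yes b≡a = ⊥-elim (a≢b (sym b≡a))
        ... | no _    | no _    = cong (λ w → levelUpTo g 4 (ofℕ 4 * w)) (density-sym (μ a) (μ b))

        clusterLevel-density : ∀ {a b} l → suc l ℕ.≤ clusterLevel g μ a b → ofℕ l + g ≤ ofℕ 4 * density (μ a) (μ b)
        clusterLevel-density {a} {b} l le with a Fin.≟ b
        ... | no _ = levelUpTo-lower g 4 le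

        pairDensity≤level : ∀ a b → ofℕ 4 * pairDensity μ a b ≤ ofℕ (clusterLevel g μ a b) + g
        pairDensity≤level a b with a Fin.≟ b
        ... | yes _ = subst (_≤ 0ℚ + g) (sym (ℚₚ.*-zeroʳ (ofℕ 4))) (ℚₚ.≤-refl ⊕ g≥0)
        ... | no _  = levelUpTo-upper g 4 (close (ofℕ≥0 4 ⊗ gap (density≤1 (μ-dist a) (μ-dist b)) ⊕ g≥0)
            (factor (ofℕ 4) (density (μ a) (μ b)) g))
          where
          factor : ∀ f d g → f + g - f * d ≡ f * (1ℚ - d) + g
          factor = solve-∀ ℚ-ring

        totalDensity≤levels : ofℕ 4 * totalDensity μ ≤ ofℕ (sumOver ks (λ a → sumOver ks (clusterLevel g μ a))) + K * (K * g)
        totalDensity≤levels = subst₂ _≤_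
          (trans (∑-cong ks λ a → ∑-scale ks (ofℕ 4) (pairDensity μ a)) (∑-scale ks (ofℕ 4) _))
          (trans (∑∑-shift (λ a b → ofℕ (clusterLevel g μ a b)) g)
            (cong (_+ K * (K * g)) (sym (trans (ofℕ-sum ks _) (∑-cong ks λ a → ofℕ-sum ks (clusterLevel g μ a))))))
          (∑-mono ks λ a → ∑-mono ks (pairDensity≤level a))

      module _ (η : ℚ) (η≥0 : 0ℚ ≤ η) where
        open Energy {k} η η≥0

        energy≤density : ∀ μ → (∀ a → Distribution (μ a)) → energy μ ≤ totalDensity μ + K * (K * η)
        energy≤density μ μ-dist = subst (energy μ ≤_) (∑∑-shift (pairDensity μ) η) (∑-mono ks λ a → ∑-mono ks (pair a))
          where
          pair : ∀ a b → pairEnergy μ a b ≤ pairDensity μ a b + η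
          pair a b with a Fin.≟ b
          ... | yes _ = ℚₚ.≤-refl ⊕ η≥0
          ... | no _  = close (η≥0 ⊗ (gap w≤1 ⊗ (0≤1 ⊕ density≥0 (μ-dist a) (μ-dist b)))) (factor (density (μ a) (μ b)) η)
            where
            w≤1 = density≤1 (μ-dist a) (μ-dist b)
            factor : ∀ w h → w + h - (w + h * (w * w)) ≡ h * ((1ℚ - w) * (1ℚ + w))
            factor = solve-∀ ℚ-ring

        energy≤ : ∀ μ → (∀ a → Distribution (μ a)) → energy μ ≤ K * (K * 1ℚ) + K * (K * η)
        energy≤ μ μ-dist = ℚₚ.≤-trans (energy≤density μ μ-dist) (ℚₚ.+-monoˡ-≤ (K * (K * η))
          (subst (totalDensity μ ≤_) (∑∑-const 1ℚ) (∑-mono ks λ a → ∑-mono ks (pair a))))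
          where
          pair : ∀ a b → pairDensity μ a b ≤ 1ℚ
          pair a b with a Fin.≟ b
          ... | yes _ = 0≤1
          ... | no _  = density≤1 (μ-dist a) (μ-dist b)

        -- There are k² - k pairs off the diagonal, counted by subtracting an indicator from each
        -- row. The quadratic part of the energy is dropped.
        energy-constant : ∀ {μ} → Distribution μ → (K * K - K) * density μ μ ≤ energy (λ _ → μ)
        energy-constant {μ} μ-dist = ℚₚ.≤-trans (close (gap off-diagonal) (expand K w (∑ ks (λ _ → K * w - w)))) (∑-mono ks row)
          where
          w = density μ μ
          w≥0 = density≥0 μ-dist μ-dist
          expand : ∀ k w s → s - (k * k - k) * w ≡ s - k * (k * w - w)
          expand = solve-∀ ℚ-ring
          off-diagonal : K * (K * w - w) ≤ ∑ ks (λ _ → K * w - w)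
          off-diagonal = ℚₚ.≤-reflexive (sym (∑ks-const (K * w - w)))

          pair : ∀ a b → w + (- w) * bit (does (a Fin.≟ b)) ≤ pairEnergy (λ _ → μ) a b
          pair a b with a Fin.≟ b
          ... | yes _ = ℚₚ.≤-reflexive (cancel w)
            where cancel : ∀ w → w + (- w) * 1ℚ ≡ 0ℚ
                  cancel = solve-∀ ℚ-ring
          ... | no _  = close (η≥0 ⊗ (w≥0 ⊗ w≥0)) (cancel w η)
            where cancel : ∀ w h → w + h * (w * w) - (w + (- w) * 0ℚ) ≡ h * (w * w)
                  cancel = solve-∀ ℚ-ring

          row : ∀ a → K * w - w ≤ ∑ ks (pairEnergy (λ _ → μ) a)
          row a = ℚₚ.≤-trans (close (w≥0 ⊗ gap (∑-indicator a (Uniqueₚ.allFin⁺ k))) (expand′ K w _))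
            (ℚₚ.≤-trans (ℚₚ.≤-reflexive (sym (trans (∑-+ ks _ _) (cong₂ _+_ (∑ks-const w)
              (∑-scale ks (- w) _))))) (∑-mono ks (pair a)))
            where
            expand′ : ∀ k w s → k * w + (- w) * s - (k * w - w) ≡ w * (1ℚ - s)
            expand′ = solve-∀ ℚ-ring

    -- 13 Σ L ≥ 52 (k² − k) w − 26 k² g with 13 w ≥ 8 + 26 g, and k g ≥ 1 + 2 g absorbs the terms linear in k.
    excess : ∀ {k g h w e₀ e d l} → 0ℚ < k → 0ℚ ≤ g → g ≡ ofℕ 4 * h → 1ℚ ≤ k → 1ℚ + ofℕ 2 * g ≤ k * g →
      ofℕ 8 + ofℕ 26 * g ≤ ofℕ 13 * w → (k * k - k) * w ≤ e₀ → e₀ ≤ e → e ≤ d + k * (k * h) → ofℕ 4 * d ≤ l + k * (k * g) →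
      ofℕ 32 * (k * k + k) < ofℕ 13 * l
    excess {k} {g} {h} {w} {e₀} {e} {d} {l} k>0 g≥0 refl k≥1 kg w≥ e₀≥ e≥ e≤ d≤ = close<
      (ofℕ≥0 13 ⊗ gap d≤ ⊕ ofℕ≥0 52 ⊗ (gap e≤ ⊕ gap e≥ ⊕ gap e₀≥) ⊕ ofℕ≥0 4 ⊗ (ℚₚ.<⇒≤ k>0 ⊗ gap k≥1) ⊗ gap w≥
        ⊕ ofℕ≥0 78 ⊗ ℚₚ.<⇒≤ k>0 ⊗ gap kg ⊕ ofℕ≥0 52 ⊗ ℚₚ.<⇒≤ k>0 ⊗ g≥0 ⊕< ofℕ>0 13 ⊗< k>0)
      (expand k h w e₀ e d l)
      where
      expand : ∀ k h w e₀ e d l → ofℕ 13 * l - ofℕ 32 * (k * k + k) ≡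
        ofℕ 13 * (l + k * (k * (ofℕ 4 * h)) - ofℕ 4 * d)
        + ofℕ 52 * (d + k * (k * h) - e + (e - e₀) + (e₀ - (k * k - k) * w))
        + ofℕ 4 * (k * (k - 1ℚ)) * (ofℕ 13 * w - (ofℕ 8 + ofℕ 26 * (ofℕ 4 * h)))
        + ofℕ 78 * k * (k * (ofℕ 4 * h) - (1ℚ + ofℕ 2 * (ofℕ 4 * h)))
        + ofℕ 52 * k * (ofℕ 4 * h)
        + ofℕ 14 * k
      expand = solve-∀ ℚ-ring

-- The density of K₁₂-free graphs
module Sparsity where

  open Rationals
  open import Defs hiding (sym)
  open import Data.Bool using (Bool; true; false; _∧_; if_then_else_; T)
  open import Data.Empty using (⊥; ⊥-elim)
  open import Data.Fin as Fin using (Fin; toℕ)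
  open import Data.Integer as ℤ using (+_; -[1+_])
  import Data.Integer.Properties as ℤₚ
  open import Data.List as List using (List; []; _∷_; allFin; length)
  import Data.List.Properties as Listₚ
  open import Data.Nat as ℕ using (ℕ; zero; suc)
  import Data.Nat.Properties as ℕₚ
  open import Data.Product using (∃-syntax; _×_; _,_; proj₁; proj₂)
  open import Data.Rational using (ℚ; mkℚ; 0ℚ; 1ℚ; ½; _≤_; _<_; _+_; _*_; _-_; -_; _/_; toℚᵘ; *≤*)
  import Data.Rational.Properties as ℚₚ
  open import Data.Rational.Unnormalised as ℚᵘ using (mkℚᵘ)
  import Data.Rational.Unnormalised.Properties as ℚᵘₚ
  open import Data.Bool.Properties using (T-≡; T?)
  open import Data.List.Membership.Propositional using (_∈_)
  import Data.List.Membership.Propositional.Properties as Memₚ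
  open import Data.List.Relation.Unary.All as All using (All; []; _∷_)
  open import Data.List.Relation.Unary.Any using (here)
  open import Data.List.Relation.Unary.AllPairs using (AllPairs; []; _∷_)
  import Data.List.Relation.Unary.Unique.Propositional.Properties as Uniqueₚ
  open import Data.Sum using (_⊎_; [_,_]′)
  open import Data.Vec using (Vec; []; _∷_; lookup)
  open import Data.Vec.Relation.Unary.All using ([]; _∷_)
  open import Function using (Equivalence)
  open import Relation.Nullary.Decidable using (from-yes)
  open Game using (State; []; _∷_; level; cliqueSize; positive; module Soundness)
  open Strategy using (strategy; strategy-checks; opening∈strategy)
  open MinimumDegree using (module Deletion)
  open LargeSets using (clique-in-large-set; clique-bound)
  open Regularity
  open CliqueEmbedding
  open DensityCounting
  open import Relation.Binary.PropositionalEquality using (_≡_; _≢_; refl; sym; trans; cong; cong₂; subst; subst₂)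
  open import Tactic.RingSolver using (solve-∀)

  -- Numerals, the archimedean property and edge counts

  ℕtoℚ-suc : ∀ n → ℕtoℚ (suc n) ≡ 1ℚ + ℕtoℚ n
  ℕtoℚ-suc n = ℚₚ.toℚᵘ-injective (begin
    toℚᵘ (ℕtoℚ (suc n))              ≈⟨ ℚₚ.toℚᵘ-fromℚᵘ (mkℚᵘ (+ suc n) 0) ⟩
    mkℚᵘ (+ suc n) 0                 ≈⟨ ℚᵘ.*≡* (cong (ℤ._* + 1) (sym (cong (λ z → + 1 ℤ.+ z) (ℤₚ.*-identityʳ (+ n))))) ⟩
    mkℚᵘ (+ 1) 0 ℚᵘ.+ mkℚᵘ (+ n) 0   ≈⟨ ℚᵘₚ.+-congʳ (mkℚᵘ (+ 1) 0) (ℚᵘₚ.≃-sym (ℚₚ.toℚᵘ-fromℚᵘ (mkℚᵘ (+ n) 0))) ⟩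
    toℚᵘ 1ℚ ℚᵘ.+ toℚᵘ (ℕtoℚ n)       ≈⟨ ℚᵘₚ.≃-sym (ℚₚ.toℚᵘ-homo-+ 1ℚ (ℕtoℚ n)) ⟩
    toℚᵘ (1ℚ + ℕtoℚ n)               ∎)
    where open ℚᵘₚ.≃-Reasoning

  ℕtoℚ≡ofℕ : ∀ n → ℕtoℚ n ≡ ofℕ n
  ℕtoℚ≡ofℕ zero    = refl
  ℕtoℚ≡ofℕ (suc n) = trans (ℕtoℚ-suc n) (cong (λ t → 1ℚ + t) (ℕtoℚ≡ofℕ n))

  archimedean : ∀ x → ∃[ m ] (x ≤ ofℕ m)
  archimedean x@(mkℚ a d _) = ℤ.∣ a ∣ , subst (x ≤_) (ℕtoℚ≡ofℕ ℤ.∣ a ∣) (ℚₚ.toℚᵘ-cancel-≤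
    (ℚᵘₚ.≤-trans (ℚᵘ.*≤* (bound a)) (ℚᵘₚ.≤-reflexive (ℚᵘₚ.≃-sym (ℚₚ.toℚᵘ-fromℚᵘ (mkℚᵘ (+ ℤ.∣ a ∣) 0))))))
    where
    bound : ∀ a → a ℤ.* + 1 ℤ.≤ + ℤ.∣ a ∣ ℤ.* + suc d
    bound (+ n)    = subst₂ ℤ._≤_ (sym (ℤₚ.*-identityʳ (+ n))) (ℤₚ.pos-* n (suc d)) (ℤ.+≤+ (ℕₚ.m≤m*n n (suc d)))
    bound -[1+ n ] = ℤₚ.≤-trans (ℤₚ.≤-reflexive (ℤₚ.*-identityʳ -[1+ n ])) ℤ.-≤+

  exceeds-multiple : ∀ {β} → 0ℚ < β → ∀ M → ∃[ t ] (M < times t β)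
  exceeds-multiple {β} β>0 M =
    let r , r>0 , βr≡1 = inverse β>0
        m , le = archimedean (M * r)
    in suc m , subst (M <_) (sym (times-ofℕ (suc m) β)) (close< (gap le ⊗ ℚₚ.<⇒≤ β>0 ⊕< β>0)
         (trans (cong (λ s → (1ℚ + ofℕ m) * β - s) (trans (sym (ℚₚ.*-identityʳ M)) (cong (λ s → M * s) (sym βr≡1))))
           (expand (ofℕ m) β M r)))
    where
    expand : ∀ m b M r → (1ℚ + m) * b - M * (b * r) ≡ (m - M * r) * b + b
    expand = solve-∀ ℚ-ring

  -- The count in `edges` takes every edge in its increasing orientation; exchanging the two
  -- variables supplies the other one.
  edges-density : ∀ {n} (G : Graph n) →
    ofℕ (edges G) + ofℕ (edges G) ≤ ∑ (allFin n) (λ x → ∑ (allFin n) (λ y → bit (adj G x y)))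
  edges-density {n} G = subst (_≤ ∑ xs (λ x → ∑ xs (λ y → bit (adj G x y))))
    (trans (trans (∑-cong xs λ x → ∑-+ xs (edge x) _) (∑-+ xs _ _)) (cong₂ _+_ (sym count) (sym (trans count (∑-swap xs xs edge)))))
    (∑-mono xs λ x → ∑-mono xs λ y → oriented x y)
    where
    xs = allFin n

    edge : Fin n → Fin n → ℚ
    edge x y = bit ((toℕ x ℕ.<ᵇ toℕ y) ∧ adj G x y)

    count : ofℕ (edges G) ≡ ∑ xs (λ x → ∑ xs (edge x))
    count = trans (ofℕ-sum xs _) (∑-cong xs λ x → trans (ofℕ-sum xs _) (∑-cong xs λ y → of-bit ((toℕ x ℕ.<ᵇ toℕ y) ∧ adj G x y)))
      where
      of-bit : ∀ b → ofℕ (if b then 1 else 0) ≡ bit b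
      of-bit true  = refl
      of-bit false = refl

    oriented : ∀ x y → edge x y + edge y x ≤ bit (adj G x y)
    oriented x y = cases (toℕ x ℕ.<ᵇ toℕ y) (toℕ y ℕ.<ᵇ toℕ x) (adj G x y) (adj G y x) (Graph.sym G x y)
      λ x<y y<x → ℕₚ.<-asym (ℕₚ.<ᵇ⇒< (toℕ x) (toℕ y) (Equivalence.from T-≡ x<y)) (ℕₚ.<ᵇ⇒< (toℕ y) (toℕ x) (Equivalence.from T-≡ y<x))
      where
      cases : ∀ p q a b → a ≡ b → (p ≡ true → q ≡ true → ⊥) → bit (p ∧ a) + bit (q ∧ b) ≤ bit a
      cases true  true  a     .a refl no = ⊥-elim (no refl refl)
      cases true  false true  .true  refl no = ℚₚ.≤-refl
      cases true  false false .false refl no = ℚₚ.≤-refl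
      cases false true  true  .true  refl no = ℚₚ.≤-refl
      cases false true  false .false refl no = ℚₚ.≤-refl
      cases false false true  .true  refl no = 0≤1
      cases false false false .false refl no = ℚₚ.≤-refl

  sum-bits : ∀ {A : Set} (P : A → Bool) xs → ∑ xs (λ x → bit (P x)) ≡ ofℕ (length (List.filterᵇ P xs))
  sum-bits P []       = refl
  sum-bits P (x ∷ xs) with P x
  ... | true  = cong (λ t → 1ℚ + t) (sum-bits P xs)
  ... | false = trans (ℚₚ.+-identityˡ _) (sum-bits P xs)

  module Constants (g : ℚ) (g>0 : 0ℚ < g) (g≤1 : g ≤ 1ℚ) (k : ℕ) (kg : 1ℚ + ofℕ 2 * g ≤ ofℕ k * g) where

    -- Levels are separated by g ≥ 16 τ₀ + 12 ξ, and ε = θ τ¹² allows for twelve conditionings by τ.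
    quarter = ½ * ½

    η ξ τ₀ τ θ P ε q β M : ℚ
    η  = g * quarter
    τ₀ = g * (quarter * quarter * ½)
    ξ  = τ₀
    τ  = τ₀ * quarter
    θ  = quarter * quarter * ½
    P  = power τ 12
    ε  = P * θ
    q  = 1ℚ - ε
    β  = ε * (η * (ε * (ξ * ξ)))
    M  = ofℕ k * (ofℕ k * 1ℚ) + ofℕ k * (ofℕ k * η)

    g≥0 = ℚₚ.<⇒≤ g>0

    quarter>0 : 0ℚ < quarter
    quarter>0 = from-yes (0ℚ ℚₚ.<? quarter)

    θ>0 : 0ℚ < θ
    θ>0 = from-yes (0ℚ ℚₚ.<? θ)

    η>0 : 0ℚ < η
    η>0 = g>0 ⊗< quarter>0

    τ₀>0 : 0ℚ < τ₀
    τ₀>0 = g>0 ⊗< θ>0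

    τ>0 : 0ℚ < τ
    τ>0 = τ₀>0 ⊗< quarter>0

    τ≤1 : τ ≤ 1ℚ
    τ≤1 = ℚₚ.≤-trans (close (g≥0 ⊗ from-yes (0ℚ ℚₚ.≤? (1ℚ - θ * quarter))) (expand g)) g≤1
      where
      expand : ∀ g → g - g * (½ * ½ * (½ * ½) * ½) * (½ * ½) ≡ g * (1ℚ - ½ * ½ * (½ * ½) * ½ * (½ * ½))
      expand = solve-∀ ℚ-ring

    P>0 : 0ℚ < P
    P>0 = power>0 τ>0 12

    P≤1 : P ≤ 1ℚ
    P≤1 = power-anti τ>0 τ≤1 {0} {12} (ℕₚ.≤⇒≤′ ℕ.z≤n)

    ε>0 : 0ℚ < ε
    ε>0 = P>0 ⊗< θ>0

    ε≤½ : ε ≤ ½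
    ε≤½ = close (gap P≤1 ⊗ ℚₚ.<⇒≤ θ>0 ⊕ from-yes (0ℚ ℚₚ.≤? (½ - θ))) (expand P)
      where
      expand : ∀ p → ½ - p * (½ * ½ * (½ * ½) * ½) ≡ (1ℚ - p) * (½ * ½ * (½ * ½) * ½) + (½ - ½ * ½ * (½ * ½) * ½)
      expand = solve-∀ ℚ-ring

    q>0 : 0ℚ < q
    q>0 = close< (gap ε≤½ ⊕< from-yes (0ℚ ℚₚ.<? ½)) (expand ε)
      where
      expand : ∀ e → 1ℚ - e - 0ℚ ≡ ½ - e + ½
      expand = solve-∀ ℚ-ring

    ε≤q : ε ≤ q
    ε≤q = close (gap ε≤½ ⊕ gap ε≤½) (expand ε)
      where
      expand : ∀ e → 1ℚ - e - e ≡ ½ - e + (½ - e)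
      expand = solve-∀ ℚ-ring

    β>0 : 0ℚ < β
    β>0 = ε>0 ⊗< (η>0 ⊗< (ε>0 ⊗< (τ₀>0 ⊗< τ₀>0)))

    fuel : ℕ
    fuel = proj₁ (exceeds-multiple β>0 M)

    -- `c` is the loss over the whole regularisation. `b` is the smallest fraction of the vertices
    -- in which a K₄ is ever sought: the share `P` left after twelve conditionings, times `c`, times
    -- the half that survives the removal of bad vertices.
    c b : ℚ
    c = scale ε fuel 1ℚ
    b = P * c * ½

    c>0 : 0ℚ < c
    c>0 = scale>0 ε>0 fuel 0<1

    b>0 : 0ℚ < b
    b>0 = P>0 ⊗< c>0 ⊗< from-yes (0ℚ ℚₚ.<? ½)

    -- An integer above 1/b: this many copies of a set of b n vertices provide n vertices.
    copies : ℕ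
    copies = proj₁ (archimedean (proj₁ (inverse b>0)))

    copies-b : 1ℚ ≤ ofℕ copies * b
    copies-b = let r , _ , br≡1 = inverse b>0 in
      close (gap (proj₂ (archimedean r)) ⊗ ℚₚ.<⇒≤ b>0) (trans (cong (λ s → ofℕ copies * b - s) (sym br≡1)) (expand (ofℕ copies) b r))
      where
      expand : ∀ m b r → m * b - b * r ≡ (m - r) * b
      expand = solve-∀ ℚ-ring

    module _ (n : ℕ) (n≥1 : 1 ℕ.≤ n) (G : Graph n) (free : KFree 12 G)
      (small : ∀ a q → IsIndepNum G a → IsQ 4 n q → copies ℕ.* a ℕ.< q)
      (u : ℚ) (u>0 : 0ℚ < u) (nu≡1 : ofℕ n * u ≡ 1ℚ) where

      private
        xs = allFin n
        A : Fin n → Fin n → ℚ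
        A x y = bit (adj G x y)
        A-sym : ∀ x y → A x y ≡ A y x
        A-sym x y = cong bit (Graph.sym G x y)

      open Embed xs (adj G) (Graph.sym G)
      module C = Counting xs A A-sym (λ x y → bit≥0 _) (λ x y → bit≤1 _)
      open Energy {k} η (ℚₚ.<⇒≤ η>0)

      constants : Constants
      constants = record
        { ε = ε ; q = q ; r = proj₁ (inverse q>0) ; ξ = ξ ; u = u ; ε>0 = ε>0 ; ξ≥0 = ℚₚ.<⇒≤ τ₀>0
        ; q≥0 = ℚₚ.<⇒≤ q>0 ; r≥0 = ℚₚ.<⇒≤ (proj₁ (proj₂ (inverse q>0))) ; ε+q≡1 = expand ε
        ; q*r≡1 = proj₂ (proj₂ (inverse q>0)) ; ε≤q = ε≤q }
        where
        expand : ∀ e → e + (1ℚ - e) ≡ 1ℚ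
        expand = solve-∀ ℚ-ring

      open Regularise constants using (Distributions; Bounded; regularise)

      uniform : Fin n → ℚ
      uniform _ = u

      uniform-dist : Distribution uniform
      uniform-dist = record { nonNeg = λ _ → ℚₚ.<⇒≤ u>0
        ; total = trans (∑-const xs u) (trans (cong (λ l → ofℕ l * u) (Listₚ.length-tabulate {n = n} (λ x → x))) nu≡1) }

      K₄-in-heavy : ∀ S → b ≤ u * ∑ xs (λ x → bit (S x)) →
        (∀ qs → length qs ≡ 4 → AllAdjacent qs → All (λ q → S q ≡ true) qs → ⊥) → ⊥
      K₄-in-heavy S heavy none = clique-in-large-set {m = copies} G small W
        (Uniqueₚ.filter⁺ (λ x → T? (S x)) (Uniqueₚ.allFin⁺ n)) large
        λ qs len cl qs⊆W → none qs len cl (All.map (λ q∈ →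
           Equivalence.to T-≡ (proj₂ (Memₚ.∈-filter⁻ (λ x → T? (S x)) {xs = xs} q∈))) qs⊆W)
        where
        W = List.filterᵇ S xs
        large : n ℕ.≤ copies ℕ.* length W
        large = ofℕ-reflects-≤ (subst (ofℕ n ≤_) (sym (ofℕ-* copies (length W))) (close
          ((ofℕ≥0 copies ⊗ ofℕ≥0 n) ⊗ gap (subst (λ t → b ≤ u * t) (sum-bits S xs) heavy) ⊕ ofℕ≥0 n ⊗ gap copies-b)
          (trans (expand (ofℕ copies) (ofℕ n) u b (ofℕ (length W)))
            (trans (cong (λ s → rest + ofℕ copies * ofℕ (length W) * (1ℚ - s)) nu≡1) (vanish rest (ofℕ copies * ofℕ (length W)))))))
          where
          rest = ofℕ copies * ofℕ n * (u * ofℕ (length W) - b) + ofℕ n * (ofℕ copies * b - 1ℚ)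
          expand : ∀ m n u b w → m * w - n ≡ m * n * (u * w - b) + n * (m * b - 1ℚ) + m * w * (1ℚ - n * u)
          expand = solve-∀ ℚ-ring
          vanish : ∀ r a → r + a * (1ℚ - 1ℚ) ≡ r
          vanish = solve-∀ ℚ-ring

      module Structured (μ : Fin k → Fin n → ℚ) (μ-dist : Distributions μ) (bounded : Bounded c μ)
        (regular : Regular ε ξ μ) where

        L : Fin k → Fin k → ℕ
        L = C.clusterLevel g μ

        L-sym : ∀ a b → L a b ≡ L b a
        L-sym = C.clusterLevel-sym g g≥0 μ μ-dist

        L-irrefl : ∀ a → L a a ≡ 0
        L-irrefl = C.clusterLevel-irrefl g g≥0 μ μ-dist

        private
          four-quarters : ∀ t → ofℕ 4 * (t * (½ * ½)) ≡ t
          four-quarters = solve-∀ ℚ-ring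
          thresholds : ∀ l g w → ofℕ 4 * (w - (g * (½ * ½ * (½ * ½) * ½) + g * (½ * ½ * (½ * ½) * ½) + g * (½ * ½ * (½ * ½) * ½)))
            - (l + pow2 4 * (g * (½ * ½ * (½ * ½) * ½))) ≡ ofℕ 4 * w - (l + g) + g * (½ * ½ * ½)
          thresholds = solve-∀ ℚ-ring

        -- With ξ = τ₀ = g/32, the required 16 τ₀ + 12 ξ amounts to 7g/8, so that g/8 is to spare.
        open Embedding μ L L-irrefl {ε} {ξ} {u} {c} {θ} {τ} {τ₀} {b} (ℚₚ.<⇒≤ c>0) τ₀>0 θ>0 (from-yes (ofℕ 12 * θ ℚₚ.≤? ½)) τ>0 τ₀>0
          (ℚₚ.≤-reflexive (four-quarters τ₀)) bounded regular
          (λ {i} {j} l _ le → close (gap (C.clusterLevel-density g g≥0 μ μ-dist {i} {j} l le) ⊕ g≥0 ⊗ from-yes (0ℚ ℚₚ.≤? (½ * ½ * ½)))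
            (thresholds (ofℕ l) g (density (μ i) (μ j))))
          K₄-in-heavy

        -- After `j` conditionings the share is still at least τ^j. As at most twelve take place, it
        -- never falls below `P` while a cluster remains to be processed.
        enough : ∀ n j {κ} → n ℕ.+ j ℕ.≤ 12 → power τ j ≤ κ → Enough n κ
        enough zero    j le κ≥ = _
        enough (suc n) j {κ} le κ≥ = κ≥0 , ε≤κ , ε≤κθ , b≤ , enough n (suc j) (subst (ℕ._≤ 12) (sym (ℕₚ.+-suc n j)) le)
            (close (gap κ≥ ⊗ ℚₚ.<⇒≤ τ>0) (factor κ (power τ j) τ))
          where
          P≤κ : P ≤ κ
          P≤κ = ℚₚ.≤-trans (power-anti τ>0 τ≤1 (ℕₚ.≤⇒≤′ (ℕₚ.≤-trans (ℕₚ.m≤n+m j (suc n)) le))) κ≥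
          κ≥0 = ℚₚ.≤-trans (ℚₚ.<⇒≤ P>0) P≤κ
          factor : ∀ k p t → k * t - p * t ≡ (k - p) * t
          factor = solve-∀ ℚ-ring
          ε≤κθ : ε ≤ κ * θ
          ε≤κθ = close (gap P≤κ ⊗ ℚₚ.<⇒≤ θ>0) (factor κ P θ)
          ε≤κ : ε ≤ κ
          ε≤κ = ℚₚ.≤-trans ε≤κθ (close (κ≥0 ⊗ from-yes (0ℚ ℚₚ.≤? (1ℚ - θ))) (factor′ κ θ))
            where
            factor′ : ∀ k t → k - k * t ≡ k * (1ℚ - t)
            factor′ = solve-∀ ℚ-ring
          b≤ : b ≤ κ * c * ½
          b≤ = close (gap P≤κ ⊗ (ℚₚ.<⇒≤ c>0 ⊗ from-yes (0ℚ ℚₚ.≤? ½))) (factor″ κ P c ½)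
            where
            factor″ : ∀ k p c h → k * c * h - p * c * h ≡ (k - p) * (c * h)
            factor″ = solve-∀ ℚ-ring

        embed : ∀ {n} (s : State n) (vs : Vec (Fin k) n) → (∀ i j → level s i j ℕ.≤ L (lookup vs i) (lookup vs j)) →
          n ℕ.≤ 12 → T (positive s) → 12 ℕ.≤ cliqueSize s → ⊥
        embed {n} s vs realises n≤12 pos big = embedClique s vs realises pos n≤12
          (enough n 0 (subst (ℕ._≤ 12) (sym (ℕₚ.+-identityʳ n)) n≤12) (ℚₚ.≤-refl {1ℚ})) []
          (λ j → record { measure = μ (lookup vs j) ; dist = μ-dist (lookup vs j)
                        ; within = λ x → ℚₚ.≤-reflexive (ℚₚ.*-identityˡ (μ (lookup vs j) x)) ; support = λ _ _ → [] })
          λ C′ C′-cl size → clique-bound G free C′ C′-cl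
            (ℕₚ.≤-trans big (ℕₚ.≤-trans (ℕₚ.≤-reflexive (sym (ℕₚ.+-identityʳ (cliqueSize s)))) size))

        open Deletion L L-sym L-irrefl

        -- Any cluster of the dense core realises the one-cluster opening state, and the strategy
        -- refutes that state.
        too-dense : 32 ℕ.* (k ℕ.* k ℕ.+ k) ℕ.< 13 ℕ.* totalDegree (allFin k) → ⊥
        too-dense dense = dense-core k (allFin k) (Listₚ.length-tabulate {n = k} (λ x → x)) dense contradiction
          where
          contradiction : ∀ S → 1 ℕ.≤ length S → (∀ {i} → i ∈ S → 32 ℕ.* length S ℕ.< 13 ℕ.* degreeIn S i) → ⊥
          contradiction S@(v ∷ _) _ high = All.lookup refuted opening∈strategy
            (v ∷ []) (here refl ∷ []) λ { Fin.zero Fin.zero → ℕ.z≤n }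
            where
            open Soundness L (C.clusterLevel≤4 g g≥0 μ μ-dist) L-sym S (respond S high)
            refuted = refutable embed strategy strategy-checks

      not-dense : ofℕ 8 + ofℕ 26 * g ≤ ofℕ 13 * density uniform uniform → ⊥
      not-dense dense = regularise M (C.energy≤ η (ℚₚ.<⇒≤ η>0)) fuel (λ _ → uniform) 0≤1 (λ _ → uniform-dist)
        (λ _ _ → ℚₚ.≤-reflexive (ℚₚ.*-identityˡ u)) start finish
        where
        E₀ = energy (λ _ → uniform)

        k>0 : 0ℚ < ofℕ k
        k>0 = positive-k k kg
          where
          positive-k : ∀ k → 1ℚ + ofℕ 2 * g ≤ ofℕ k * g → 0ℚ < ofℕ k
          positive-k zero    kg = ⊥-elim (absurd (ofℕ≥0 2 ⊗ g≥0 ⊕< 0<1) (close (gap kg) (expand g)))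
            where
            expand : ∀ g → 0ℚ - (ofℕ 2 * g + 1ℚ) ≡ 0ℚ * g - (1ℚ + ofℕ 2 * g)
            expand = solve-∀ ℚ-ring
          positive-k (suc k) kg = ofℕ>0 k

        k≥1 : 1ℚ ≤ ofℕ k
        k≥1 = ofℕ-mono {1} {k} (ofℕ-reflects-< {0} {k} k>0)

        E₀≥ : (ofℕ k * ofℕ k - ofℕ k) * density uniform uniform ≤ E₀
        E₀≥ = C.energy-constant {k} η (ℚₚ.<⇒≤ η>0) uniform-dist

        start : M < E₀ + times fuel β
        start = ℚₚ.<-≤-trans (proj₂ (exceeds-multiple β>0 M)) (close E₀≥0 (expand E₀ (times fuel β)))
          where
          expand : ∀ e t → e + t - t ≡ e
          expand = solve-∀ ℚ-ring
          E₀≥0 : 0ℚ ≤ E₀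
          E₀≥0 = ℚₚ.≤-trans (subst (0ℚ ≤_) (factor (ofℕ k) (density uniform uniform))
              (ℚₚ.<⇒≤ k>0 ⊗ gap k≥1 ⊗ density≥0 uniform-dist uniform-dist)) E₀≥
            where
            factor : ∀ k w → k * (k - 1ℚ) * w ≡ (k * k - k) * w
            factor = solve-∀ ℚ-ring

        finish : ∀ μ → Distributions μ → Bounded c μ → E₀ ≤ energy μ → Regular ε ξ μ → ⊥
        finish μ μ-dist bounded up regular = too-dense (ofℕ-reflects-< (subst₂ _<_
            (sym (trans (ofℕ-* 32 (k ℕ.* k ℕ.+ k)) (cong (ofℕ 32 *_) (trans (ofℕ-+ (k ℕ.* k) k) (cong (_+ ofℕ k) (ofℕ-* k k))))))
            (sym (ofℕ-* 13 (totalDegree (allFin k))))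
            (C.excess {ofℕ k} {g} {η} {density uniform uniform} {E₀} {energy μ} {C.totalDensity μ} {ofℕ (totalDegree (allFin k))}
              k>0 g≥0 (quarters g) k≥1 kg dense E₀≥ up
              (C.energy≤density η (ℚₚ.<⇒≤ η>0) μ μ-dist) (C.totalDensity≤levels g g≥0 μ μ-dist))))
          where
          open Structured μ μ-dist bounded regular
          open Deletion L L-sym L-irrefl
          quarters : ∀ g → g ≡ ofℕ 4 * (g * (½ * ½))
          quarters = solve-∀ ℚ-ring

  sparse-of-K₁₂-free : ∀ (g : ℚ) → 0ℚ < g → g ≤ 1ℚ → ∀ k → 1ℚ + ofℕ 2 * g ≤ ofℕ k * g →
    ∃[ m ] (∀ n → 1 ℕ.≤ n → (G : Graph n) → KFree 12 G → (∀ a q → IsIndepNum G a → IsQ 4 n q → m ℕ.* a ℕ.< q) → ∀ u → 0ℚ < u → ofℕ n * u ≡ 1ℚ →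
    ofℕ 8 + ofℕ 26 * g ≤ ofℕ 13 * ∑ (allFin n) (λ x → u * ∑ (allFin n) (λ y → u * bit (adj G x y))) → ⊥)
  sparse-of-K₁₂-free g g>0 g≤1 k kg = copies , not-dense
    where open Constants g g>0 g≤1 k kg

-- Translation to edge counts
module Quantitative where

  open Sparsity
  open Rationals
  open import Defs hiding (sym)
  open LargeSets using (Q-positive)
  open import Data.Empty using (⊥-elim)
  open import Data.Fin using (Fin)
  open import Data.Integer using (+_)
  open import Data.List using (allFin)
  open import Data.Nat as ℕ using (ℕ; suc)
  open import Data.Product using (∃-syntax; _×_; _,_)
  open import Data.Rational using (ℚ; 0ℚ; 1ℚ; _≤_; _<_; _+_; _*_; _-_; -_; _/_)
  import Data.Rational.Properties as ℚₚ
  open import Data.Sum using (_⊎_; [_,_]′)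
  open import Relation.Binary.PropositionalEquality using (_≡_; _≢_; sym; trans; cong; cong₂; subst; subst₂)
  open import Tactic.RingSolver using (solve-∀)

  -- With g = 1/m, taking k = m + 2 clusters gives k g = 1 + 2 g, as the counting of levels demands.
  unit-fraction : ∀ {γ} → 0ℚ < γ → ∃[ m ] ∃[ g ] (0ℚ < g × g ≤ γ × g ≤ 1ℚ × ofℕ m * g ≡ 1ℚ)
  unit-fraction {γ} γ>0 =
    let r , r>0 , γr≡1 = inverse γ>0
        m , r≤m = archimedean r
        g , g>0 , mg≡1 = inverse (ofℕ>0 m)
    in suc m , g , g>0
     , close (ℚₚ.<⇒≤ γ>0 ⊗ (0≤1 ⊕ gap r≤m) ⊗ ℚₚ.<⇒≤ g>0)
         (trans (expand γ r (ofℕ m) g) (trans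
           (cong₂ (λ a b → γ * (1ℚ + (ofℕ m - r)) * g + γ * (1ℚ - a) + g * (b - 1ℚ)) mg≡1 γr≡1) (vanish _ γ g)))
     , close (ofℕ≥0 m ⊗ ℚₚ.<⇒≤ g>0) (trans (cong (_- g) (sym mg≡1)) (one-less (ofℕ m) g))
     , mg≡1
    where
    expand : ∀ c r m g → c - g ≡ c * (1ℚ + (m - r)) * g + c * (1ℚ - (1ℚ + m) * g) + g * (c * r - 1ℚ)
    expand = solve-∀ ℚ-ring
    vanish : ∀ a c g → a + c * (1ℚ - 1ℚ) + g * (1ℚ - 1ℚ) ≡ a
    vanish = solve-∀ ℚ-ring
    one-less : ∀ m g → (1ℚ + m) * g - g ≡ m * g
    one-less = solve-∀ ℚ-ring

  -- The uniform pair density is at least 2 e(G)/n², and 13 · 2 · (4/13 + γ) = 8 + 26 γ.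
  density-from-edges : ∀ {n γ g u} (G : Graph n) → g ≤ γ → ofℕ n * u ≡ 1ℚ → 0ℚ ≤ u →
    ((+ 4) / 13 + γ) * ofℕ (n ℕ.* n) < ofℕ (edges G) →
    ofℕ 8 + ofℕ 26 * g ≤ ofℕ 13 * ∑ (allFin n) (λ x → u * ∑ (allFin n) (λ y → u * bit (adj G x y)))
  density-from-edges {n} {γ} {g} {u} G g≤γ nu≡1 u≥0 many = subst (λ d → ofℕ 8 + ofℕ 26 * g ≤ ofℕ 13 * d) (sym factor-out)
    (close (ofℕ≥0 13 ⊗ (u≥0 ⊗ u≥0) ⊗ gap (edges-density G)
        ⊕ ofℕ≥0 26 ⊗ (u≥0 ⊗ u≥0) ⊗ gap (subst (λ N → ((+ 4) / 13 + γ) * N ≤ e) (ofℕ-* n n) (ℚₚ.<⇒≤ many))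
        ⊕ ofℕ≥0 26 ⊗ gap g≤γ)
      (trans (expand u E e γ g (ofℕ n)) (trans (cong (λ z → rest + ofℕ 26 * ((+ 4) / 13 + γ) * (z * z - 1ℚ)) nu≡1)
        (vanish rest (ofℕ 26 * ((+ 4) / 13 + γ))))))
    where
    E = ∑ (allFin n) λ x → ∑ (allFin n) λ y → bit (adj G x y)
    e = ofℕ (edges G)
    rest = ofℕ 13 * (u * u) * (E - (e + e)) + ofℕ 26 * (u * u) * (e - ((+ 4) / 13 + γ) * (ofℕ n * ofℕ n)) + ofℕ 26 * (γ - g)
    factor-out : ∑ (allFin n) (λ x → u * ∑ (allFin n) (λ y → u * bit (adj G x y))) ≡ u * (u * E)
    factor-out = trans (∑-scale (allFin n) u _) (cong (u *_)
      (trans (∑-cong (allFin n) λ x → ∑-scale (allFin n) u _) (∑-scale (allFin n) u _)))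
    expand : ∀ u E e γ g n → ofℕ 13 * (u * (u * E)) - (ofℕ 8 + ofℕ 26 * g) ≡
      ofℕ 13 * (u * u) * (E - (e + e)) + ofℕ 26 * (u * u) * (e - ((+ 4) / 13 + γ) * (n * n)) + ofℕ 26 * (γ - g)
      + ofℕ 26 * ((+ 4) / 13 + γ) * (n * u * (n * u) - 1ℚ)
    expand = solve-∀ ℚ-ring
    vanish : ∀ r a → r + a * (1ℚ * 1ℚ - 1ℚ) ≡ r
    vanish = solve-∀ ℚ-ring

  -- Since δ = 1/(m + 1), m a ≤ m δ q = q - δ q, which is less than q because q ≥ 1.
  scaled-bound : ∀ {n δ m} → 0ℚ < δ → ofℕ (suc m) * δ ≡ 1ℚ → 1 ℕ.≤ n → ∀ {a q} → IsQ 4 n q → ofℕ a ≤ δ * ofℕ q → m ℕ.* a ℕ.< q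
  scaled-bound {n} {δ} {m} δ>0 mδ≡1 n≥1 {a} {q} isQ a≤ = ofℕ-reflects-< (subst (_< ofℕ q) (sym (ofℕ-* m a))
    (close< (ofℕ≥0 m ⊗ gap a≤ ⊕< δ>0 ⊗< ℚₚ.<-≤-trans 0<1 (ofℕ-mono (Q-positive n≥1 isQ)))
      (trans (cong (_- ofℕ m * ofℕ a) (trans (sym (ℚₚ.*-identityˡ (ofℕ q))) (cong (_* ofℕ q) (sym mδ≡1))))
        (expand (ofℕ m) (ofℕ a) (ofℕ q) δ))))
    where
    expand : ∀ m a q d → (1ℚ + m) * d * q - m * a ≡ m * (d * q - a) + d * q
    expand = solve-∀ ℚ-ring

  linear : ∀ {m g} → ofℕ m * g ≡ 1ℚ → 1ℚ + ofℕ 2 * g ≡ ofℕ (2 ℕ.+ m) * g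
  linear {m} {g} mg≡1 = trans (cong (λ s → s + ofℕ 2 * g) (sym mg≡1)) (expand (ofℕ m) g)
    where
    expand : ∀ m g → m * g + ofℕ 2 * g ≡ (1ℚ + (1ℚ + m)) * g
    expand = solve-∀ ℚ-ring

  ofℕ-positive : ∀ {n} → 1 ℕ.≤ n → 0ℚ < ofℕ n
  ofℕ-positive {suc n} _ = ofℕ>0 n

open import Defs
open import Data.Nat using (ℕ; _≥_)
open import Data.Integer using (+_)
open import Data.Rational using (ℚ; 0ℚ; _<_; _≤_; _+_; _*_; _/_)
open import Data.Product using (∃-syntax; _×_)
open import Data.Empty using (⊥-elim)
open import Data.Product using (_,_)
import Data.Rational.Properties as ℚₚ
open import Data.Sum using ([_,_]′)
open import Relation.Binary.PropositionalEquality using (subst₂) renaming (sym to ≡-sym)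
open Rationals using (ofℕ>0; inverse; _≤⊎>_)
open Sparsity using (ℕtoℚ≡ofℕ; sparse-of-K₁₂-free)
open Quantitative

theorem1p5 : ∀ (γ : ℚ) → 0ℚ < γ →
    ∃[ δ ] (0ℚ < δ × ∃[ N ] (∀ (n : ℕ) → n ≥ N → (G : Graph n) → KFree 12 G →
    (∀ a q → IsIndepNum G a → IsQ 4 n q → ℕtoℚ a ≤ δ * ℕtoℚ q) →
    ℕtoℚ (edges G) ≤ ((+ 4) / 13 + γ) * ℕtoℚ (n Data.Nat.* n)))
theorem1p5 γ γ>0 =
  let m , g , g>0 , g≤γ , g≤1 , mg≡1 = unit-fraction γ>0
      c , sparse = sparse-of-K₁₂-free g g>0 g≤1 (2 Data.Nat.+ m) (ℚₚ.≤-reflexive (linear {m} mg≡1))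
      δ , δ>0 , cδ≡1 = inverse (ofℕ>0 c)
  -- `N = 1`: the constants depend on γ alone, and n ≥ 1 provides the uniform measure and Q(4,n) ≥
  -- 1.
  in δ , δ>0 , 1 , λ n n≥1 G free small →
    subst₂ (λ e N → e ≤ ((+ 4) / 13 + γ) * N) (≡-sym (ℕtoℚ≡ofℕ (edges G))) (≡-sym (ℕtoℚ≡ofℕ (n Data.Nat.* n)))
      ([ (λ le → le)
       , (λ many → let u , u>0 , nu≡1 = inverse (ofℕ-positive n≥1) in ⊥-elim (sparse n n≥1 G free
           (λ a q isA isQ → scaled-bound {m = c} δ>0 cδ≡1 n≥1 isQ
             (subst₂ (λ s t → s ≤ δ * t) (ℕtoℚ≡ofℕ a) (ℕtoℚ≡ofℕ q) (small a q isA isQ)))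
           u u>0 nu≡1 (density-from-edges G g≤γ nu≡1 (ℚₚ.<⇒≤ u>0) many)))
       ]′ (Rationals.ofℕ (edges G) ≤⊎> ((+ 4) / 13 + γ) * Rationals.ofℕ (n Data.Nat.* n)))
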